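{- Let $n,m\ge 1$ be integers and let $V(n,m)=\{1,\dots,n\}\times\{1,\dots,m\}\subset\mathbb{R}^2$. The minimum number of segments of a (possibly self-crossing) polygonal path covering $V(n,m)$ is $2\min(n,m)-2$ if $n=m\ge 3$, and $2\min(n,m)-1$ otherwise. The minimum number of segments of a noncrossing polygonal path covering $V(n,m)$ is $2\min(n,m)-1$ for all $n,m\ge 1$.
   Context: $V(n,m)$ is the vertex set of the $n\times m$ orthogonal unit grid ($n$ columns, $m$ rows). A polygonal path is a sequence of points $p_0,p_1,\dots,p_k$ in the plane ($k\ge 1$) together with the closed straight-line segments $p_{i-1}p_i$, $i=1,\dots,k$, each of positive length; its number of segments is $k$. The turning points $p_i$ may be arbitrary points of the plane (not necessarily grid points). The path covers a point set $P$ if every point of $P$ lies on the union of its segments. The path is noncrossing if any two of its segments intersect only when they are consecutive, and then only in their common endpoint. -}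

module Defs where

open import Algebra.Bundles using (CommutativeMonoid)
import Algebra.Properties.CommutativeSemigroup as CommutativeSemigroupProperties
open import Data.Fin.Base as Fin using (Fin; inject₁; toℕ)
open import Data.Integer.Base using (+_)
open import Data.Nat.Base as ℕ using (ℕ; suc)
import Data.Nat.Properties as ℕ
open import Data.Product.Base using (_×_; _,_; ∃; ∃₂)
open import Data.Rational.Base as ℚ using (ℚ; 0ℚ; 1ℚ; ½)
import Data.Rational.Properties as ℚ
open import Relation.Binary.PropositionalEquality using (_≡_; sym; trans; cong; cong₂; subst)
open import Relation.Unary using (Pred; _⊆_; ⋃)
open import Level using (0ℓ)

-- Real numbers are Cauchy sequences of rationals; their equality is the
-- setoid relation _≈_ below, not _≡_.

Eventually : Pred ℕ 0ℓ → Set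
Eventually P = ∃ λ N → ∀ i → N ℕ.≤ i → P i

Cauchy : (ℕ → ℚ) → Set
Cauchy s = ∀ ε → 0ℚ ℚ.< ε →
  ∃ λ N → ∀ i j → N ℕ.≤ i → N ℕ.≤ j → ℚ.∣ s i ℚ.- s j ∣ ℚ.< ε

record ℝ : Set where
  constructor mkℝ
  field
    seq    : ℕ → ℚ
    cauchy : Cauchy seq

open ℝ public

private
  module +-props = CommutativeSemigroupProperties (CommutativeMonoid.commutativeSemigroup ℚ.+-0-commutativeMonoid)
  module *-props = CommutativeSemigroupProperties (CommutativeMonoid.commutativeSemigroup ℚ.*-1-commutativeMonoid)

abstract
  p-q+q≡p : ∀ p q → (p ℚ.- q) ℚ.+ q ≡ p
  p-q+q≡p p q = trans (ℚ.+-assoc p (ℚ.- q) q)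
    (trans (cong (p ℚ.+_) (ℚ.+-inverseˡ q)) (ℚ.+-identityʳ p))

  half-pos : ∀ {ε} → 0ℚ ℚ.< ε → 0ℚ ℚ.< ε ℚ.* ½
  half-pos {ε} 0<ε = subst (ℚ._< ε ℚ.* ½) (ℚ.*-zeroˡ ½) (ℚ.*-monoˡ-<-pos ½ 0<ε)

  half+half : ∀ ε → ε ℚ.* ½ ℚ.+ ε ℚ.* ½ ≡ ε
  half+half ε = trans (sym (ℚ.*-distribˡ-+ ε ½ ½)) (ℚ.*-identityʳ ε)

  +-cauchy : ∀ s t → Cauchy s → Cauchy t → Cauchy (λ i → s i ℚ.+ t i)
  +-cauchy s t cs ct ε 0<ε with cs (ε ℚ.* ½) (half-pos 0<ε) | ct (ε ℚ.* ½) (half-pos 0<ε)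
  ... | M , hs | N , ht = M ℕ.⊔ N , λ i j pi pj → begin-strict
    ℚ.∣ (s i ℚ.+ t i) ℚ.- (s j ℚ.+ t j) ∣
      ≡⟨ cong ℚ.∣_∣ (regroup (s i) (t i) (s j) (t j)) ⟩
    ℚ.∣ (s i ℚ.- s j) ℚ.+ (t i ℚ.- t j) ∣
      ≤⟨ ℚ.∣p+q∣≤∣p∣+∣q∣ (s i ℚ.- s j) (t i ℚ.- t j) ⟩
    ℚ.∣ s i ℚ.- s j ∣ ℚ.+ ℚ.∣ t i ℚ.- t j ∣
      <⟨ ℚ.+-mono-< (hs i j (ℕ.m⊔n≤o⇒m≤o M N pi) (ℕ.m⊔n≤o⇒m≤o M N pj))
                    (ht i j (ℕ.m⊔n≤o⇒n≤o M N pi) (ℕ.m⊔n≤o⇒n≤o M N pj)) ⟩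
    ε ℚ.* ½ ℚ.+ ε ℚ.* ½
      ≡⟨ half+half ε ⟩
    ε ∎
    where
    open ℚ.≤-Reasoning
    regroup : ∀ a b c d → (a ℚ.+ b) ℚ.- (c ℚ.+ d) ≡ (a ℚ.- c) ℚ.+ (b ℚ.- d)
    regroup a b c d = trans (cong ((a ℚ.+ b) ℚ.+_) (ℚ.neg-distrib-+ c d))
      (+-props.interchange a b (ℚ.- c) (ℚ.- d))

  neg-cauchy : ∀ s → Cauchy s → Cauchy (λ i → ℚ.- s i)
  neg-cauchy s cs ε 0<ε with cs ε 0<ε
  ... | N , h = N , λ i j pi pj → subst (ℚ._< ε) (flip (s i) (s j)) (h i j pi pj)
    where
    flip : ∀ a b → ℚ.∣ a ℚ.- b ∣ ≡ ℚ.∣ ℚ.- a ℚ.- (ℚ.- b) ∣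
    flip a b = trans (sym (ℚ.∣-p∣≡∣p∣ (a ℚ.- b)))
      (cong ℚ.∣_∣ (ℚ.neg-distrib-+ a (ℚ.- b)))

  eventually-bounded : ∀ s → Cauchy s →
    ∃ λ B → ℚ.Positive B × Eventually (λ i → ℚ.∣ s i ∣ ℚ.< B)
  eventually-bounded s cs with cs 1ℚ (ℚ.positive⁻¹ 1ℚ)
  ... | N , h = 1ℚ ℚ.+ ℚ.∣ s N ∣ ,
    ℚ.pos+nonNeg⇒pos 1ℚ ℚ.∣ s N ∣ {{ℚ.∣-∣-nonNeg (s N)}} ,
    N , λ i pi → begin-strict
      ℚ.∣ s i ∣                           ≡⟨ cong ℚ.∣_∣ (p-q+q≡p (s i) (s N)) ⟨
      ℚ.∣ (s i ℚ.- s N) ℚ.+ s N ∣         ≤⟨ ℚ.∣p+q∣≤∣p∣+∣q∣ (s i ℚ.- s N) (s N) ⟩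
      ℚ.∣ s i ℚ.- s N ∣ ℚ.+ ℚ.∣ s N ∣     <⟨ ℚ.+-monoˡ-< ℚ.∣ s N ∣ (h i N pi ℕ.≤-refl) ⟩
      1ℚ ℚ.+ ℚ.∣ s N ∣                    ∎
    where
    open ℚ.≤-Reasoning

  *-bound : ∀ {a b B δ} → .{{ℚ.Positive B}} →
    ℚ.∣ a ∣ ℚ.< B → ℚ.∣ b ∣ ℚ.< δ → ℚ.∣ a ℚ.* b ∣ ℚ.< B ℚ.* δ
  *-bound {a} {b} {B} {δ} a<B b<δ = begin-strict
    ℚ.∣ a ℚ.* b ∣           ≡⟨ ℚ.∣p*q∣≡∣p∣*∣q∣ a b ⟩
    ℚ.∣ a ∣ ℚ.* ℚ.∣ b ∣     ≤⟨ ℚ.*-monoʳ-≤-nonNeg ℚ.∣ b ∣ {{ℚ.∣-∣-nonNeg b}} (ℚ.<⇒≤ a<B) ⟩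
    B ℚ.* ℚ.∣ b ∣           <⟨ ℚ.*-monoʳ-<-pos B b<δ ⟩
    B ℚ.* δ                 ∎
    where open ℚ.≤-Reasoning

  *-cauchy : ∀ s t → Cauchy s → Cauchy t → Cauchy (λ i → s i ℚ.* t i)
  *-cauchy s t cs ct ε 0<ε with eventually-bounded s cs | eventually-bounded t ct
  ... | B , B>0 , K , hB | C , C>0 , L , hC = conclude (cs δ 0<δ) (ct δ 0<δ)
    where
    open ℚ.≤-Reasoning

    D : ℚ
    D = B ℚ.+ C

    instance
      B>0′ : ℚ.Positive B
      B>0′ = B>0
      C>0′ : ℚ.Positive C
      C>0′ = C>0
      D>0 : ℚ.Positive D
      D>0 = ℚ.pos+pos⇒pos B C
      D≢0 : ℚ.NonZero D
      D≢0 = ℚ.pos⇒nonZero D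

    δ : ℚ
    δ = ε ℚ.* ℚ.1/ D

    0<δ : 0ℚ ℚ.< δ
    0<δ = subst (ℚ._< δ) (ℚ.*-zeroˡ (ℚ.1/ D)) (ℚ.*-monoˡ-<-pos (ℚ.1/ D) {{ℚ.1/pos⇒pos D}} 0<ε)

    Dδ≡ε : B ℚ.* δ ℚ.+ C ℚ.* δ ≡ ε
    Dδ≡ε = begin-equality
      B ℚ.* δ ℚ.+ C ℚ.* δ     ≡⟨ ℚ.*-distribʳ-+ δ B C ⟨
      D ℚ.* (ε ℚ.* ℚ.1/ D)    ≡⟨ *-props.x∙yz≈y∙xz D ε (ℚ.1/ D) ⟩
      ε ℚ.* (D ℚ.* ℚ.1/ D)    ≡⟨ cong (ε ℚ.*_) (ℚ.*-inverseʳ D) ⟩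
      ε ℚ.* 1ℚ                ≡⟨ ℚ.*-identityʳ ε ⟩
      ε                       ∎

    expand : ∀ a b c d → a ℚ.* b ℚ.- c ℚ.* d ≡ a ℚ.* (b ℚ.- d) ℚ.+ d ℚ.* (a ℚ.- c)
    expand a b c d = sym (begin-equality
      a ℚ.* (b ℚ.- d) ℚ.+ d ℚ.* (a ℚ.- c)
        ≡⟨ cong₂ ℚ._+_ (distrib-minus a b d) (distrib-minus d a c) ⟩
      (a ℚ.* b ℚ.- a ℚ.* d) ℚ.+ (d ℚ.* a ℚ.- d ℚ.* c)
        ≡⟨ cong₂ (λ u v → (a ℚ.* b ℚ.- a ℚ.* d) ℚ.+ (u ℚ.- v)) (ℚ.*-comm d a) (ℚ.*-comm d c) ⟩
      (a ℚ.* b ℚ.- a ℚ.* d) ℚ.+ (a ℚ.* d ℚ.- c ℚ.* d)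
        ≡⟨ ℚ.+-assoc (a ℚ.* b ℚ.- a ℚ.* d) (a ℚ.* d) (ℚ.- (c ℚ.* d)) ⟨
      ((a ℚ.* b ℚ.- a ℚ.* d) ℚ.+ a ℚ.* d) ℚ.- c ℚ.* d
        ≡⟨ cong (ℚ._- c ℚ.* d) (p-q+q≡p (a ℚ.* b) (a ℚ.* d)) ⟩
      a ℚ.* b ℚ.- c ℚ.* d ∎)
      where
      distrib-minus : ∀ x y z → x ℚ.* (y ℚ.- z) ≡ x ℚ.* y ℚ.- x ℚ.* z
      distrib-minus x y z = trans (ℚ.*-distribˡ-+ x y (ℚ.- z))
        (cong (x ℚ.* y ℚ.+_) (sym (ℚ.neg-distribʳ-* x z)))

    conclude :
      (∃ λ M → ∀ i j → M ℕ.≤ i → M ℕ.≤ j → ℚ.∣ s i ℚ.- s j ∣ ℚ.< δ) →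
      (∃ λ N → ∀ i j → N ℕ.≤ i → N ℕ.≤ j → ℚ.∣ t i ℚ.- t j ∣ ℚ.< δ) →
      ∃ λ N → ∀ i j → N ℕ.≤ i → N ℕ.≤ j → ℚ.∣ s i ℚ.* t i ℚ.- s j ℚ.* t j ∣ ℚ.< ε
    conclude (M , hs) (N , ht) = (K ℕ.⊔ L) ℕ.⊔ (M ℕ.⊔ N) , λ i j pi pj →
      let KL≤i = ℕ.m⊔n≤o⇒m≤o (K ℕ.⊔ L) (M ℕ.⊔ N) pi
          KL≤j = ℕ.m⊔n≤o⇒m≤o (K ℕ.⊔ L) (M ℕ.⊔ N) pj
          MN≤i = ℕ.m⊔n≤o⇒n≤o (K ℕ.⊔ L) (M ℕ.⊔ N) pi
          MN≤j = ℕ.m⊔n≤o⇒n≤o (K ℕ.⊔ L) (M ℕ.⊔ N) pj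
      in begin-strict
      ℚ.∣ s i ℚ.* t i ℚ.- s j ℚ.* t j ∣
        ≡⟨ cong ℚ.∣_∣ (expand (s i) (t i) (s j) (t j)) ⟩
      ℚ.∣ s i ℚ.* (t i ℚ.- t j) ℚ.+ t j ℚ.* (s i ℚ.- s j) ∣
        ≤⟨ ℚ.∣p+q∣≤∣p∣+∣q∣ (s i ℚ.* (t i ℚ.- t j)) (t j ℚ.* (s i ℚ.- s j)) ⟩
      ℚ.∣ s i ℚ.* (t i ℚ.- t j) ∣ ℚ.+ ℚ.∣ t j ℚ.* (s i ℚ.- s j) ∣
        <⟨ ℚ.+-mono-<
             (*-bound {s i} {t i ℚ.- t j} (hB i (ℕ.m⊔n≤o⇒m≤o K L KL≤i))
               (ht i j (ℕ.m⊔n≤o⇒n≤o M N MN≤i) (ℕ.m⊔n≤o⇒n≤o M N MN≤j)))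
             (*-bound {t j} {s i ℚ.- s j} (hC j (ℕ.m⊔n≤o⇒n≤o K L KL≤j))
               (hs i j (ℕ.m⊔n≤o⇒m≤o M N MN≤i) (ℕ.m⊔n≤o⇒m≤o M N MN≤j))) ⟩
      B ℚ.* δ ℚ.+ C ℚ.* δ
        ≡⟨ Dδ≡ε ⟩
      ε ∎

infix  8 -_
infixl 7 _*_
infixl 6 _+_ _-_
infix  4 _≈_ _≤_ _<_

fromℚ : ℚ → ℝ
fromℚ q = mkℝ (λ _ → q)
  (λ ε 0<ε → 0 , λ _ _ _ _ → subst (λ z → ℚ.∣ z ∣ ℚ.< ε) (sym (ℚ.+-inverseʳ q)) 0<ε)

fromℕ : ℕ → ℝ
fromℕ n = fromℚ (+ n ℚ./ 1)

0ℝ 1ℝ : ℝ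
0ℝ = fromℕ 0
1ℝ = fromℕ 1

-_ : ℝ → ℝ
- x = mkℝ (λ i → ℚ.- seq x i) (neg-cauchy (seq x) (cauchy x))

_+_ _-_ _*_ : ℝ → ℝ → ℝ
x + y = mkℝ (λ i → seq x i ℚ.+ seq y i) (+-cauchy (seq x) (seq y) (cauchy x) (cauchy y))
x * y = mkℝ (λ i → seq x i ℚ.* seq y i) (*-cauchy (seq x) (seq y) (cauchy x) (cauchy y))
x - y = x + (- y)

_≈_ _≤_ _<_ : ℝ → ℝ → Set
x ≈ y = ∀ ε → 0ℚ ℚ.< ε → Eventually (λ i → ℚ.∣ seq x i ℚ.- seq y i ∣ ℚ.< ε)
x ≤ y = ∀ ε → 0ℚ ℚ.< ε → Eventually (λ i → seq x i ℚ.< seq y i ℚ.+ ε)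
x < y = ∃ λ ε → 0ℚ ℚ.< ε × Eventually (λ i → seq x i ℚ.+ ε ℚ.< seq y i)

Point : Set
Point = ℝ × ℝ

infix 4 _≈ₚ_

_≈ₚ_ : Point → Point → Set
(x₁ , y₁) ≈ₚ (x₂ , y₂) = x₁ ≈ x₂ × y₁ ≈ y₂

combination : ℝ → Point → Point → Point
combination t (x₁ , y₁) (x₂ , y₂) =
  (1ℝ - t) * x₁ + t * x₂ , (1ℝ - t) * y₁ + t * y₂

Segment : Point → Point → Pred Point 0ℓ
Segment p q r = ∃ λ t → 0ℝ ≤ t × t ≤ 1ℝ × r ≈ₚ combination t p q

-- A segment has positive length exactly when its squared length is
-- positive; the square avoids constructing a square root.
squaredLength : Point → Point → ℝ
squaredLength (x₁ , y₁) (x₂ , y₂) =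
  (x₂ - x₁) * (x₂ - x₁) + (y₂ - y₁) * (y₂ - y₁)

record PolygonalPath (k : ℕ) : Set where
  field
    nonempty       : 1 ℕ.≤ k
    vertex         : Fin (suc k) → Point
    positiveLength : ∀ (i : Fin k) →
      0ℝ < squaredLength (vertex (inject₁ i)) (vertex (Fin.suc i))

  side : Fin k → Pred Point 0ℓ
  side i = Segment (vertex (inject₁ i)) (vertex (Fin.suc i))

open PolygonalPath public

Covers : ∀ {k} → PolygonalPath k → Pred Point 0ℓ → Set
Covers {k} π P = P ⊆ ⋃[ i ∶ Fin k ] side π i

-- The common endpoint of consecutive sides i and j = i + 1 is the
-- starting vertex of side j.
Noncrossing : ∀ {k} → PolygonalPath k → Set
Noncrossing {k} π = ∀ (i j : Fin k) → i Fin.< j → ∀ p →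
  side π i p → side π j p → toℕ j ≡ suc (toℕ i) × p ≈ₚ vertex π (inject₁ j)

V : ℕ → ℕ → Pred Point 0ℓ
V n m p = ∃₂ λ a b →
  (1 ℕ.≤ a × a ℕ.≤ n) × (1 ℕ.≤ b × b ℕ.≤ m) × p ≈ₚ (fromℕ a , fromℕ b)

CoverableWith : ℕ → ℕ → Pred ℕ 0ℓ
CoverableWith n m k = ∃ λ (π : PolygonalPath k) → Covers π (V n m)

NoncrossingCoverableWith : ℕ → ℕ → Pred ℕ 0ℓ
NoncrossingCoverableWith n m k =
  ∃ λ (π : PolygonalPath k) → Noncrossing π × Covers π (V n m)

IsMinimum : Pred ℕ 0ℓ → ℕ → Set
IsMinimum P k = P k × (∀ l → P l → k ℕ.≤ l)

{-# OPTIONS --safe #-}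

-- Lower bound.  Assign to each grid point a side covering it, and call a row
-- or a column a line if two of its points have the same side.  If every row
-- is a line, the m sides are pairwise nonconsecutive, because consecutive
-- sides share a vertex, so there are at least 2m − 1 sides; likewise for the
-- columns.  Otherwise let c ≥ 1 columns and r ≥ 1 rows not be lines.  The
-- points on the rim of the c × r subgrid they span use none of the
-- (n − c) + (m − r) sides of the lines, and no side contains three of them,
-- since no two are in the same row or column.  As the rim has 2(c + r) − 4
-- points (for c, r ≥ 2), there are at least n + m − 2 sides.  If there are
-- no more than that, then each corner of the rim shares its side with another
-- rim point, and two of these chords cross in an interior point: this is
-- impossible for consecutive sides, and for all sides of a noncrossing path.
--
-- Upper bound.  The boustrophedon path is noncrossing and has
-- 2 min(n, m) − 1 sides.  For n = m ≥ 3, start from the four sides of the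
-- nine dots puzzle and spiral outwards: two more sides extend the square by
-- a row and a column.
module Submission where

-- The turning points are arbitrary Cauchy reals, whose equality and order are not decidable, while
-- the grid is rational. The counting therefore runs on a finite colouring: `covered` chooses one
-- side for each grid point, and being a line, being free or sharing a side refers to this choice
-- alone, so all of it is decided by finite search. The colouring knows one geometric fact, that
-- three points of one colour have determinant 0. Real arguments remain only where a vertex of the
-- path matters, and what comes back from them is an equation or a weak inequality between rational
-- constants. This suffices because crossings are expressed by strict signs of rational
-- determinants.
--
-- The rim yields k ≥ n + m - 2, and for n ≠ m this is already at least 2 min(n, m) - 1; only
-- squares lose one. Squares with n ≤ 2 do not lose it after all: a crossing takes two
-- nonconsecutive sides, hence at least three sides in total.

-- Equality and order of Cauchy reals.

module Reals where

  open import Data.Nat.Base as ℕ using (ℕ)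
  import Data.Nat.Properties as ℕ
  open import Data.Product.Base using (_×_; _,_; ∃)
  open import Data.Rational.Base as ℚ using (ℚ; 0ℚ; 1ℚ; ½)
  import Data.Rational.Properties as ℚ
  open import Data.Sum.Base using (inj₁; inj₂)
  open import Level using (0ℓ)
  open import Relation.Binary.PropositionalEquality
  open import Relation.Nullary.Decidable.Core using (dec⇒maybe; yes; no)
  open import Relation.Unary using (Pred; _∩_; _⊆_)
  import Tactic.RingSolver as RingSolver
  import Tactic.RingSolver.Core.AlmostCommutativeRing as ACR
  open import Defs

  ℚ-ring : ACR.AlmostCommutativeRing 0ℓ 0ℓ
  ℚ-ring = ACR.fromCommutativeRing ℚ.+-*-commutativeRing λ q → dec⇒maybe (0ℚ ℚ.≟ q)

  eventually-map : {P Q : Pred ℕ 0ℓ} → P ⊆ Q → Eventually P → Eventually Q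
  eventually-map P⊆Q (N , h) = N , λ i N≤i → P⊆Q (h i N≤i)

  eventually-∩ : {P Q : Pred ℕ 0ℓ} → Eventually P → Eventually Q → Eventually (P ∩ Q)
  eventually-∩ (M , p) (N , q) = M ℕ.⊔ N , λ i h →
    p i (ℕ.m⊔n≤o⇒m≤o M N h) , q i (ℕ.m⊔n≤o⇒n≤o M N h)

  eventually-const : {P : Set} → Eventually (λ _ → P) → P
  eventually-const (N , h) = h N ℕ.≤-refl

  always : {P : Pred ℕ 0ℓ} → (∀ i → P i) → Eventually P
  always h = 0 , λ i _ → h i

  -- `x ≈ y` unfolds to `Null` of the difference of the two sequences, so the congruence laws below
  -- reduce to closure properties of null sequences.
  Null : (ℕ → ℚ) → Set
  Null s = ∀ ε → 0ℚ ℚ.< ε → Eventually (λ i → ℚ.∣ s i ∣ ℚ.< ε)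

  null-cong : ∀ {s t} → (∀ i → s i ≡ t i) → Null s → Null t
  null-cong eq ns ε 0<ε = eventually-map (λ {i} → subst (λ z → ℚ.∣ z ∣ ℚ.< ε) (eq i)) (ns ε 0<ε)

  null-+ : ∀ {s t} → Null s → Null t → Null (λ i → s i ℚ.+ t i)
  null-+ {s} {t} ns nt ε 0<ε =
    eventually-map
      (λ {i} (a , b) → subst (ℚ.∣ s i ℚ.+ t i ∣ ℚ.<_) (half+half ε)
        (ℚ.≤-<-trans (ℚ.∣p+q∣≤∣p∣+∣q∣ (s i) (t i)) (ℚ.+-mono-< a b)))
      (eventually-∩ (ns _ (half-pos 0<ε)) (nt _ (half-pos 0<ε)))

  null-neg : ∀ {s} → Null s → Null (λ i → ℚ.- s i)
  null-neg {s} ns ε 0<ε = eventually-map (λ {i} → subst (ℚ._< ε) (sym (ℚ.∣-p∣≡∣p∣ (s i)))) (ns ε 0<ε)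

  divide : ∀ B ε → ℚ.Positive B → 0ℚ ℚ.< ε → ∃ λ δ → 0ℚ ℚ.< δ × B ℚ.* δ ≡ ε
  divide B ε B>0 0<ε = ε ℚ.* ℚ.1/ B
    , subst (ℚ._< ε ℚ.* ℚ.1/ B) (ℚ.*-zeroˡ (ℚ.1/ B)) (ℚ.*-monoˡ-<-pos (ℚ.1/ B) {{ℚ.1/pos⇒pos B}} 0<ε)
    , (begin
      B ℚ.* (ε ℚ.* ℚ.1/ B)  ≡⟨ cong (B ℚ.*_) (ℚ.*-comm ε (ℚ.1/ B)) ⟩
      B ℚ.* (ℚ.1/ B ℚ.* ε)  ≡⟨ ℚ.*-assoc B (ℚ.1/ B) ε ⟨
      B ℚ.* ℚ.1/ B ℚ.* ε    ≡⟨ cong (ℚ._* ε) (ℚ.*-inverseʳ B) ⟩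
      1ℚ ℚ.* ε              ≡⟨ ℚ.*-identityˡ ε ⟩
      ε                     ∎)
    where
    open ≡-Reasoning
    instance
      B>0′ : ℚ.Positive B
      B>0′ = B>0
      B≢0 : ℚ.NonZero B
      B≢0 = ℚ.pos⇒nonZero B

  null-* : ∀ x {s} → Null s → Null (λ i → seq x i ℚ.* s i)
  null-* x {s} ns ε 0<ε with eventually-bounded (seq x) (cauchy x)
  ... | B , B>0 , bounded with divide B ε B>0 0<ε
  ...   | δ , 0<δ , refl = eventually-map
          (λ {i} (a , b) → *-bound {seq x i} {s i} {{B>0}} a b)
          (eventually-∩ bounded (ns δ 0<δ))

  -- Real operations act entrywise, so through this lemma every polynomial identity over ℝ becomes a
  -- rational identity, left to the ring solver.
  pointwise : ∀ {x y} → (∀ i → seq x i ≡ seq y i) → x ≈ y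
  pointwise {x} {y} eq ε 0<ε = always λ i →
    subst (λ z → ℚ.∣ z ∣ ℚ.< ε) (sym (trans (cong (ℚ._- seq y i) (eq i)) (ℚ.+-inverseʳ (seq y i)))) 0<ε

  ≈-refl : ∀ {x} → x ≈ x
  ≈-refl {x} = pointwise {x} {x} λ _ → refl

  private
    neg-involutive : ∀ a → ℚ.- (ℚ.- a) ≡ a
    neg-involutive = RingSolver.solve-∀ ℚ-ring

    minus-swap : ∀ p q → ℚ.- (p ℚ.- q) ≡ q ℚ.- p
    minus-swap = RingSolver.solve-∀ ℚ-ring

    telescope : ∀ p q r → (p ℚ.- q) ℚ.+ (q ℚ.- r) ≡ p ℚ.- r
    telescope = RingSolver.solve-∀ ℚ-ring

    minus-interchange : ∀ p q r s → (p ℚ.- q) ℚ.+ (r ℚ.- s) ≡ (p ℚ.+ r) ℚ.- (q ℚ.+ s)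
    minus-interchange = RingSolver.solve-∀ ℚ-ring

    product-difference : ∀ p q r s → p ℚ.* (r ℚ.- s) ℚ.+ s ℚ.* (p ℚ.- q) ≡ p ℚ.* r ℚ.- q ℚ.* s
    product-difference = RingSolver.solve-∀ ℚ-ring

    neg-difference : ∀ p q → ℚ.- (p ℚ.- q) ≡ (ℚ.- p) ℚ.- (ℚ.- q)
    neg-difference = RingSolver.solve-∀ ℚ-ring

  ≈-sym : ∀ {x y} → x ≈ y → y ≈ x
  ≈-sym {x} {y} x≈y = null-cong (λ i → minus-swap (seq x i) (seq y i)) (null-neg x≈y)

  ≈-trans : ∀ {x y z} → x ≈ y → y ≈ z → x ≈ z
  ≈-trans {x} {y} {z} x≈y y≈z =
    null-cong (λ i → telescope (seq x i) (seq y i) (seq z i)) (null-+ x≈y y≈z)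

  +-cong : ∀ {x x′ y y′} → x ≈ x′ → y ≈ y′ → x + y ≈ x′ + y′
  +-cong {x} {x′} {y} {y′} p q =
    null-cong (λ i → minus-interchange (seq x i) (seq x′ i) (seq y i) (seq y′ i)) (null-+ p q)

  -‿cong : ∀ {x x′} → x ≈ x′ → - x ≈ - x′
  -‿cong {x} {x′} p = null-cong (λ i → neg-difference (seq x i) (seq x′ i)) (null-neg p)

  *-cong : ∀ {x x′ y y′} → x ≈ x′ → y ≈ y′ → x * y ≈ x′ * y′
  *-cong {x} {x′} {y} {y′} p q =
    null-cong (λ i → product-difference (seq x i) (seq x′ i) (seq y i) (seq y′ i))
      (null-+ (null-* x q) (null-* y′ p))

  minus-cong : ∀ {x x′ y y′} → x ≈ x′ → y ≈ y′ → x - y ≈ x′ - y′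
  minus-cong {x} {x′} {y} {y′} p q = +-cong {x} {x′} { - y} { - y′} p (-‿cong {y} {y′} q)

  private
    small⇒≤0 : ∀ q → (∀ ε → 0ℚ ℚ.< ε → q ℚ.< ε) → q ℚ.≤ 0ℚ
    small⇒≤0 q h = ℚ.≮⇒≥ (λ 0<q → ℚ.<-irrefl refl (h q 0<q))

  -- For constant sequences "eventually" says nothing about the index, so the rational |p - q| is
  -- below every positive ε and vanishes. This is the way back from real to rational equations.
  fromℚ-injective : ∀ {p q} → fromℚ p ≈ fromℚ q → p ≡ q
  fromℚ-injective {p} {q} p≈q = trans (sym (p-q+q≡p p q)) (trans (cong (ℚ._+ q) p-q≡0) (ℚ.+-identityˡ q))
    where
    p-q≡0 : p ℚ.- q ≡ 0ℚ
    p-q≡0 = ℚ.∣p∣≡0⇒p≡0 (p ℚ.- q)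
      (ℚ.≤-antisym (small⇒≤0 _ λ ε 0<ε → eventually-const (p≈q ε 0<ε)) (ℚ.0≤∣p∣ _))

  NonNegative : ℝ → Set
  NonNegative x = 0ℝ ≤ x

  ≤⇒nonNegative : ∀ {x y} → x ≤ y → NonNegative (y - x)
  ≤⇒nonNegative {x} {y} x≤y ε 0<ε = eventually-map
    (λ {i} h → subst₂ ℚ._<_ (ℚ.+-inverseʳ (seq x i)) (eq (seq x i) (seq y i) ε) (ℚ.+-monoˡ-< (ℚ.- seq x i) h))
    (x≤y ε 0<ε)
    where
    eq : ∀ a b c → (b ℚ.+ c) ℚ.+ ℚ.- a ≡ (b ℚ.+ ℚ.- a) ℚ.+ c
    eq = RingSolver.solve-∀ ℚ-ring

  nonNegative⇒≤ : ∀ {x y} → NonNegative (y - x) → x ≤ y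
  nonNegative⇒≤ {x} {y} 0≤y-x ε 0<ε = eventually-map
    (λ {i} h → subst₂ ℚ._<_ (ℚ.+-identityˡ (seq x i)) (eq (seq x i) (seq y i) ε) (ℚ.+-monoˡ-< (seq x i) h))
    (0≤y-x ε 0<ε)
    where
    eq : ∀ a b c → ((b ℚ.+ ℚ.- a) ℚ.+ c) ℚ.+ a ≡ b ℚ.+ c
    eq = RingSolver.solve-∀ ℚ-ring

  pointwise-nonNegative : ∀ {x} → (∀ i → 0ℚ ℚ.≤ seq x i) → NonNegative x
  pointwise-nonNegative h ε 0<ε = always λ i → ℚ.+-mono-≤-< (h i) 0<ε

  fromℚ-nonNegative : ∀ {q} → 0ℚ ℚ.≤ q → NonNegative (fromℚ q)
  fromℚ-nonNegative {q} 0≤q = pointwise-nonNegative {fromℚ q} λ _ → 0≤q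

  -- For negative q the choice ε = -q would give 0 < q - q.
  fromℚ-nonNegative⁻¹ : ∀ {q} → NonNegative (fromℚ q) → 0ℚ ℚ.≤ q
  fromℚ-nonNegative⁻¹ {q} h = ℚ.≮⇒≥ λ q<0 → ℚ.<-irrefl (sym (ℚ.+-inverseʳ q))
    (eventually-const (h (ℚ.- q) (ℚ.neg-antimono-< q<0)))

  +-nonNegative : ∀ {x y} → NonNegative x → NonNegative y → NonNegative (x + y)
  +-nonNegative {x} {y} 0≤x 0≤y ε 0<ε = eventually-map
    (λ {i} (a , b) → subst (0ℚ ℚ.<_)
      (trans (eq (seq x i) (seq y i) (ε ℚ.* ½)) (cong (λ e → (seq x i ℚ.+ seq y i) ℚ.+ e) (half+half ε)))
      (ℚ.+-mono-< a b))
    (eventually-∩ (0≤x _ (half-pos 0<ε)) (0≤y _ (half-pos 0<ε)))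
    where
    eq : ∀ a b c → (a ℚ.+ c) ℚ.+ (b ℚ.+ c) ≡ (a ℚ.+ b) ℚ.+ (c ℚ.+ c)
    eq = RingSolver.solve-∀ ℚ-ring

  private
    0<+⇒-< : ∀ {a c} → 0ℚ ℚ.< a ℚ.+ c → ℚ.- a ℚ.< c
    0<+⇒-< {a} {c} h = subst₂ ℚ._<_ (ℚ.+-identityˡ (ℚ.- a)) (eq a c) (ℚ.+-monoˡ-< (ℚ.- a) h)
      where
      eq : ∀ a c → (a ℚ.+ c) ℚ.+ ℚ.- a ≡ c
      eq = RingSolver.solve-∀ ℚ-ring

    -<⇒0<+ : ∀ {a c} → ℚ.- a ℚ.< c → 0ℚ ℚ.< a ℚ.+ c
    -<⇒0<+ {a} {c} h = subst (ℚ._< a ℚ.+ c) (ℚ.+-inverseʳ a) (ℚ.+-monoʳ-< a h)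

    -≤∣∣ : ∀ a → ℚ.- a ℚ.≤ ℚ.∣ a ∣
    -≤∣∣ a with ℚ.∣p∣≡p∨∣p∣≡-p a
    ... | inj₁ e = ℚ.≤-trans (ℚ.neg-antimono-≤ (subst (0ℚ ℚ.≤_) e (ℚ.0≤∣p∣ a))) (ℚ.0≤∣p∣ a)
    ... | inj₂ e = ℚ.≤-reflexive (sym e)

  nonNegative-resp-≈ : ∀ {x y} → x ≈ y → NonNegative x → NonNegative y
  nonNegative-resp-≈ {x} {y} x≈y 0≤x ε 0<ε = eventually-map
    (λ {i} (a , b) → subst (0ℚ ℚ.<_)
      (trans (eq (seq x i) (seq y i) (ε ℚ.* ½)) (cong (seq y i ℚ.+_) (half+half ε)))
      (ℚ.+-mono-< a (-<⇒0<+ (ℚ.≤-<-trans (-≤∣∣ (seq y i ℚ.- seq x i)) b))))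
    (eventually-∩ (0≤x _ (half-pos 0<ε)) (≈-sym {x} {y} x≈y _ (half-pos 0<ε)))
    where
    eq : ∀ a b c → (a ℚ.+ c) ℚ.+ ((b ℚ.- a) ℚ.+ c) ≡ b ℚ.+ (c ℚ.+ c)
    eq = RingSolver.solve-∀ ℚ-ring

  nonNegative-antisym : ∀ {x} → NonNegative x → NonNegative (- x) → x ≈ 0ℝ
  nonNegative-antisym {x} 0≤x x≤0 ε 0<ε = eventually-map
    (λ {i} (a , b) → bound i (0<+⇒-< a) (subst (ℚ._< ε) (neg-involutive (seq x i)) (0<+⇒-< b)))
    (eventually-∩ (0≤x ε 0<ε) (x≤0 ε 0<ε))
    where
    bound : ∀ i → ℚ.- seq x i ℚ.< ε → seq x i ℚ.< ε → ℚ.∣ seq x i ℚ.- 0ℚ ∣ ℚ.< ε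
    bound i a b with ℚ.∣p∣≡p∨∣p∣≡-p (seq x i) | ℚ.+-identityʳ (seq x i)
    ... | inj₁ e | r = subst (ℚ._< ε) (sym (trans (cong ℚ.∣_∣ r) e)) b
    ... | inj₂ e | r = subst (ℚ._< ε) (sym (trans (cong ℚ.∣_∣ r) e)) a

  -- The sign of a real is not decidable, but the sign of each entry is. An entry of either factor
  -- exceeds -δ; if it is negative, its absolute value is below δ, and the other factor is bounded
  -- by `B + C`, so the product exceeds -ε for ε = (B + C)δ. Two nonnegative entries have a
  -- nonnegative product.
  *-nonNegative : ∀ {x y} → NonNegative x → NonNegative y → NonNegative (x * y)
  *-nonNegative {x} {y} 0≤x 0≤y ε 0<ε
    with eventually-bounded (seq x) (cauchy x) | eventually-bounded (seq y) (cauchy y)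
  ... | B , B>0 , hB | C , C>0 , hC
    with divide (B ℚ.+ C) ε (ℚ.pos+pos⇒pos B {{B>0}} C {{C>0}}) 0<ε
  ...   | δ , 0<δ , refl = eventually-map
          (λ {i} ((a , b) , (c , d)) → -<⇒0<+ {seq x i ℚ.* seq y i} (bound (seq x i) (seq y i) (0<+⇒-< {seq x i} a) (0<+⇒-< {seq y i} b)
             (ℚ.<-≤-trans c (≤+ B C {{C>0}})) (ℚ.<-≤-trans d (subst (C ℚ.≤_) (ℚ.+-comm C B) (≤+ C B {{B>0}})))))
          (eventually-∩ (eventually-∩ (0≤x δ 0<δ) (0≤y δ 0<δ)) (eventually-∩ hB hC))
    where
    instance
      D>0 : ℚ.Positive (B ℚ.+ C)
      D>0 = ℚ.pos+pos⇒pos B {{B>0}} C {{C>0}}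

    ≤+ : ∀ p q .{{_ : ℚ.Positive q}} → p ℚ.≤ p ℚ.+ q
    ≤+ p q = subst (ℚ._≤ p ℚ.+ q) (ℚ.+-identityʳ p) (ℚ.+-monoʳ-≤ p (ℚ.<⇒≤ (ℚ.positive⁻¹ q)))

    negative-small : ∀ {u} → u ℚ.< 0ℚ → ℚ.- u ℚ.< δ → ℚ.∣ u ∣ ℚ.< δ
    negative-small {u} u<0 h =
      subst (ℚ._< δ) (trans (sym (ℚ.0≤p⇒∣p∣≡p (ℚ.<⇒≤ (ℚ.neg-antimono-< u<0)))) (ℚ.∣-p∣≡∣p∣ u)) h

    bound : ∀ u v → ℚ.- u ℚ.< δ → ℚ.- v ℚ.< δ → ℚ.∣ u ∣ ℚ.< B ℚ.+ C → ℚ.∣ v ∣ ℚ.< B ℚ.+ C →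
      ℚ.- (u ℚ.* v) ℚ.< (B ℚ.+ C) ℚ.* δ
    bound u v hu hv u<D v<D with 0ℚ ℚ.≤? u | 0ℚ ℚ.≤? v
    ... | no 0≰u  | _       = ℚ.≤-<-trans (-≤∣∣ (u ℚ.* v))
            (subst (λ z → ℚ.∣ z ∣ ℚ.< _) (ℚ.*-comm v u) (*-bound {v} {u} v<D (negative-small (ℚ.≰⇒> 0≰u) hu)))
    ... | yes _   | no 0≰v  = ℚ.≤-<-trans (-≤∣∣ (u ℚ.* v)) (*-bound {u} {v} u<D (negative-small (ℚ.≰⇒> 0≰v) hv))
    ... | yes 0≤u | yes 0≤v = ℚ.≤-<-trans
            (ℚ.neg-antimono-≤ (subst (ℚ._≤ u ℚ.* v) (ℚ.*-zeroʳ u) (ℚ.*-monoˡ-≤-nonNeg u {{ℚ.nonNegative 0≤u}} 0≤v))) 0<ε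

-- Orientation determinants and proper crossings in the rational plane.

module RationalPlane where

  open import Data.Product.Base using (_×_; _,_; ∃)
  open import Data.Rational.Base
  open import Data.Rational.Properties
  open import Data.Sum.Base using (_⊎_; inj₁; inj₂)
  open import Relation.Binary.PropositionalEquality
  import Tactic.RingSolver as RingSolver
  open Reals using (ℚ-ring)

  ℚ² : Set
  ℚ² = ℚ × ℚ

  -- Twice the signed area of the triangle a b c.
  cross : ℚ² → ℚ² → ℚ² → ℚ
  cross (ax , ay) (bx , by) (cx , cy) = (bx - ax) * (cy - ay) - (by - ay) * (cx - ax)

  lerp : ℚ → ℚ → ℚ → ℚ
  lerp t p q = (1ℚ - t) * p + t * q

  mix : ℚ → ℚ² → ℚ² → ℚ²
  mix t (px , py) (qx , qy) = lerp t px qx , lerp t py qy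

  Opposite : ℚ → ℚ → Set
  Opposite p q = (p < 0ℚ × 0ℚ < q) ⊎ (0ℚ < p × q < 0ℚ)

  -- Strict separation in both directions makes the crossing proper: the common point is interior to
  -- both segments.
  record Crossing (a b c e : ℚ²) : Set where
    constructor crossing
    field
      ab-separated : Opposite (cross c e a) (cross c e b)
      ce-separated : Opposite (cross a b c) (cross a b e)

  Crossing-sym : ∀ {a b c e} → Crossing a b c e → Crossing c e a b
  Crossing-sym (crossing p q) = crossing q p

  p<q⇒0<q-p : ∀ {p q} → p < q → 0ℚ < q - p
  p<q⇒0<q-p {p} {q} p<q = subst (_< q - p) (+-inverseʳ p) (+-monoˡ-< (- p) p<q)

  p≤q⇒0≤q-p : ∀ {p q} → p ≤ q → 0ℚ ≤ q - p
  p≤q⇒0≤q-p {p} {q} p≤q = subst (_≤ q - p) (+-inverseʳ p) (+-monoˡ-≤ (- p) p≤q)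

  0≤q-p⇒p≤q : ∀ {p q} → 0ℚ ≤ q - p → p ≤ q
  0≤q-p⇒p≤q {p} {q} h = subst₂ _≤_ (+-identityˡ p) (eq q p) (+-monoˡ-≤ p h)
    where
    eq : ∀ q p → q - p + p ≡ q
    eq = RingSolver.solve-∀ ℚ-ring

  0<p+q : ∀ {p q} → 0ℚ < p → 0ℚ < q → 0ℚ < p + q
  0<p+q {p} {q} 0<p 0<q = +-mono-< {0ℚ} {p} {0ℚ} {q} 0<p 0<q

  0<p*q : ∀ {p q} → 0ℚ < p → 0ℚ < q → 0ℚ < p * q
  0<p*q {p} {q} 0<p 0<q = subst (_< p * q) (*-zeroʳ p) (*-monoʳ-<-pos p {{positive 0<p}} 0<q)

  0≤p*q : ∀ {p q} → 0ℚ ≤ p → 0ℚ ≤ q → 0ℚ ≤ p * q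
  0≤p*q {p} {q} 0≤p 0≤q = subst (_≤ p * q) (*-zeroʳ p) (*-monoˡ-≤-nonNeg p {{nonNegative 0≤p}} 0≤q)

  0≤p² : ∀ p → 0ℚ ≤ p * p
  0≤p² p with ≤-total 0ℚ p
  ... | inj₁ 0≤p = 0≤p*q 0≤p 0≤p
  ... | inj₂ p≤0 = subst (0ℚ ≤_) (eq p) (0≤p*q (neg-antimono-≤ p≤0) (neg-antimono-≤ p≤0))
    where
    eq : ∀ p → (- p) * (- p) ≡ p * p
    eq = RingSolver.solve-∀ ℚ-ring

  0<-p⇒p<0 : ∀ {p} → 0ℚ < - p → p < 0ℚ
  0<-p⇒p<0 {p} h = subst (_< 0ℚ) (eq p) (neg-antimono-< h)
    where
    eq : ∀ p → - (- p) ≡ p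
    eq = RingSolver.solve-∀ ℚ-ring

  -p<0⇒0<p : ∀ {p} → - p < 0ℚ → 0ℚ < p
  -p<0⇒0<p {p} h = subst (0ℚ <_) (eq p) (neg-antimono-< h)
    where
    eq : ∀ p → - (- p) ≡ p
    eq = RingSolver.solve-∀ ℚ-ring

  opposite⇒*<0 : ∀ {p q} → Opposite p q → p * q < 0ℚ
  opposite⇒*<0 {p} {q} (inj₁ (p<0 , 0<q)) = 0<-p⇒p<0 (subst (0ℚ <_) (sym (neg-distribˡ-* p q)) (0<p*q (neg-antimono-< p<0) 0<q))
  opposite⇒*<0 {p} {q} (inj₂ (0<p , q<0)) = 0<-p⇒p<0 (subst (0ℚ <_) (sym (neg-distribʳ-* p q)) (0<p*q 0<p (neg-antimono-< q<0)))

  fraction : ∀ {p q} → 0ℚ ≤ p → 0ℚ ≤ q → 0ℚ < p + q →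
    ∃ λ t → 0ℚ ≤ t × t ≤ 1ℚ × t * (p + q) ≡ p
  fraction {p} {q} 0≤p 0≤q 0<p+q =
    p * r , 0≤p*q 0≤p 0≤r , 0≤q-p⇒p≤q (subst (0ℚ ≤_) complement (0≤p*q 0≤q 0≤r)) , product
    where
    instance
      sum>0 : Positive (p + q)
      sum>0 = positive 0<p+q
      sum≢0 : NonZero (p + q)
      sum≢0 = pos⇒nonZero (p + q)
    r = 1/ (p + q)
    0≤r : 0ℚ ≤ r
    0≤r = <⇒≤ (positive⁻¹ r {{1/pos⇒pos (p + q)}})
    complement : q * r ≡ 1ℚ - p * r
    complement = trans (eq p q r) (cong (_- p * r) (*-inverseʳ (p + q)))
      where
      eq : ∀ p q r → q * r ≡ (p + q) * r - p * r
      eq = RingSolver.solve-∀ ℚ-ring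
    product : p * r * (p + q) ≡ p
    product = trans (*-assoc p r (p + q)) (trans (cong (p *_) (*-inverseˡ (p + q))) (*-identityʳ p))

  -- An affine function with value p at 0 and q at 1 vanishes at t = p / (p - q).
  opposite⇒zero : ∀ {p q} → Opposite p q → p - q ≢ 0ℚ × ∃ λ t → 0ℚ ≤ t × t ≤ 1ℚ × t * (p - q) ≡ p
  opposite⇒zero {p} {q} (inj₂ (0<p , q<0)) =
    (λ e → <⇒≢ 0<p-q (sym e)) , fraction {p} { - q} (<⇒≤ 0<p) (<⇒≤ 0<-q) 0<p-q
    where
    0<-q : 0ℚ < - q
    0<-q = neg-antimono-< q<0
    0<p-q : 0ℚ < p - q
    0<p-q = 0<p+q {p} { - q} 0<p 0<-q
  opposite⇒zero {p} {q} (inj₁ (p<0 , 0<q)) = nonzero , flip (fraction { - p} {q} (<⇒≤ 0<-p) (<⇒≤ 0<q) 0<-p+q)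
    where
    0<-p : 0ℚ < - p
    0<-p = neg-antimono-< p<0
    0<-p+q : 0ℚ < - p + q
    0<-p+q = 0<p+q { - p} {q} 0<-p 0<q
    eq₁ : ∀ p q → - p + q ≡ - (p - q)
    eq₁ = RingSolver.solve-∀ ℚ-ring
    eq₂ : ∀ t p q → t * (p - q) ≡ - (t * (- p + q))
    eq₂ = RingSolver.solve-∀ ℚ-ring
    eq₃ : ∀ p → - (- p) ≡ p
    eq₃ = RingSolver.solve-∀ ℚ-ring
    nonzero : p - q ≢ 0ℚ
    nonzero e = <⇒≢ 0<-p+q (sym (trans (eq₁ p q) (cong -_ e)))
    flip : (∃ λ t → 0ℚ ≤ t × t ≤ 1ℚ × t * (- p + q) ≡ - p) → ∃ λ t → 0ℚ ≤ t × t ≤ 1ℚ × t * (p - q) ≡ p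
    flip (t , 0≤t , t≤1 , e) = t , 0≤t , t≤1 , trans (eq₂ t p q) (trans (cong -_ e) (eq₃ p))

  *-cancelˡ-≡ : ∀ {r p q} → r ≢ 0ℚ → r * p ≡ r * q → p ≡ q
  *-cancelˡ-≡ {r} {p} {q} r≢0 e = trans (sym (undo p)) (trans (cong (1/ r *_) e) (undo q))
    where
    instance
      _ : NonZero r
      _ = ≢-nonZero r≢0
    undo : ∀ s → 1/ r * (r * s) ≡ s
    undo s = trans (sym (*-assoc (1/ r) r s)) (trans (cong (_* s) (*-inverseˡ r)) (*-identityˡ s))

  -- The parameters are the zeros of the two determinants, that of `c e` along `a b` and that of
  -- `a b` along `c e`. Both denominators are, up to sign, the determinant `D` of the two
  -- directions, so after multiplication by `D` the coordinates agree by Cramer's rule.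
  crossing-point : ∀ {a b c e} → Crossing a b c e →
    ∃ λ s → ∃ λ t → (0ℚ ≤ s × s ≤ 1ℚ) × (0ℚ ≤ t × t ≤ 1ℚ) × mix s a b ≡ mix t c e
  crossing-point {a@(ax , ay)} {b@(bx , by)} {c@(cx , cy)} {e@(ex , ey)} (crossing ab ce)
    with opposite⇒zero ab | opposite⇒zero ce
  ... | D≢0 , s , 0≤s , s≤1 , sD≡α | _ , t , 0≤t , t≤1 , tΔ≡γ =
    s , t , (0≤s , s≤1) , (0≤t , t≤1) ,
    cong₂ _,_ (*-cancelˡ-≡ D≢0 (scaled ax bx cx ex (x-identity ax ay bx by cx cy ex ey)))
              (*-cancelˡ-≡ D≢0 (scaled ay by cy ey (y-identity ax ay bx by cx cy ex ey)))
    where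
    α = cross c e a
    β = cross c e b
    γ = cross a b c
    δ = cross a b e
    D = α - β

    x-identity : ∀ ax ay bx by cx cy ex ey →
      let α = (ex - cx) * (ay - cy) - (ey - cy) * (ax - cx)
          β = (ex - cx) * (by - cy) - (ey - cy) * (bx - cx)
          γ = (bx - ax) * (cy - ay) - (by - ay) * (cx - ax)
      in (α - β) * ax + α * (bx - ax) ≡ (α - β) * cx - γ * (ex - cx)
    x-identity = RingSolver.solve-∀ ℚ-ring

    y-identity : ∀ ax ay bx by cx cy ex ey →
      let α = (ex - cx) * (ay - cy) - (ey - cy) * (ax - cx)
          β = (ex - cx) * (by - cy) - (ey - cy) * (bx - cx)
          γ = (bx - ax) * (cy - ay) - (by - ay) * (cx - ax)
      in (α - β) * ay + α * (by - ay) ≡ (α - β) * cy - γ * (ey - cy)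
    y-identity = RingSolver.solve-∀ ℚ-ring

    Δ≡-D : ∀ ax ay bx by cx cy ex ey →
      (((bx - ax) * (cy - ay) - (by - ay) * (cx - ax)) - ((bx - ax) * (ey - ay) - (by - ay) * (ex - ax))) ≡
      - (((ex - cx) * (ay - cy) - (ey - cy) * (ax - cx)) - ((ex - cx) * (by - cy) - (ey - cy) * (bx - cx)))
    Δ≡-D = RingSolver.solve-∀ ℚ-ring

    tD≡-γ : t * D ≡ - γ
    tD≡-γ = trans (eq t D) (cong -_ (trans (cong (t *_) (sym (Δ≡-D ax ay bx by cx cy ex ey))) tΔ≡γ))
      where
      eq : ∀ t D → t * D ≡ - (t * - D)
      eq = RingSolver.solve-∀ ℚ-ring

    scaled : ∀ a b c e → D * a + α * (b - a) ≡ D * c - γ * (e - c) → D * lerp s a b ≡ D * lerp t c e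
    scaled a b c e h = begin
      D * lerp s a b            ≡⟨ eq D s a b ⟩
      D * a + s * D * (b - a)   ≡⟨ cong (λ z → D * a + z * (b - a)) sD≡α ⟩
      D * a + α * (b - a)       ≡⟨ h ⟩
      D * c - γ * (e - c)       ≡⟨ cong (D * c +_) (neg-distribˡ-* γ (e - c)) ⟩
      D * c + - γ * (e - c)     ≡⟨ cong (λ z → D * c + z * (e - c)) tD≡-γ ⟨
      D * c + t * D * (e - c)   ≡⟨ eq D t c e ⟨
      D * lerp t c e            ∎
      where
      open ≡-Reasoning
      eq : ∀ D s a b → D * ((1ℚ - s) * a + s * b) ≡ D * a + s * D * (b - a)
      eq = RingSolver.solve-∀ ℚ-ring

  transpose : ℚ² → ℚ²
  transpose (x , y) = y , x

  cross-transpose : ∀ a b c → cross (transpose a) (transpose b) (transpose c) ≡ - cross a b c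
  cross-transpose (ax , ay) (bx , by) (cx , cy) = eq ax ay bx by cx cy
    where
    eq : ∀ ax ay bx by cx cy →
      (by - ay) * (cx - ax) - (bx - ax) * (cy - ay) ≡ - ((bx - ax) * (cy - ay) - (by - ay) * (cx - ax))
    eq = RingSolver.solve-∀ ℚ-ring

  opposite-neg : ∀ {p q} → Opposite (- p) (- q) → Opposite p q
  opposite-neg (inj₁ (-p<0 , 0<-q)) = inj₂ (-p<0⇒0<p -p<0 , 0<-p⇒p<0 0<-q)
  opposite-neg (inj₂ (0<-p , -q<0)) = inj₁ (0<-p⇒p<0 0<-p , -p<0⇒0<p -q<0)

  -- A reflection changes the sign of all four determinants, and `Opposite` is unaffected by a
  -- simultaneous change of sign. This lets `corner-crossing` serve the top left corner as well.
  crossing-transpose : ∀ a b c e →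
    Crossing (transpose a) (transpose b) (transpose c) (transpose e) → Crossing a b c e
  crossing-transpose a b c e (crossing ab ce) = crossing
    (opposite-neg (subst₂ Opposite (cross-transpose c e a) (cross-transpose c e b) ab))
    (opposite-neg (subst₂ Opposite (cross-transpose a b c) (cross-transpose a b e) ce))

  -- (l , b) and (r , b) are the bottom corners of a rectangle with top
  -- side y = t; the segment from the first ends on the right side, that
  -- from the second on the left or the top side.
  corner-crossing : ∀ {l r b t y x′ y′} → l < r → b < y → y ≤ t → l ≤ x′ → x′ < r → b < y′ →
    x′ ≡ l ⊎ y′ ≡ t → Crossing (l , b) (r , y) (r , b) (x′ , y′)
  corner-crossing {l} {r} {b} {t} {y} {x′} {y′} l<r b<y y≤t l≤x′ x′<r b<y′ end = crossing
    (inj₂ ( subst (0ℚ <_) (eq₁ l r b x′ y′) (0<p*q (p<q⇒0<q-p b<y′) (p<q⇒0<q-p l<r))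
          , 0<-p⇒p<0 (subst (0ℚ <_) (eq₂ r b y x′ y′) (0<p*q (p<q⇒0<q-p x′<r) (p<q⇒0<q-p b<y)))))
    (inj₁ ( 0<-p⇒p<0 (subst (0ℚ <_) (eq₃ l r b y) (0<p*q (p<q⇒0<q-p b<y) (p<q⇒0<q-p l<r)))
          , beyond end))
    where
    eq₁ : ∀ l r b x′ y′ → (y′ - b) * (r - l) ≡ (x′ - r) * (b - b) - (y′ - b) * (l - r)
    eq₁ = RingSolver.solve-∀ ℚ-ring
    eq₂ : ∀ r b y x′ y′ → (r - x′) * (y - b) ≡ - ((x′ - r) * (y - b) - (y′ - b) * (r - r))
    eq₂ = RingSolver.solve-∀ ℚ-ring
    eq₃ : ∀ l r b y → (y - b) * (r - l) ≡ - ((r - l) * (b - b) - (y - b) * (r - l))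
    eq₃ = RingSolver.solve-∀ ℚ-ring
    beyond : x′ ≡ l ⊎ y′ ≡ t → 0ℚ < (r - l) * (y′ - b) - (y - b) * (x′ - l)
    beyond (inj₁ refl) = subst (0ℚ <_) (eq₄ l r b y y′) (0<p*q (p<q⇒0<q-p l<r) (p<q⇒0<q-p b<y′))
      where
      eq₄ : ∀ l r b y y′ → (r - l) * (y′ - b) ≡ (r - l) * (y′ - b) - (y - b) * (l - l)
      eq₄ = RingSolver.solve-∀ ℚ-ring
    -- The determinant splits into (r - x′)(t - b) > 0 and (x′ - l)(t - y) ≥ 0. The second summand
    -- vanishes if x′ = l or if the first chord ends in the top right corner.
    beyond (inj₂ refl) = subst (0ℚ <_) (eq₄ l r b y x′ y′)
      (+-mono-<-≤ {0ℚ} {(r - x′) * (y′ - b)} {0ℚ} {(x′ - l) * (y′ - y)}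
        (0<p*q (p<q⇒0<q-p x′<r) (p<q⇒0<q-p b<y′)) (0≤p*q (p≤q⇒0≤q-p l≤x′) (p≤q⇒0≤q-p y≤t)))
      where
      eq₄ : ∀ l r b y x′ y′ → (r - x′) * (y′ - b) + (x′ - l) * (y′ - y) ≡ (r - l) * (y′ - b) - (y - b) * (x′ - l)
      eq₄ = RingSolver.solve-∀ ℚ-ring

  -- Excludes collinearity of a point on the bottom side of the rim with one point on its left and
  -- one on its right that both lie higher. `above-chord` does the same for the top side.
  below-chord : ∀ {px py mx my qx qy} → px < mx → mx < qx → my < py → my < qy →
    cross (mx , my) (px , py) (qx , qy) < 0ℚ
  below-chord {px} {py} {mx} {my} {qx} {qy} px<mx mx<qx my<py my<qy = 0<-p⇒p<0
    (subst (0ℚ <_) (eq px py mx my qx qy)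
      (0<p+q (0<p*q (p<q⇒0<q-p px<mx) (p<q⇒0<q-p my<qy)) (0<p*q (p<q⇒0<q-p my<py) (p<q⇒0<q-p mx<qx))))
    where
    eq : ∀ px py mx my qx qy →
      (mx - px) * (qy - my) + (py - my) * (qx - mx) ≡ - ((px - mx) * (qy - my) - (py - my) * (qx - mx))
    eq = RingSolver.solve-∀ ℚ-ring

  above-chord : ∀ {px py mx my qx qy} → px < mx → mx < qx → py < my → qy < my →
    0ℚ < cross (mx , my) (px , py) (qx , qy)
  above-chord {px} {py} {mx} {my} {qx} {qy} px<mx mx<qx py<my qy<my =
    subst (0ℚ <_) (eq px py mx my qx qy)
      (0<p+q (0<p*q (p<q⇒0<q-p px<mx) (p<q⇒0<q-p qy<my)) (0<p*q (p<q⇒0<q-p py<my) (p<q⇒0<q-p mx<qx)))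
    where
    eq : ∀ px py mx my qx qy →
      (mx - px) * (my - qy) + (my - py) * (qx - mx) ≡ (px - mx) * (qy - my) - (py - my) * (qx - mx)
    eq = RingSolver.solve-∀ ℚ-ring

  horizontal : ∀ {ax bx cx cy y} → ax ≢ bx → cross (ax , y) (bx , y) (cx , cy) ≡ 0ℚ → cy ≡ y
  horizontal {ax} {bx} {cx} {cy} {y} ax≢bx e = *-cancelˡ-≡ {bx - ax} nonzero
    (trans (eq ax bx cx cy y) (trans (cong (_+ (bx - ax) * y) e) (+-identityˡ _)))
    where
    eq : ∀ ax bx cx cy y → (bx - ax) * cy ≡ ((bx - ax) * (cy - y) - (y - y) * (cx - ax)) + (bx - ax) * y
    eq = RingSolver.solve-∀ ℚ-ring
    eq′ : ∀ a b → b ≡ (b - a) + a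
    eq′ = RingSolver.solve-∀ ℚ-ring
    nonzero : bx - ax ≢ 0ℚ
    nonzero bx-ax≡0 = ax≢bx (sym (trans (eq′ ax bx) (trans (cong (_+ ax) bx-ax≡0) (+-identityˡ ax))))

  vertical : ∀ {ay by cx cy x} → ay ≢ by → cross (x , ay) (x , by) (cx , cy) ≡ 0ℚ → cx ≡ x
  vertical {ay} {by} {cx} {cy} {x} ay≢by e =
    horizontal {ay} {by} {cy} ay≢by (trans (cross-transpose (x , ay) (x , by) (cx , cy)) (cong -_ e))

-- Real segments containing rational points.

module RealPlane where

  open import Data.Empty using (⊥)
  open import Data.Fin.Base as Fin using (Fin; inject₁; toℕ)
  import Data.Fin.Properties as Fin
  open import Data.Nat.Base using (suc)
  open import Data.Product.Base using (_×_; _,_; ∃; proj₁)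
  open import Data.Rational.Base as ℚ using (ℚ; 0ℚ; 1ℚ)
  import Data.Rational.Properties as ℚ
  open import Relation.Binary.PropositionalEquality
  import Tactic.RingSolver as RingSolver
  open import Defs
  open Reals
  open RationalPlane

  embed : ℚ² → Point
  embed (x , y) = fromℚ x , fromℚ y

  crossℝ : Point → Point → Point → ℝ
  crossℝ (ax , ay) (bx , by) (cx , cy) = (bx - ax) * (cy - ay) - (by - ay) * (cx - ax)

  lerpℝ : ℝ → ℝ → ℝ → ℝ
  lerpℝ t x y = (1ℝ - t) * x + t * y

  lerpℝ-cong : ∀ {t t′ x x′ y y′} → t ≈ t′ → x ≈ x′ → y ≈ y′ → lerpℝ t x y ≈ lerpℝ t′ x′ y′
  lerpℝ-cong {t} {t′} {x} {x′} {y} {y′} p q r =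
    +-cong {(1ℝ - t) * x} {(1ℝ - t′) * x′} {t * y} {t′ * y′}
      (*-cong {1ℝ - t} {1ℝ - t′} {x} {x′} (minus-cong {1ℝ} {1ℝ} {t} {t′} (≈-refl {1ℝ}) p) q)
      (*-cong {t} {t′} {y} {y′} p r)

  cross-cong : ∀ {a a′ b b′ c c′} → a ≈ₚ a′ → b ≈ₚ b′ → c ≈ₚ c′ → crossℝ a b c ≈ crossℝ a′ b′ c′
  cross-cong {ax , ay} {ax′ , ay′} {bx , by} {bx′ , by′} {cx , cy} {cx′ , cy′} (p , p′) (q , q′) (r , r′) =
    minus-cong {(bx - ax) * (cy - ay)} {(bx′ - ax′) * (cy′ - ay′)} {(by - ay) * (cx - ax)} {(by′ - ay′) * (cx′ - ax′)}
      (*-cong {bx - ax} {bx′ - ax′} {cy - ay} {cy′ - ay′}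
        (minus-cong {bx} {bx′} {ax} {ax′} q p) (minus-cong {cy} {cy′} {ay} {ay′} r′ p′))
      (*-cong {by - ay} {by′ - ay′} {cx - ax} {cx′ - ax′}
        (minus-cong {by} {by′} {ay} {ay′} q′ p′) (minus-cong {cx} {cx′} {ax} {ax′} r p))

  ≈ₚ-refl : ∀ {p} → p ≈ₚ p
  ≈ₚ-refl {x , y} = ≈-refl {x} , ≈-refl {y}

  start∈Segment : ∀ p q → Segment p q p
  start∈Segment (px , py) (qx , qy) =
    0ℝ , fromℚ-nonNegative {0ℚ} ℚ.≤-refl
    , nonNegative⇒≤ {0ℝ} {1ℝ} (fromℚ-nonNegative {1ℚ} (ℚ.<⇒≤ (ℚ.positive⁻¹ 1ℚ)))
    , pointwise {px} {lerpℝ 0ℝ px qx} (λ i → eq (seq px i) (seq qx i))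
    , pointwise {py} {lerpℝ 0ℝ py qy} (λ i → eq (seq py i) (seq qy i))
    where
    eq : ∀ p q → p ≡ (1ℚ ℚ.- 0ℚ) ℚ.* p ℚ.+ 0ℚ ℚ.* q
    eq = RingSolver.solve-∀ ℚ-ring

  end∈Segment : ∀ p q → Segment p q q
  end∈Segment (px , py) (qx , qy) =
    1ℝ , fromℚ-nonNegative {1ℚ} (ℚ.<⇒≤ (ℚ.positive⁻¹ 1ℚ))
    , nonNegative⇒≤ {1ℝ} {1ℝ} (fromℚ-nonNegative {0ℚ} ℚ.≤-refl)
    , pointwise {qx} {lerpℝ 1ℝ px qx} (λ i → eq (seq px i) (seq qx i))
    , pointwise {qy} {lerpℝ 1ℝ py qy} (λ i → eq (seq py i) (seq qy i))
    where
    eq : ∀ p q → q ≡ (1ℚ ℚ.- 1ℚ) ℚ.* p ℚ.+ 1ℚ ℚ.* q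
    eq = RingSolver.solve-∀ ℚ-ring

  -- Once the three points are written with their parameters r, s, t, the determinant vanishes
  -- identically as a polynomial.
  Segment-collinear : ∀ {p q a b c} →
    Segment p q a → Segment p q b → Segment p q c → crossℝ a b c ≈ 0ℝ
  Segment-collinear {p@(px , py)} {q@(qx , qy)} {a} {b} {c} (r , _ , _ , a≈) (s , _ , _ , b≈) (t , _ , _ , c≈) =
    ≈-trans {crossℝ a b c} {crossℝ (combination r p q) (combination s p q) (combination t p q)} {0ℝ}
      (cross-cong {a} {combination r p q} {b} {combination s p q} {c} {combination t p q} a≈ b≈ c≈)
      (pointwise {crossℝ (combination r p q) (combination s p q) (combination t p q)} {0ℝ}
        (λ i → eq (seq px i) (seq py i) (seq qx i) (seq qy i) (seq r i) (seq s i) (seq t i)))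
    where
    eq : ∀ px py qx qy r s t →
      cross (mix r (px , py) (qx , qy)) (mix s (px , py) (qx , qy)) (mix t (px , py) (qx , qy)) ≡ 0ℚ
    eq = eq′
      where
      eq′ : ∀ px py qx qy r s t → let f = λ t p q → (1ℚ ℚ.- t) ℚ.* p ℚ.+ t ℚ.* q in
        (f s px qx ℚ.- f r px qx) ℚ.* (f t py qy ℚ.- f r py qy)
          ℚ.- (f s py qy ℚ.- f r py qy) ℚ.* (f t px qx ℚ.- f r px qx) ≡ 0ℚ
      eq′ = RingSolver.solve-∀ ℚ-ring

  -- On embedded points `crossℝ` is a constant sequence, so its vanishing is a rational equation,
  -- although the end points `p` and `q` are real.
  embed-collinear : ∀ {p q a b c} →
    Segment p q (embed a) → Segment p q (embed b) → Segment p q (embed c) → cross a b c ≡ 0ℚ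
  embed-collinear {p} {q} {a} {b} {c} a∈ b∈ c∈ =
    fromℚ-injective {cross a b c} {0ℚ} (Segment-collinear {p} {q} {embed a} {embed b} {embed c} a∈ b∈ c∈)

  private
    cross-lerp : ∀ t cx cy ex ey px py qx qy →
      cross (cx , cy) (ex , ey) (mix t (px , py) (qx , qy)) ≡
      lerp t (cross (cx , cy) (ex , ey) (px , py)) (cross (cx , cy) (ex , ey) (qx , qy))
    cross-lerp = eq
      where
      eq : ∀ t cx cy ex ey px py qx qy →
        (ex ℚ.- cx) ℚ.* (((1ℚ ℚ.- t) ℚ.* py ℚ.+ t ℚ.* qy) ℚ.- cy)
          ℚ.- (ey ℚ.- cy) ℚ.* (((1ℚ ℚ.- t) ℚ.* px ℚ.+ t ℚ.* qx) ℚ.- cx) ≡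
        (1ℚ ℚ.- t) ℚ.* ((ex ℚ.- cx) ℚ.* (py ℚ.- cy) ℚ.- (ey ℚ.- cy) ℚ.* (px ℚ.- cx))
          ℚ.+ t ℚ.* ((ex ℚ.- cx) ℚ.* (qy ℚ.- cy) ℚ.- (ey ℚ.- cy) ℚ.* (qx ℚ.- cx))
      eq = RingSolver.solve-∀ ℚ-ring

  -- As v lies on the line c e, both cross products are nonnegative
  -- multiples of that of p.
  endpoint-line-separates-nothing : ∀ {p v a b c e} →
    Segment p v (embed a) → Segment p v (embed b) → crossℝ (embed c) (embed e) v ≈ 0ℝ →
    0ℚ ℚ.≤ cross c e a ℚ.* cross c e b
  endpoint-line-separates-nothing {p@(px , py)} {v@(vx , vy)} {a} {b} {c@(cx , cy)} {e@(ex , ey)}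
    (s , _ , s≤1 , a≈) (t , _ , t≤1 , b≈) v-on-ce =
    fromℚ-nonNegative⁻¹ {cross c e a ℚ.* cross c e b}
      (nonNegative-resp-≈ {multiple} {fromℚ (cross c e a) * fromℚ (cross c e b)}
        (≈-sym {fromℚ (cross c e a) * fromℚ (cross c e b)} {multiple}
          (≈-trans {fromℚ (cross c e a) * fromℚ (cross c e b)} {((1ℝ - s) * λₚ) * ((1ℝ - t) * λₚ)} {multiple}
            (*-cong {fromℚ (cross c e a)} {(1ℝ - s) * λₚ} {fromℚ (cross c e b)} {(1ℝ - t) * λₚ}
              (scaled a s a≈) (scaled b t b≈))
            (pointwise {((1ℝ - s) * λₚ) * ((1ℝ - t) * λₚ)} {multiple}
              (λ i → regroup (seq (1ℝ - s) i) (seq (1ℝ - t) i) (seq λₚ i)))))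
        (*-nonNegative {(1ℝ - s) * (1ℝ - t)} {λₚ * λₚ}
          (*-nonNegative {1ℝ - s} {1ℝ - t} (≤⇒nonNegative {s} {1ℝ} s≤1) (≤⇒nonNegative {t} {1ℝ} t≤1))
          (pointwise-nonNegative {λₚ * λₚ} (λ i → 0≤p² (seq λₚ i)))))
    where
    λₚ λᵥ multiple : ℝ
    λₚ = crossℝ (embed c) (embed e) p
    λᵥ = crossℝ (embed c) (embed e) v
    -- The sign of `λₚ` is unknown, but it enters only through its square, which is nonnegative
    -- entry by entry.
    multiple = ((1ℝ - s) * (1ℝ - t)) * (λₚ * λₚ)

    regroup : ∀ x y z → (x ℚ.* z) ℚ.* (y ℚ.* z) ≡ (x ℚ.* y) ℚ.* (z ℚ.* z)
    regroup = RingSolver.solve-∀ ℚ-ring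

    drop : ∀ x t → x ℚ.+ t ℚ.* 0ℚ ≡ x
    drop = RingSolver.solve-∀ ℚ-ring

    scaled : ∀ a t → embed a ≈ₚ combination t p v → fromℚ (cross c e a) ≈ (1ℝ - t) * λₚ
    scaled a t a≈ =
      ≈-trans {fromℚ (cross c e a)} {crossℝ (embed c) (embed e) (combination t p v)} {(1ℝ - t) * λₚ}
        (cross-cong {embed c} {embed c} {embed e} {embed e} {embed a} {combination t p v}
          (≈ₚ-refl {embed c}) (≈ₚ-refl {embed e}) a≈)
        (≈-trans {crossℝ (embed c) (embed e) (combination t p v)} {lerpℝ t λₚ λᵥ} {(1ℝ - t) * λₚ}
          (pointwise {crossℝ (embed c) (embed e) (combination t p v)} {lerpℝ t λₚ λᵥ}
            (λ i → cross-lerp (seq t i) cx cy ex ey (seq px i) (seq py i) (seq vx i) (seq vy i)))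
          (≈-trans {lerpℝ t λₚ λᵥ} {lerpℝ t λₚ 0ℝ} {(1ℝ - t) * λₚ}
            (lerpℝ-cong {t} {t} {λₚ} {λₚ} {λᵥ} {0ℝ} (≈-refl {t}) (≈-refl {λₚ}) v-on-ce)
            (pointwise {lerpℝ t λₚ 0ℝ} {(1ℝ - t) * λₚ} (λ i → drop (seq ((1ℝ - t) * λₚ) i) (seq t i)))))

  Segment-convex : ∀ {p q a b} t → 0ℚ ℚ.≤ t → t ℚ.≤ 1ℚ →
    Segment p q (embed a) → Segment p q (embed b) → Segment p q (embed (mix t a b))
  Segment-convex {p@(px , py)} {q@(qx , qy)} {a@(ax , ay)} {b@(bx , by)} t 0≤t t≤1
    (r , 0≤r , r≤1 , a≈x , a≈y) (s , 0≤s , s≤1 , b≈x , b≈y) =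
    w , convex {r} {s} 0≤r 0≤s
    , nonNegative⇒≤ {w} {1ℝ}
        (nonNegative-resp-≈ {lerpℝ T (1ℝ - r) (1ℝ - s)} {1ℝ - w}
          (pointwise {lerpℝ T (1ℝ - r) (1ℝ - s)} {1ℝ - w} (λ i → complement t (seq r i) (seq s i)))
          (convex {1ℝ - r} {1ℝ - s} (≤⇒nonNegative {r} {1ℝ} r≤1) (≤⇒nonNegative {s} {1ℝ} s≤1)))
    , coordinate px qx ax bx a≈x b≈x
    , coordinate py qy ay by a≈y b≈y
    where
    T w : ℝ
    T = fromℚ t
    w = lerpℝ T r s

    complement : ∀ t r s → (1ℚ ℚ.- t) ℚ.* (1ℚ ℚ.- r) ℚ.+ t ℚ.* (1ℚ ℚ.- s) ≡ 1ℚ ℚ.- ((1ℚ ℚ.- t) ℚ.* r ℚ.+ t ℚ.* s)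
    complement = RingSolver.solve-∀ ℚ-ring

    convex : ∀ {x y} → NonNegative x → NonNegative y → NonNegative (lerpℝ T x y)
    convex {x} {y} 0≤x 0≤y = +-nonNegative {(1ℝ - T) * x} {T * y}
      (*-nonNegative {1ℝ - T} {x} (fromℚ-nonNegative {1ℚ ℚ.- t} (p≤q⇒0≤q-p t≤1)) 0≤x)
      (*-nonNegative {T} {y} (fromℚ-nonNegative {t} 0≤t) 0≤y)

    eq : ∀ t r s p q → let f = λ t p q → (1ℚ ℚ.- t) ℚ.* p ℚ.+ t ℚ.* q in
      f t (f r p q) (f s p q) ≡ f (f t r s) p q
    eq = RingSolver.solve-∀ ℚ-ring

    coordinate : ∀ x y a b → fromℚ a ≈ lerpℝ r x y → fromℚ b ≈ lerpℝ s x y → fromℚ (lerp t a b) ≈ lerpℝ w x y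
    coordinate x y a b a≈ b≈ =
      ≈-trans {fromℚ (lerp t a b)} {lerpℝ T (lerpℝ r x y) (lerpℝ s x y)} {lerpℝ w x y}
        (lerpℝ-cong {T} {T} {fromℚ a} {lerpℝ r x y} {fromℚ b} {lerpℝ s x y} (≈-refl {T}) a≈ b≈)
        (pointwise {lerpℝ T (lerpℝ r x y) (lerpℝ s x y)} {lerpℝ w x y}
          (λ i → eq t (seq r i) (seq s i) (seq x i) (seq y i)))

  module _ {k} (π : PolygonalPath k) where

    vertex∈previous : ∀ {i j : Fin k} → toℕ j ≡ suc (toℕ i) → side π i (vertex π (inject₁ j))
    vertex∈previous {i} {j} j≡1+i =
      subst (λ v → side π i (vertex π v)) (Fin.toℕ-injective (sym (trans (Fin.toℕ-inject₁ j) j≡1+i)))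
        (end∈Segment (vertex π (inject₁ i)) (vertex π (Fin.suc i)))

    -- The common vertex ends side i and lies on the line through `c` and `e`, so this line cannot
    -- have `a` and `b` strictly on different sides.
    consecutive-not-crossing : ∀ {i j a b c e} → toℕ j ≡ suc (toℕ i) →
      side π i (embed a) → side π i (embed b) → side π j (embed c) → side π j (embed e) →
      Crossing a b c e → ⊥
    consecutive-not-crossing {i} {j} {a} {b} {c} {e} j≡1+i a∈ b∈ c∈ e∈ (crossing ab _) =
      ℚ.<-irrefl refl (ℚ.<-≤-trans {cross c e a ℚ.* cross c e b} {0ℚ} {cross c e a ℚ.* cross c e b} (opposite⇒*<0 {cross c e a} {cross c e b} ab)
        (endpoint-line-separates-nothing {vertex π (inject₁ i)} {v} {a} {b} {c} {e}
          (subst (λ z → Segment (vertex π (inject₁ i)) (vertex π z) (embed a)) next a∈)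
          (subst (λ z → Segment (vertex π (inject₁ i)) (vertex π z) (embed b)) next b∈)
          (Segment-collinear {v} {vertex π (Fin.suc j)} {embed c} {embed e} {v} c∈ e∈
            (start∈Segment v (vertex π (Fin.suc j))))))
      where
      v = vertex π (inject₁ j)
      next : Fin.suc i ≡ inject₁ j
      next = Fin.toℕ-injective (sym (trans (Fin.toℕ-inject₁ j) j≡1+i))

    -- By convexity the crossing point lies on both sides of the path. `Noncrossing` then forces the
    -- sides to be consecutive, and consecutive sides have no proper crossing.
    noncrossing-not-crossing : ∀ {i j a b c e} → Noncrossing π → i Fin.< j →
      side π i (embed a) → side π i (embed b) → side π j (embed c) → side π j (embed e) →
      Crossing a b c e → ⊥
    noncrossing-not-crossing {i} {j} {a} {b} {c} {e} nc i<j a∈ b∈ c∈ e∈ X = meet (crossing-point {a} {b} {c} {e} X)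
      where
      meet : (∃ λ s → ∃ λ t → (0ℚ ℚ.≤ s × s ℚ.≤ 1ℚ) × (0ℚ ℚ.≤ t × t ℚ.≤ 1ℚ) × mix s a b ≡ mix t c e) → ⊥
      meet (s , t , (0≤s , s≤1) , (0≤t , t≤1) , eq) =
        consecutive-not-crossing {i} {j} {a} {b} {c} {e} (proj₁ (nc i j i<j point ∈i ∈j)) a∈ b∈ c∈ e∈ X
        where
        point : Point
        point = embed (mix s a b)
        ∈i : side π i point
        ∈i = Segment-convex {vertex π (inject₁ i)} {vertex π (Fin.suc i)} {a} {b} s 0≤s s≤1 a∈ b∈
        ∈j : side π j point
        ∈j = subst (λ z → side π j (embed z)) (sym eq)
          (Segment-convex {vertex π (inject₁ j)} {vertex π (Fin.suc j)} {c} {e} t 0≤t t≤1 c∈ e∈)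

-- Pigeonhole arguments for lists.

module Counting where

  open import Data.Empty using (⊥)
  open import Data.Fin.Base as Fin using (Fin; suc; inject₁; toℕ)
  open import Data.Fin.Properties as Fin using (_≟_)
  open import Data.List.Base hiding (find)
  open import Data.List.Membership.Propositional using (_∈_; find; lose)
  open import Data.List.Membership.Propositional.Properties using (∈-filter⁺; ∈-filter⁻; ∈-allFin; ∈-map⁻)
  open import Data.List.Properties using (filter-notAll; length-map; length-++; length-tabulate)
  import Data.List.Relation.Unary.All as All
  open All using (All; []; _∷_)
  open import Data.List.Relation.Unary.AllPairs.Core using (AllPairs; []; _∷_)
  open import Data.List.Relation.Unary.Any using (Any; here; there; any?)
  open import Data.List.Relation.Unary.Unique.Propositional using (Unique)
  import Data.List.Relation.Unary.Unique.Propositional.Properties as Unique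
  open import Data.Nat.Base as ℕ using (ℕ; _+_; _*_; _≤_; _<_; z≤n; s≤s)
  import Data.Nat.Properties as ℕ
  open import Data.Product.Base using (_×_; _,_; proj₁; proj₂)
  open import Function.Base using (_∘_; id)
  open import Level using (0ℓ)
  open import Relation.Binary.PropositionalEquality
  open import Relation.Nullary.Decidable.Core using (yes; no; ¬?)
  open import Relation.Nullary.Negation.Core using (contradiction)
  open import Relation.Unary using (Pred; Decidable)

  module _ {A : Set} {P : Pred A 0ℓ} (P? : Decidable P) where

    length-filter-complement : ∀ xs → length (filter P? xs) + length (filter (¬? ∘ P?) xs) ≡ length xs
    length-filter-complement [] = refl
    length-filter-complement (x ∷ xs) with P? x
    ... | yes _ = cong ℕ.suc (length-filter-complement xs)
    ... | no _  = trans (ℕ.+-suc _ _) (cong ℕ.suc (length-filter-complement xs))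

    length-filter-filter : ∀ {Q : Pred A 0ℓ} (Q? : Decidable Q) xs →
      length (filter P? (filter Q? xs)) ≤ length (filter P? xs)
    length-filter-filter Q? [] = z≤n
    length-filter-filter Q? (x ∷ xs) with Q? x
    ... | yes _ with P? x
    ...   | yes _ = s≤s (length-filter-filter Q? xs)
    ...   | no _  = length-filter-filter Q? xs
    length-filter-filter Q? (x ∷ xs) | no _ with P? x
    ...   | yes _ = ℕ.m≤n⇒m≤1+n (length-filter-filter Q? xs)
    ...   | no _  = length-filter-filter Q? xs

  module _ {A : Set} {k : ℕ} (g : A → Fin k) where

    fibre : Fin k → List A → List A
    fibre i = filter (λ a → g a ≟ i)

    -- Peels the fibres off `L`, one value of `K` at a time; a repetition in `K` only weakens the
    -- bound.
    length≤fibres : ∀ d K L → (∀ {a} → a ∈ L → g a ∈ K) → (∀ i → length (fibre i L) ≤ d) → length L ≤ length K * d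
    length≤fibres d [] [] _ _ = z≤n
    length≤fibres d [] (a ∷ L) into _ with into (here refl)
    ... | ()
    length≤fibres d (i ∷ K) L into small = subst (_≤ d + length K * d)
      (length-filter-complement (λ a → g a ≟ i) L)
      (ℕ.+-mono-≤ (small i) (length≤fibres d K rest into′
        (λ j → ℕ.≤-trans (length-filter-filter (λ a → g a ≟ j) (λ a → ¬? (g a ≟ i)) L) (small j))))
      where
      rest : List A
      rest = filter (λ a → ¬? (g a ≟ i)) L
      into′ : ∀ {a} → a ∈ rest → g a ∈ K
      into′ a∈rest with ∈-filter⁻ (λ a → ¬? (g a ≟ i)) {xs = L} a∈rest
      ... | a∈L , ga≢i with into a∈L
      ...   | here ga≡i = contradiction ga≡i ga≢i
      ...   | there ga∈K = ga∈K

    module _ {L : List A} (unique : Unique L) where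

      private
        fibre⁻ : ∀ i {a} → a ∈ fibre i L → a ∈ L × g a ≡ i
        fibre⁻ i = ∈-filter⁻ (λ a → g a ≟ i) {xs = L}

      fibre≤1 : ∀ i → (∀ {a b} → a ∈ L → b ∈ L → a ≢ b → g a ≡ i → g b ≡ i → ⊥) → length (fibre i L) ≤ 1
      fibre≤1 i inj = go (fibre i L) (Unique.filter⁺ (λ a → g a ≟ i) unique) (fibre⁻ i)
        where
        go : ∀ xs → Unique xs → (∀ {a} → a ∈ xs → a ∈ L × g a ≡ i) → length xs ≤ 1
        go []          _ _ = z≤n
        go (_ ∷ [])    _ _ = ℕ.≤-refl
        go (a ∷ b ∷ _) ((a≢b ∷ _) ∷ _) mem =
          contradiction (proj₂ (mem (there (here refl))))
            (inj (proj₁ (mem (here refl))) (proj₁ (mem (there (here refl)))) a≢b (proj₂ (mem (here refl))))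

      fibre≤2 : ∀ i → (∀ {a b c} → a ∈ L → b ∈ L → c ∈ L → a ≢ b → a ≢ c → b ≢ c →
        g a ≡ i → g b ≡ i → g c ≡ i → ⊥) → length (fibre i L) ≤ 2
      fibre≤2 i no-triple = go (fibre i L) (Unique.filter⁺ (λ a → g a ≟ i) unique) (fibre⁻ i)
        where
        go : ∀ xs → Unique xs → (∀ {a} → a ∈ xs → a ∈ L × g a ≡ i) → length xs ≤ 2
        go []           _ _ = z≤n
        go (_ ∷ [])     _ _ = s≤s z≤n
        go (_ ∷ _ ∷ []) _ _ = ℕ.≤-refl
        go (a ∷ b ∷ c ∷ _) ((a≢b ∷ a≢c ∷ _) ∷ (b≢c ∷ _) ∷ _) mem =
          contradiction (proj₂ (mem (there (there (here refl)))))
            (no-triple (proj₁ (mem (here refl))) (proj₁ (mem (there (here refl)))) (proj₁ (mem (there (there (here refl)))))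
              a≢b a≢c b≢c (proj₂ (mem (here refl))) (proj₂ (mem (there (here refl)))))

      injective⇒length≤ : (∀ {a b} → a ∈ L → b ∈ L → g a ≡ g b → a ≡ b) →
        ∀ K → (∀ {a} → a ∈ L → g a ∈ K) → length L ≤ length K
      injective⇒length≤ inj K into = subst (length L ≤_) (ℕ.*-identityʳ (length K))
        (length≤fibres 1 K L into (λ i → fibre≤1 i λ a∈ b∈ a≢b p q → a≢b (inj a∈ b∈ (trans p (sym q)))))

      -- When `g` sends each line to its side, these are the sides available to the points outside
      -- all lines.
      missed : List (Fin k)
      missed = filter (λ i → ¬? (any? (λ a → g a ≟ i) L)) (allFin k)

      missed⁺ : ∀ {i} → (∀ {a} → a ∈ L → g a ≢ i) → i ∈ missed
      missed⁺ {i} h = ∈-filter⁺ (λ i → ¬? (any? (λ a → g a ≟ i) L)) (∈-allFin i)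
        (λ hit → let a , a∈L , ga≡i = find hit in h a∈L ga≡i)

      length-missed : (∀ {a b} → a ∈ L → b ∈ L → g a ≡ g b → a ≡ b) → length L + length missed ≤ k
      length-missed inj = begin
        length L + length missed      ≤⟨ ℕ.+-monoˡ-≤ (length missed) (injective⇒length≤ inj hit hit⁺) ⟩
        length hit + length missed    ≡⟨ length-filter-complement hit? (allFin k) ⟩
        length (allFin k)             ≡⟨ length-tabulate id ⟩
        k                             ∎
        where
        open ℕ.≤-Reasoning
        hit? : Decidable (λ i → Any (λ a → g a ≡ i) L)
        hit? i = any? (λ a → g a ≟ i) L
        hit : List (Fin k)
        hit = filter hit? (allFin k)
        hit⁺ : ∀ {a} → a ∈ L → g a ∈ hit
        hit⁺ {a} a∈L = ∈-filter⁺ hit? (∈-allFin (g a)) (lose a∈L refl)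

      module _ (K : List (Fin k)) (into : ∀ {a} → a ∈ L → g a ∈ K)
               (no-triple : ∀ {a b c} → a ∈ L → b ∈ L → c ∈ L → a ≢ b → a ≢ c → b ≢ c → g a ≡ g b → g a ≡ g c → ⊥) where

        private
          small : ∀ i → length (fibre i L) ≤ 2
          small i = fibre≤2 i λ a∈ b∈ c∈ a≢b a≢c b≢c p q r →
            no-triple a∈ b∈ c∈ a≢b a≢c b≢c (trans p (sym q)) (trans p (sym r))

        no-triple⇒length≤ : length L ≤ length K * 2
        no-triple⇒length≤ = length≤fibres 2 K L into small

        -- Each value has room for two elements, and that of `a` is filled by one only. Without this
        -- value the other elements number at most 2(|K| - 1).
        lonely⇒length< : ∀ {a} → a ∈ L → (∀ {b} → b ∈ L → b ≢ a → g b ≢ g a) → length L < length K * 2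
        lonely⇒length< {a} a∈L lonely = begin-strict
          length L                                     ≡⟨ length-filter-complement (λ b → g b ≟ g a) L ⟨
          length (fibre (g a) L) + length rest         ≤⟨ ℕ.+-mono-≤ (fibre≤1 (g a) at-most-one)
                                                            (length≤fibres 2 K′ rest into′ small′) ⟩
          1 + length K′ * 2                            <⟨ ℕ.n<1+n _ ⟩
          ℕ.suc (length K′) * 2                        ≤⟨ ℕ.*-monoˡ-≤ 2 shorter ⟩
          length K * 2                                 ∎
          where
          open ℕ.≤-Reasoning
          rest : List A
          rest = filter (λ b → ¬? (g b ≟ g a)) L
          K′ : List (Fin k)
          K′ = filter (λ i → ¬? (i ≟ g a)) K
          shorter : length K′ < length K
          shorter = filter-notAll (λ i → ¬? (i ≟ g a)) K (lose (into a∈L) (λ h → h refl))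
          into′ : ∀ {b} → b ∈ rest → g b ∈ K′
          into′ b∈ with ∈-filter⁻ (λ b → ¬? (g b ≟ g a)) {xs = L} b∈
          ... | b∈L , gb≢ga = ∈-filter⁺ (λ i → ¬? (i ≟ g a)) (into b∈L) gb≢ga
          small′ : ∀ i → length (fibre i rest) ≤ 2
          small′ i = ℕ.≤-trans (length-filter-filter (λ b → g b ≟ i) (λ b → ¬? (g b ≟ g a)) L) (small i)
          at-most-one : ∀ {b c} → b ∈ L → c ∈ L → b ≢ c → g b ≡ g a → g c ≡ g a → ⊥
          at-most-one {b} {c} b∈ c∈ b≢c p q = lonely b∈ b≢a p
            where
            b≢a : b ≢ a
            b≢a b≡a = lonely c∈ (λ c≡a → b≢c (trans b≡a (sym c≡a))) q

  -- The 2m numbers h y and 1 + h y are distinct and at most k.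
  spread : ∀ {m k} (h : Fin m → Fin k) → (∀ {y z} → h y ≡ h z → y ≡ z) →
    (∀ y z → toℕ (h z) ≢ ℕ.suc (toℕ (h y))) → m + m ≤ ℕ.suc k
  spread {m} {k} h inj nonadjacent = subst₂ _≤_ length-tokens (length-tabulate {n = ℕ.suc k} id)
    (injective⇒length≤ id unique (λ _ _ e → e) (allFin (ℕ.suc k)) (λ {i} _ → ∈-allFin i))
    where
    low high tokens : List (Fin (ℕ.suc k))
    low    = map (inject₁ ∘ h) (allFin m)
    high   = map (suc ∘ h) (allFin m)
    tokens = low ++ high
    length-image : (f : Fin m → Fin (ℕ.suc k)) → length (map f (allFin m)) ≡ m
    length-image f = trans (length-map f (allFin m)) (length-tabulate (λ (i : Fin m) → i))
    length-tokens : length tokens ≡ m + m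
    length-tokens = trans (length-++ low) (cong₂ _+_ (length-image (inject₁ ∘ h)) (length-image (suc ∘ h)))
    disjoint : ∀ {i} → i ∈ low × i ∈ high → ⊥
    disjoint (i∈low , i∈high) with ∈-map⁻ (inject₁ ∘ h) i∈low | ∈-map⁻ (suc ∘ h) i∈high
    ... | z , _ , refl | y , _ , e = nonadjacent y z (trans (sym (Fin.toℕ-inject₁ (h z))) (cong toℕ e))
    unique : Unique tokens
    unique = Unique.++⁺ (Unique.map⁺ (inj ∘ Fin.inject₁-injective) (Unique.allFin⁺ m))
                        (Unique.map⁺ (inj ∘ Fin.suc-injective) (Unique.allFin⁺ m)) disjoint

  -- Applied to the columns and to the rows that are not lines: the first and the last entry bound
  -- the rectangle. The entries between them are strictly inside, which keeps the four parts of the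
  -- rim disjoint.
  data Ends {n} : List (Fin n) → Set where
    empty  : Ends []
    single : ∀ a → Ends (a ∷ [])
    ends   : ∀ a xs z → a Fin.< z → All (λ x → a Fin.< x × x Fin.< z) xs → Unique xs →
             Ends (a ∷ xs ∷ʳ z)

  ends-view : ∀ {n} {xs : List (Fin n)} → AllPairs Fin._<_ xs → Ends xs
  ends-view [] = empty
  ends-view ([] ∷ []) = single _
  ends-view {xs = a ∷ x ∷ xs} ((a<x ∷ a<xs) ∷ sorted) with ends-view sorted
  ... | single .x = ends a [] x a<x [] []
  ... | ends .x ys z x<z between unique =
        ends a (x ∷ ys) z (Fin.<-trans a<x x<z)
          ((a<x , x<z) ∷ All.map (λ (x<y , y<z) → Fin.<-trans a<x x<y , y<z) between)
          (All.map (Fin.<⇒≢ ∘ proj₁) between ∷ unique)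

-- The grid coloured by the sides of the path.

module Grid where

  import Algebra.Properties.CommutativeSemigroup as CommutativeSemigroupProperties
  open import Data.Empty using (⊥; ⊥-elim)
  open import Data.Fin.Base as Fin using (Fin; toℕ)
  open import Data.Fin.Properties as Fin using (_≟_)
  open import Data.List.Base hiding (find)
  open import Data.List.Membership.Propositional using (_∈_; find; lose)
  open import Data.List.Membership.Propositional.Properties
    using (∈-filter⁺; ∈-filter⁻; ∈-allFin; ∈-map⁺; ∈-map⁻; ∈-++⁻; ∈-++⁺ˡ; ∈-++⁺ʳ; ∈-length)
  open import Data.List.Properties using (length-map; length-++; length-tabulate)
  import Data.List.Relation.Unary.All as All
  open All using (All)
  import Data.List.Relation.Unary.AllPairs.Properties as AllPairs
  open import Data.List.Relation.Unary.AllPairs.Core using (AllPairs)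
  open import Data.List.Relation.Unary.Any using (here; there; any?)
  open import Data.List.Relation.Unary.Unique.Propositional using (Unique)
  import Data.List.Relation.Unary.Unique.Propositional.Properties as Unique
  open import Data.Nat.Base as ℕ using (ℕ; _+_; _*_)
  import Data.Nat.Properties as ℕ
  import Data.Nat.Tactic.RingSolver as ℕSolver
  open import Data.Product.Base using (_×_; _,_; ∃; ∃₂; proj₁; proj₂)
  open import Data.Product.Properties using (≡-dec; ,-injectiveˡ; ,-injectiveʳ)
  open import Data.Rational.Base as ℚ using (ℚ; 0ℚ)
  import Data.Rational.Properties as ℚ
  open import Data.Sum.Base using (_⊎_; inj₁; inj₂)
  open import Data.Sum.Properties using (inj₁-injective; inj₂-injective)
  open import Function.Base using (_∘_)
  open import Relation.Binary.Definitions using (tri<; tri≈; tri>)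
  open import Relation.Binary.PropositionalEquality
  open import Relation.Nullary.Decidable.Core using (yes; no; ¬?; _×-dec_)
  open import Relation.Nullary.Negation.Core using (¬_; contradiction)
  open import Relation.Unary using (Decidable)
  open Counting
  open RationalPlane

  ≤∧≢⇒< : ∀ {n} {i j : Fin n} → i Fin.≤ j → i ≢ j → i Fin.< j
  ≤∧≢⇒< i≤j i≢j = ℕ.≤∧≢⇒< i≤j (i≢j ∘ Fin.toℕ-injective)

  -- A point on several sides receives just one of them as its colour `f`. The path itself is
  -- absent: all that remains of it is `collinear` and the order of the coordinates.
  module Colouring {n m k} (u : Fin n → ℚ) (v : Fin m → ℚ)
    (u-mono : ∀ {i j} → i Fin.< j → u i ℚ.< u j)
    (v-mono : ∀ {i j} → i Fin.< j → v i ℚ.< v j)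
    (f : Fin n × Fin m → Fin k)
    (collinear : ∀ p q r → f p ≡ f q → f p ≡ f r →
      cross (u (proj₁ p) , v (proj₂ p)) (u (proj₁ q) , v (proj₂ q)) (u (proj₁ r) , v (proj₂ r)) ≡ 0ℚ)
    where

    Index : Set
    Index = Fin n × Fin m

    point : Index → ℚ²
    point (i , j) = u i , v j

    CrossingSides : Set
    CrossingSides = ∃₂ λ a b → ∃₂ λ c e →
      f a ≡ f b × f c ≡ f e × Crossing (point a) (point b) (point c) (point e)

    u-inj : ∀ {i i′} → i ≢ i′ → u i ≢ u i′
    u-inj {i} {i′} i≢i′ e with Fin.<-cmp i i′
    ... | tri< i<i′ _ _ = ℚ.<⇒≢ (u-mono i<i′) e
    ... | tri≈ _ i≡i′ _ = i≢i′ i≡i′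
    ... | tri> _ _ i′<i = ℚ.<⇒≢ (u-mono i′<i) (sym e)

    v-inj : ∀ {j j′} → j ≢ j′ → v j ≢ v j′
    v-inj {j} {j′} j≢j′ e with Fin.<-cmp j j′
    ... | tri< j<j′ _ _ = ℚ.<⇒≢ (v-mono j<j′) e
    ... | tri≈ _ j≡j′ _ = j≢j′ j≡j′
    ... | tri> _ _ j′<j = ℚ.<⇒≢ (v-mono j′<j) (sym e)

    u-≤ : ∀ {i i′} → i Fin.≤ i′ → u i ℚ.≤ u i′
    u-≤ {i} {i′} i≤i′ with i ≟ i′
    ... | yes refl = ℚ.≤-refl
    ... | no i≢i′  = ℚ.<⇒≤ (u-mono (≤∧≢⇒< i≤i′ i≢i′))

    v-≤ : ∀ {j j′} → j Fin.≤ j′ → v j ℚ.≤ v j′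
    v-≤ {j} {j′} j≤j′ with j ≟ j′
    ... | yes refl = ℚ.≤-refl
    ... | no j≢j′  = ℚ.<⇒≤ (v-mono (≤∧≢⇒< j≤j′ j≢j′))

    -- Stated with the chosen colour and not with containment in the real segment, so that `Row?`
    -- can decide it by finite search.
    RowSide : Fin m → Fin k → Set
    RowSide j s = ∃₂ λ i i′ → i ≢ i′ × f (i , j) ≡ s × f (i′ , j) ≡ s

    ColumnSide : Fin n → Fin k → Set
    ColumnSide i s = ∃₂ λ j j′ → j ≢ j′ × f (i , j) ≡ s × f (i , j′) ≡ s

    -- Two distinct points of row `j` make the line of `s` horizontal. Hence a side serves at most
    -- one row, and no point outside that row has its colour.
    rowSide⇒row : ∀ {j s p} → RowSide j s → f p ≡ s → proj₂ p ≡ j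
    rowSide⇒row {j} {s} {p} (i , i′ , i≢i′ , e , e′) fp≡s with proj₂ p ≟ j
    ... | yes p₂≡j = p₂≡j
    ... | no p₂≢j = contradiction
          (horizontal {u i} {u i′} {u (proj₁ p)} {v (proj₂ p)} {v j} (u-inj i≢i′)
            (collinear (i , j) (i′ , j) p (trans e (sym e′)) (trans e (sym fp≡s))))
          (v-inj p₂≢j)

    columnSide⇒column : ∀ {i s p} → ColumnSide i s → f p ≡ s → proj₁ p ≡ i
    columnSide⇒column {i} {s} {p} (j , j′ , j≢j′ , e , e′) fp≡s with proj₁ p ≟ i
    ... | yes p₁≡i = p₁≡i
    ... | no p₁≢i = contradiction
          (vertical {v j} {v j′} {u (proj₁ p)} {v (proj₂ p)} {u i} (v-inj j≢j′)
            (collinear (i , j) (i , j′) p (trans e (sym e′)) (trans e (sym fp≡s))))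
          (u-inj p₁≢i)

    row≢column : ∀ {i j s} → RowSide j s → ColumnSide i s → ⊥
    row≢column row@(i , i′ , i≢i′ , e , e′) column =
      i≢i′ (trans (columnSide⇒column column e) (sym (columnSide⇒column column e′)))

    Row? : Decidable (λ j → ∃ (RowSide j))
    Row? j with Fin.any? (λ i → Fin.any? (λ i′ → ¬? (i ≟ i′) ×-dec (f (i , j) ≟ f (i′ , j))))
    ... | yes (i , i′ , i≢i′ , e) = yes (f (i′ , j) , i , i′ , i≢i′ , e , refl)
    ... | no h = no λ (s , i , i′ , i≢i′ , e , e′) → h (i , i′ , i≢i′ , trans e (sym e′))

    Column? : Decidable (λ i → ∃ (ColumnSide i))
    Column? i with Fin.any? (λ j → Fin.any? (λ j′ → ¬? (j ≟ j′) ×-dec (f (i , j) ≟ f (i , j′))))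
    ... | yes (j , j′ , j≢j′ , e) = yes (f (i , j′) , j , j′ , j≢j′ , e , refl)
    ... | no h = no λ (s , j , j′ , j≢j′ , e , e′) → h (j , j′ , j≢j′ , trans e (sym e′))

    all-rows : (∀ j → ∃ (RowSide j)) →
      (∀ {j j′ s s′} → RowSide j s → RowSide j′ s′ → toℕ s′ ≡ ℕ.suc (toℕ s) → j ≡ j′) →
      m + m ℕ.≤ ℕ.suc k
    all-rows row consecutive = spread (proj₁ ∘ row) inj nonadjacent
      where
      inj : ∀ {j j′} → proj₁ (row j) ≡ proj₁ (row j′) → j ≡ j′
      inj {j} {j′} e = let i , _ , _ , f≡ , _ = proj₂ (row j) in rowSide⇒row (proj₂ (row j′)) (trans f≡ e)
      nonadjacent : ∀ j j′ → toℕ (proj₁ (row j′)) ≢ ℕ.suc (toℕ (proj₁ (row j)))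
      nonadjacent j j′ e with consecutive (proj₂ (row j)) (proj₂ (row j′)) e
      ... | refl = ℕ.1+n≢n (sym e)

    all-columns : (∀ i → ∃ (ColumnSide i)) →
      (∀ {i i′ s s′} → ColumnSide i s → ColumnSide i′ s′ → toℕ s′ ≡ ℕ.suc (toℕ s) → i ≡ i′) →
      n + n ℕ.≤ ℕ.suc k
    all-columns column consecutive = spread (proj₁ ∘ column) inj nonadjacent
      where
      inj : ∀ {i i′} → proj₁ (column i) ≡ proj₁ (column i′) → i ≡ i′
      inj {i} {i′} e = let j , _ , _ , f≡ , _ = proj₂ (column i) in columnSide⇒column (proj₂ (column i′)) (trans f≡ e)
      nonadjacent : ∀ i i′ → toℕ (proj₁ (column i′)) ≢ ℕ.suc (toℕ (proj₁ (column i)))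
      nonadjacent i i′ e with consecutive (proj₂ (column i)) (proj₂ (column i′)) e
      ... | refl = ℕ.1+n≢n (sym e)

    Free : Index → Set
    Free (i , j) = ¬ ∃ (ColumnSide i) × ¬ ∃ (RowSide j)

    free-row : ∀ {i i′ j} → Free (i , j) → f (i , j) ≡ f (i′ , j) → i ≡ i′
    free-row {i} {i′} {j} (_ , ¬row) e with i ≟ i′
    ... | yes i≡i′ = i≡i′
    ... | no i≢i′  = contradiction (f (i′ , j) , i , i′ , i≢i′ , e , refl) ¬row

    free-column : ∀ {i j j′} → Free (i , j) → f (i , j) ≡ f (i , j′) → j ≡ j′
    free-column {i} {j} {j′} (¬column , _) e with j ≟ j′
    ... | yes j≡j′ = j≡j′
    ... | no j≢j′  = contradiction (f (i , j′) , j , j′ , j≢j′ , e , refl) ¬column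

    free-≢ : ∀ {p q} → Free p → p ≢ q → f p ≡ f q → proj₁ p ≢ proj₁ q × proj₂ p ≢ proj₂ q
    free-≢ {i , j} {i′ , j′} free p≢q e =
      (λ { refl → p≢q (cong (i ,_) (free-column free e)) }) ,
      (λ { refl → p≢q (cong (_, j) (free-row free e)) })

    module Rectangle {l r : Fin n} {b t : Fin m} (l<r : l Fin.< r) (b<t : b Fin.< t) where

      record OnRim (p : Index) : Set where
        constructor onRim
        field
          free : Free p
          l≤   : l Fin.≤ proj₁ p
          ≤r   : proj₁ p Fin.≤ r
          b≤   : b Fin.≤ proj₂ p
          ≤t   : proj₂ p Fin.≤ t
          rim  : (proj₁ p ≡ l ⊎ proj₁ p ≡ r) ⊎ (proj₂ p ≡ b ⊎ proj₂ p ≡ t)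
      open OnRim

      -- As `q` is strictly between two rim points in the order of columns, it is on neither
      -- vertical side of the rectangle. Points of equal colour are in different rows by `free-≢`,
      -- so `q` on the bottom side is strictly lower than both others, and on the top side strictly
      -- higher; either contradicts collinearity.
      middle : ∀ {p q o} → OnRim p → OnRim q → OnRim o →
        proj₁ p Fin.< proj₁ q → proj₁ q Fin.< proj₁ o → f q ≡ f p → f q ≡ f o → ⊥
      middle {p} {q} {o} P Q O p<q q<o e e′ with rim Q
      ... | inj₁ (inj₁ refl) = ℕ.<⇒≱ p<q (l≤ P)
      ... | inj₁ (inj₂ refl) = ℕ.<⇒≱ q<o (≤r O)
      ... | inj₂ (inj₁ refl) = ℚ.<⇒≢
              (below-chord (u-mono p<q) (u-mono q<o)
                (v-mono (≤∧≢⇒< (b≤ P) (proj₂ (free-≢ (free Q) (λ {refl → Fin.<-irrefl refl p<q}) e))))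
                (v-mono (≤∧≢⇒< (b≤ O) (proj₂ (free-≢ (free Q) (λ {refl → Fin.<-irrefl refl q<o}) e′)))))
              (collinear q p o e e′)
      ... | inj₂ (inj₂ refl) = ℚ.<⇒≢
              (above-chord (u-mono p<q) (u-mono q<o)
                (v-mono (≤∧≢⇒< (≤t P) (proj₂ (free-≢ (free Q) (λ {refl → Fin.<-irrefl refl p<q}) e) ∘ sym)))
                (v-mono (≤∧≢⇒< (≤t O) (proj₂ (free-≢ (free Q) (λ {refl → Fin.<-irrefl refl q<o}) e′) ∘ sym))))
              (sym (collinear q p o e e′))

      no-triple : ∀ {p q o} → OnRim p → OnRim q → OnRim o → p ≢ q → p ≢ o → q ≢ o → f p ≡ f q → f p ≡ f o → ⊥
      no-triple {p} {q} {o} P Q O p≢q p≢o q≢o e e′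
        with Fin.<-cmp (proj₁ p) (proj₁ q) | Fin.<-cmp (proj₁ q) (proj₁ o) | Fin.<-cmp (proj₁ p) (proj₁ o)
      ... | tri≈ _ p≡q _ | _ | _ = proj₁ (free-≢ (free P) p≢q e) p≡q
      ... | _ | tri≈ _ q≡o _ | _ = proj₁ (free-≢ (free Q) q≢o (trans (sym e) e′)) q≡o
      ... | _ | _ | tri≈ _ p≡o _ = proj₁ (free-≢ (free P) p≢o e′) p≡o
      ... | tri< p<q _ _ | tri< q<o _ _ | _ = middle P Q O p<q q<o (sym e) (trans (sym e) e′)
      ... | tri> _ _ q<p | tri> _ _ o<q | _ = middle O Q P o<q q<p (trans (sym e) e′) (sym e)
      ... | tri< p<q _ _ | tri> _ _ o<q | tri< p<o _ _ = middle P O Q p<o o<q (sym e′) (trans (sym e′) e)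
      ... | tri< p<q _ _ | tri> _ _ o<q | tri> _ _ o<p = middle O P Q o<p p<q e′ e
      ... | tri> _ _ q<p | tri< q<o _ _ | tri< p<o _ _ = middle Q P O q<p p<o e e′
      ... | tri> _ _ q<p | tri< q<o _ _ | tri> _ _ o<p = middle Q O P q<o o<p (trans (sym e′) e) (sym e′)

      bl br tl : Index
      bl = l , b
      br = r , b
      tl = l , t

      -- The chord from the bottom left corner ends on the right or on the
      -- top side, and so cuts off the bottom right or the top left corner;
      -- the chord from that corner has to cross it.
      corner-chords-cross : OnRim bl → OnRim br → OnRim tl →
        (∃ λ p → OnRim p × p ≢ bl × f p ≡ f bl) →
        (∃ λ p → OnRim p × p ≢ br × f p ≡ f br) →
        (∃ λ p → OnRim p × p ≢ tl × f p ≡ f tl) → CrossingSides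
      corner-chords-cross BL BR TL (p , P , p≢bl , fp) (q , Q , q≢br , fq) (o , O , o≢tl , fo)
        with free-≢ (free P) p≢bl fp
      ... | p₁≢l , p₂≢b = cases (rim P)
        where
        l<p : l Fin.< proj₁ p
        l<p = ≤∧≢⇒< (l≤ P) (p₁≢l ∘ sym)
        b<p : b Fin.< proj₂ p
        b<p = ≤∧≢⇒< (b≤ P) (p₂≢b ∘ sym)

        ends-right : proj₁ p ≡ r → CrossingSides
        ends-right refl = bl , p , br , q , sym fp , sym fq ,
          corner-crossing (u-mono l<r) (v-mono b<p) (v-≤ (≤t P)) (u-≤ (l≤ Q))
            (u-mono (≤∧≢⇒< (≤r Q) (proj₁ q≢))) (v-mono (≤∧≢⇒< (b≤ Q) (proj₂ q≢ ∘ sym))) (end (rim Q))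
          where
          q≢ = free-≢ (free Q) q≢br fq
          end : (proj₁ q ≡ l ⊎ proj₁ q ≡ r) ⊎ (proj₂ q ≡ b ⊎ proj₂ q ≡ t) → u (proj₁ q) ≡ u l ⊎ v (proj₂ q) ≡ v t
          end (inj₁ (inj₁ e)) = inj₁ (cong u e)
          end (inj₁ (inj₂ e)) = contradiction e (proj₁ q≢)
          end (inj₂ (inj₁ e)) = contradiction e (proj₂ q≢)
          end (inj₂ (inj₂ e)) = inj₂ (cong v e)

        ends-top : proj₂ p ≡ t → CrossingSides
        ends-top refl = bl , p , tl , o , sym fp , sym fo ,
          crossing-transpose (point bl) (point p) (point tl) (point o)
            (corner-crossing (v-mono b<t) (u-mono l<p) (u-≤ (≤r P)) (v-≤ (b≤ O))
              (v-mono (≤∧≢⇒< (≤t O) (proj₂ o≢))) (u-mono (≤∧≢⇒< (l≤ O) (proj₁ o≢ ∘ sym))) (end (rim O)))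
          where
          o≢ = free-≢ (free O) o≢tl fo
          end : (proj₁ o ≡ l ⊎ proj₁ o ≡ r) ⊎ (proj₂ o ≡ b ⊎ proj₂ o ≡ t) → v (proj₂ o) ≡ v b ⊎ u (proj₁ o) ≡ u r
          end (inj₁ (inj₁ e)) = contradiction e (proj₁ o≢)
          end (inj₁ (inj₂ e)) = inj₂ (cong u e)
          end (inj₂ (inj₁ e)) = inj₁ (cong v e)
          end (inj₂ (inj₂ e)) = contradiction e (proj₂ o≢)

        cases : (proj₁ p ≡ l ⊎ proj₁ p ≡ r) ⊎ (proj₂ p ≡ b ⊎ proj₂ p ≡ t) → CrossingSides
        cases (inj₁ (inj₁ e)) = contradiction e p₁≢l
        cases (inj₁ (inj₂ e)) = ends-right e
        cases (inj₂ (inj₁ e)) = contradiction e p₂≢b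
        cases (inj₂ (inj₂ e)) = ends-top e

    module _ (default : Fin k) where

      private
        freeRows : List (Fin m)
        freeRows = filter (¬? ∘ Row?) (allFin m)

        freeColumns : List (Fin n)
        freeColumns = filter (¬? ∘ Column?) (allFin n)

        lineRows : List (Fin m)
        lineRows = filter Row? (allFin m)

        lineColumns : List (Fin n)
        lineColumns = filter Column? (allFin n)

        lines : List (Fin m ⊎ Fin n)
        lines = map inj₁ lineRows ++ map inj₂ lineColumns

        -- Only meaningful on lines; elsewhere it is default.
        lineSide : Fin m ⊎ Fin n → Fin k
        lineSide (inj₁ j) with Row? j
        ... | yes (s , _) = s
        ... | no _ = default
        lineSide (inj₂ i) with Column? i
        ... | yes (s , _) = s
        ... | no _ = default

        LineSide : Fin m ⊎ Fin n → Fin k → Set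
        LineSide (inj₁ j) = RowSide j
        LineSide (inj₂ i) = ColumnSide i

        lineSide-correct : ∀ {x} → x ∈ lines → LineSide x (lineSide x)
        lineSide-correct {x} x∈ with ∈-++⁻ (map inj₁ lineRows) x∈
        ... | inj₁ x∈rows with ∈-map⁻ inj₁ x∈rows
        ...   | j , j∈ , refl with Row? j
        ...     | yes (_ , row) = row
        ...     | no ¬row = contradiction (proj₂ (∈-filter⁻ Row? {xs = allFin m} j∈)) ¬row
        lineSide-correct {x} x∈ | inj₂ x∈columns with ∈-map⁻ inj₂ x∈columns
        ...   | i , i∈ , refl with Column? i
        ...     | yes (_ , column) = column
        ...     | no ¬column = contradiction (proj₂ (∈-filter⁻ Column? {xs = allFin n} i∈)) ¬column

        lines-unique : Unique lines
        lines-unique = Unique.++⁺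
          (Unique.map⁺ inj₁-injective (Unique.filter⁺ Row? (Unique.allFin⁺ m)))
          (Unique.map⁺ inj₂-injective (Unique.filter⁺ Column? (Unique.allFin⁺ n)))
          disjoint
          where
          disjoint : ∀ {x} → x ∈ map inj₁ lineRows × x ∈ map inj₂ lineColumns → ⊥
          disjoint (x∈rows , x∈columns) with ∈-map⁻ inj₁ x∈rows | ∈-map⁻ inj₂ x∈columns
          ... | _ , _ , refl | _ , _ , ()

        lineSide-injective : ∀ {x y} → x ∈ lines → y ∈ lines → lineSide x ≡ lineSide y → x ≡ y
        lineSide-injective {x} {y} x∈ y∈ e = distinct x y (lineSide-correct x∈) (lineSide-correct y∈) e
          where
          distinct : ∀ x y {s s′} → LineSide x s → LineSide y s′ → s ≡ s′ → x ≡ y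
          distinct (inj₁ j) (inj₁ j′) (_ , _ , _ , e , _) row refl = cong inj₁ (rowSide⇒row row e)
          distinct (inj₁ j) (inj₂ i)  row column refl = ⊥-elim (row≢column row column)
          distinct (inj₂ i) (inj₁ j)  column row refl = ⊥-elim (row≢column row column)
          distinct (inj₂ i) (inj₂ i′) (_ , _ , _ , e , _) column refl = cong inj₂ (columnSide⇒column column e)

        freeSides : List (Fin k)
        freeSides = missed lineSide lines-unique

        free-side : ∀ {p} → Free p → f p ∈ freeSides
        free-side {p} (¬column , ¬row) = missed⁺ lineSide lines-unique λ {x} x∈ e → off x (lineSide-correct x∈) (sym e)
          where
          off : ∀ x {s} → LineSide x s → f p ≡ s → ⊥
          off (inj₁ j) {s} row e    = ¬row (s , subst (λ j → RowSide j s) (sym (rowSide⇒row row e)) row)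
          off (inj₂ i) {s} column e = ¬column (s , subst (λ i → ColumnSide i s) (sym (columnSide⇒column column e)) column)

        -- Adds the remaining rows and columns to both sides of the inequality: these are the lines,
        -- and their sides are distinct and disjoint from `freeSides`.
        count : ∀ d → length freeColumns + length freeRows ℕ.≤ d + length freeSides → n + m ℕ.≤ d + k
        count d h = begin
          n + m                                       ≡⟨ cong₂ _+_ columns rows ⟨
          (hc + fc) + (hr + fr)                       ≡⟨ +-interchange hc fc hr fr ⟩
          (hc + hr) + (fc + fr)                       ≤⟨ ℕ.+-monoʳ-≤ (hc + hr) h ⟩
          (hc + hr) + (d + length freeSides)          ≡⟨ x∙yz≈y∙xz (hc + hr) d (length freeSides) ⟩
          d + ((hc + hr) + length freeSides)          ≡⟨ cong (λ z → d + (z + length freeSides)) (trans (ℕ.+-comm hc hr) (sym length-lines)) ⟩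
          d + (length lines + length freeSides)       ≤⟨ ℕ.+-monoʳ-≤ d (length-missed lineSide lines-unique lineSide-injective) ⟩
          d + k                                       ∎
          where
          open ℕ.≤-Reasoning
          open CommutativeSemigroupProperties ℕ.+-commutativeSemigroup using (x∙yz≈y∙xz) renaming (interchange to +-interchange)
          hc hr fc fr : ℕ
          hc = length lineColumns
          hr = length lineRows
          fc = length freeColumns
          fr = length freeRows
          columns : hc + fc ≡ n
          columns = trans (length-filter-complement Column? (allFin n)) (length-tabulate (λ (i : Fin n) → i))
          rows : hr + fr ≡ m
          rows = trans (length-filter-complement Row? (allFin m)) (length-tabulate (λ (j : Fin m) → j))
          length-lines : length lines ≡ hr + hc
          length-lines = trans (length-++ (map inj₁ lineRows))
            (cong₂ _+_ (length-map inj₁ lineRows) (length-map inj₂ lineColumns))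

        -- Two rim points to a side give only the bound with 2; in the extremal case a crossing has
        -- to be exhibited as well. The constants become those of `lower-bound` through `count`.
        Result : ℕ → ℕ → Set
        Result c r = (c + r ℕ.≤ 1 + length freeSides) ⊎ (c + r ℕ.≤ 2 + length freeSides × CrossingSides)

        rectangle : ∀ {C R} → Ends C → Ends R → Unique C → Unique R →
          (∀ {i} → i ∈ C → ¬ ∃ (ColumnSide i)) → (∀ {j} → j ∈ R → ¬ ∃ (RowSide j)) →
          1 ℕ.≤ length C → 1 ℕ.≤ length R → Result (length C) (length R)
        -- In a single column all free points have different colours, so there are as many free
        -- sides as rows in `R`, and the stronger alternative holds.
        rectangle (single c) _ _ R! freeC freeR _ _ = inj₁ (ℕ.s≤s
          (injective⇒length≤ (λ j → f (c , j)) R! (λ j∈ _ → free-column (freeC (here refl) , freeR j∈))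
            freeSides (λ j∈ → free-side (freeC (here refl) , freeR j∈))))
        rectangle (ends _ _ _ _ _ _) (single r) C! _ freeC freeR _ _ = inj₁
          (subst (ℕ._≤ 1 + length freeSides) (ℕ.+-comm 1 _) (ℕ.s≤s
            (injective⇒length≤ (λ i → f (i , r)) C! (λ i∈ _ → free-row (freeC i∈ , freeR (here refl)))
              freeSides (λ i∈ → free-side (freeC i∈ , freeR (here refl))))))
        rectangle (ends l xs r l<r xs-between _) (ends b ys t b<t ys-between ys!) C! R! freeC freeR _ _ =
          result
          where
          open Rectangle l<r b<t
          C : List (Fin n)
          C = l ∷ xs ∷ʳ r

          -- The bottom and the top row include the corners; the vertical sides run over the inner
          -- rows `ys` only, so that no corner is counted twice.
          bottom top left right rimPoints : List Index
          bottom = map (_, b) C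
          top    = map (_, t) C
          left   = map (l ,_) ys
          right  = map (r ,_) ys
          rimPoints = bottom ++ (top ++ (left ++ right))

          range : ∀ {i} → i ∈ C → l Fin.≤ i × i Fin.≤ r
          range (here refl) = ℕ.≤-refl , ℕ.<⇒≤ l<r
          range (there i∈) with ∈-++⁻ xs i∈
          ... | inj₁ i∈xs = let l<i , i<r = All.lookup xs-between i∈xs in ℕ.<⇒≤ l<i , ℕ.<⇒≤ i<r
          ... | inj₂ (here refl) = ℕ.<⇒≤ l<r , ℕ.≤-refl

          l∈ : l ∈ C
          l∈ = here refl
          r∈ : r ∈ C
          r∈ = there (∈-++⁺ʳ xs (here refl))
          t∈ : t ∈ b ∷ ys ∷ʳ t
          t∈ = there (∈-++⁺ʳ ys (here refl))

          onBottom : ∀ {i} → i ∈ C → OnRim (i , b)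
          onBottom i∈ = onRim (freeC i∈ , freeR (here refl)) (proj₁ (range i∈)) (proj₂ (range i∈))
            ℕ.≤-refl (ℕ.<⇒≤ b<t) (inj₂ (inj₁ refl))

          onTop : ∀ {i} → i ∈ C → OnRim (i , t)
          onTop i∈ = onRim (freeC i∈ , freeR t∈) (proj₁ (range i∈)) (proj₂ (range i∈))
            (ℕ.<⇒≤ b<t) ℕ.≤-refl (inj₂ (inj₂ refl))

          onSide : ∀ {i j} → i ≡ l ⊎ i ≡ r → i ∈ C → j ∈ ys → OnRim (i , j)
          onSide e i∈ j∈ = onRim (freeC i∈ , freeR (there (∈-++⁺ˡ j∈))) (proj₁ (range i∈)) (proj₂ (range i∈))
            (ℕ.<⇒≤ (proj₁ (All.lookup ys-between j∈))) (ℕ.<⇒≤ (proj₂ (All.lookup ys-between j∈))) (inj₁ e)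

          rim⁻ : ∀ {p} → p ∈ rimPoints → OnRim p
          rim⁻ p∈ with ∈-++⁻ bottom p∈
          ... | inj₁ p∈bottom with ∈-map⁻ (_, b) p∈bottom
          ...   | _ , i∈ , refl = onBottom i∈
          rim⁻ p∈ | inj₂ p∈′ with ∈-++⁻ top p∈′
          ... | inj₁ p∈top with ∈-map⁻ (_, t) p∈top
          ...   | _ , i∈ , refl = onTop i∈
          rim⁻ p∈ | inj₂ p∈′ | inj₂ p∈″ with ∈-++⁻ left p∈″
          ... | inj₁ p∈left with ∈-map⁻ (l ,_) p∈left
          ...   | _ , j∈ , refl = onSide (inj₁ refl) l∈ j∈
          rim⁻ p∈ | inj₂ p∈′ | inj₂ p∈″ | inj₂ p∈right with ∈-map⁻ (r ,_) p∈right
          ...   | _ , j∈ , refl = onSide (inj₂ refl) r∈ j∈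

          rim-unique : Unique rimPoints
          rim-unique = Unique.++⁺ (Unique.map⁺ ,-injectiveˡ C!)
            (Unique.++⁺ (Unique.map⁺ ,-injectiveˡ C!)
              (Unique.++⁺ (Unique.map⁺ ,-injectiveʳ ys!) (Unique.map⁺ ,-injectiveʳ ys!) left-right)
              top-sides)
            bottom-rest
            where
            row-of : ∀ {j p} → p ∈ map (_, j) C → proj₂ p ≡ j
            row-of p∈ with ∈-map⁻ _ p∈
            ... | _ , _ , refl = refl
            inner : ∀ {p} → p ∈ left ++ right → b Fin.< proj₂ p × proj₂ p Fin.< t
            inner p∈ with ∈-++⁻ left p∈
            ... | inj₁ p∈left with ∈-map⁻ (l ,_) p∈left
            ...   | _ , j∈ , refl = All.lookup ys-between j∈
            inner p∈ | inj₂ p∈right with ∈-map⁻ (r ,_) p∈right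
            ...   | _ , j∈ , refl = All.lookup ys-between j∈
            left-right : ∀ {p} → p ∈ left × p ∈ right → ⊥
            left-right (p∈left , p∈right) with ∈-map⁻ (l ,_) p∈left | ∈-map⁻ (r ,_) p∈right
            ... | _ , _ , refl | _ , _ , e = Fin.<⇒≢ l<r (cong proj₁ e)
            top-sides : ∀ {p} → p ∈ top × p ∈ left ++ right → ⊥
            top-sides (p∈top , p∈sides) = Fin.<⇒≢ (proj₂ (inner p∈sides)) (row-of p∈top)
            bottom-rest : ∀ {p} → p ∈ bottom × p ∈ top ++ (left ++ right) → ⊥
            bottom-rest (p∈bottom , p∈) with ∈-++⁻ top p∈
            ... | inj₁ p∈top   = Fin.<⇒≢ b<t (trans (sym (row-of p∈bottom)) (row-of p∈top))
            ... | inj₂ p∈sides = Fin.<⇒≢ (proj₁ (inner p∈sides)) (sym (row-of p∈bottom))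

          into : ∀ {p} → p ∈ rimPoints → f p ∈ freeSides
          into p∈ = free-side (OnRim.free (rim⁻ p∈))

          no-triple′ : ∀ {p q o} → p ∈ rimPoints → q ∈ rimPoints → o ∈ rimPoints →
            p ≢ q → p ≢ o → q ≢ o → f p ≡ f q → f p ≡ f o → ⊥
          no-triple′ p∈ q∈ o∈ = no-triple (rim⁻ p∈) (rim⁻ q∈) (rim⁻ o∈)

          -- As `ys` lacks the bottom and the top row, this is c + r - 2.
          half-rim : ℕ
          half-rim = length C + length ys

          length-rim : length rimPoints ≡ half-rim * 2
          length-rim = begin
            length rimPoints                                          ≡⟨ length-++ bottom ⟩
            length bottom + length (top ++ (left ++ right))           ≡⟨ cong (length bottom +_) (length-++ top) ⟩
            length bottom + (length top + length (left ++ right))     ≡⟨ cong (λ z → length bottom + (length top + z)) (length-++ left) ⟩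
            length bottom + (length top + (length left + length right))
              ≡⟨ cong₂ (λ x y → x + y) (length-map (_, b) C)
                   (cong₂ _+_ (length-map (_, t) C) (cong₂ _+_ (length-map (l ,_) ys) (length-map (r ,_) ys))) ⟩
            length C + (length C + (length ys + length ys))           ≡⟨ double (length C) (length ys) ⟩
            half-rim * 2                                              ∎
            where
            open ≡-Reasoning
            double : ∀ c y → c + (c + (y + y)) ≡ (c + y) * 2
            double = ℕSolver.solve-∀

          sides-total : length C + length (b ∷ ys ∷ʳ t) ≡ 2 + half-rim
          sides-total = trans (cong (λ z → length C + ℕ.suc z) (length-++ ys)) (shift (length C) (length ys))
            where
            shift : ∀ c y → c + ℕ.suc (y + 1) ≡ 2 + (c + y)
            shift = ℕSolver.solve-∀

          Partner : Index → Set
          Partner c = ∃ λ p → OnRim p × p ≢ c × f p ≡ f c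

          -- A rim point alone on its side makes the count of rim points strict. As the rim has an
          -- even number of points, halving turns this into a whole additional free side.
          partner : ∀ {c} → c ∈ rimPoints → Partner c ⊎ half-rim ℕ.< length freeSides
          partner {c} c∈ with any? (λ p → ¬? (≡-dec _≟_ _≟_ p c) ×-dec (f p ≟ f c)) rimPoints
          ... | yes h = let p , p∈ , p≢c , e = find h in inj₁ (p , rim⁻ p∈ , p≢c , e)
          ... | no h  = inj₂ (ℕ.*-cancelʳ-< 2 half-rim (length freeSides) (subst (ℕ._< length freeSides * 2) length-rim
                  (lonely⇒length< f rim-unique freeSides into no-triple′ c∈
                    (λ p∈ p≢c e → h (lose p∈ (p≢c , e))))))

          few : half-rim ℕ.< length freeSides → Result (length C) (length (b ∷ ys ∷ʳ t))
          few h = inj₁ (subst (ℕ._≤ 1 + length freeSides) (sym sides-total) (ℕ.s≤s h))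

          result : Result (length C) (length (b ∷ ys ∷ʳ t))
          result with partner {bl} (∈-++⁺ˡ (∈-map⁺ (_, b) l∈)) | partner {br} (∈-++⁺ˡ (∈-map⁺ (_, b) r∈))
                    | partner {tl} (∈-++⁺ʳ bottom (∈-++⁺ˡ (∈-map⁺ (_, t) l∈)))
          ... | inj₂ h | _      | _      = few h
          ... | inj₁ _ | inj₂ h | _      = few h
          ... | inj₁ _ | inj₁ _ | inj₂ h = few h
          ... | inj₁ p | inj₁ q | inj₁ o = inj₂
                ( subst (ℕ._≤ 2 + length freeSides) (sym sides-total) (ℕ.s≤s (ℕ.s≤s
                    (ℕ.*-cancelʳ-≤ half-rim (length freeSides) 2 (subst (ℕ._≤ length freeSides * 2) length-rim
                      (no-triple⇒length≤ f rim-unique freeSides into no-triple′)))))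
                , corner-chords-cross (onBottom l∈) (onBottom r∈) (onTop l∈) p q o)

      free-point⇒bound : ∀ {i j} → Free (i , j) → n + m ℕ.≤ 1 + k ⊎ (n + m ℕ.≤ 2 + k × CrossingSides)
      free-point⇒bound {i} {j} (¬column , ¬row)
        with rectangle
               (ends-view (AllPairs.filter⁺ (¬? ∘ Column?) (AllPairs.tabulate⁺-< (λ i<j → i<j))))
               (ends-view (AllPairs.filter⁺ (¬? ∘ Row?) (AllPairs.tabulate⁺-< (λ i<j → i<j))))
               (Unique.filter⁺ (¬? ∘ Column?) (Unique.allFin⁺ n))
               (Unique.filter⁺ (¬? ∘ Row?) (Unique.allFin⁺ m))
               (λ i∈ → proj₂ (∈-filter⁻ (¬? ∘ Column?) {xs = allFin n} i∈))
               (λ j∈ → proj₂ (∈-filter⁻ (¬? ∘ Row?) {xs = allFin m} j∈))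
               (∈-length (∈-filter⁺ (¬? ∘ Column?) (∈-allFin i) ¬column))
               (∈-length (∈-filter⁺ (¬? ∘ Row?) (∈-allFin j) ¬row))
      ... | inj₁ h = inj₁ (count 1 h)
      ... | inj₂ (h , X) = inj₂ (count 2 h , X)

-- The natural numbers inside the rationals.

module Integral where

  open import Data.Integer.Base as ℤ using (+_)
  import Data.Integer.Properties as ℤ
  open import Data.Nat.Base as ℕ using (ℕ)
  import Data.Nat.Properties as ℕ
  open import Data.Rational.Base
  open import Data.Rational.Properties
  open import Data.Rational.Unnormalised.Base as ℚᵘ using (ℚᵘ; mkℚᵘ; *<*; *≤*; *≡*)
  import Data.Rational.Unnormalised.Properties as ℚᵘ
  open import Relation.Binary.PropositionalEquality

  ι : ℕ → ℚ
  ι a = + a / 1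

  private
    -- The fraction with denominator 1, which `mkℚᵘ` stores as 0. The laws of `ι`, whose value is in
    -- lowest terms, are proved here and carried over along `toℚᵘ`.
    ιᵘ : ℕ → ℚᵘ
    ιᵘ a = mkℚᵘ (+ a) 0

    toℚᵘ-ι : ∀ a → toℚᵘ (ι a) ℚᵘ.≃ ιᵘ a
    toℚᵘ-ι a = toℚᵘ-fromℚᵘ (ιᵘ a)

  ι-mono-< : ∀ {a b} → a ℕ.< b → ι a < ι b
  ι-mono-< {a} {b} a<b = toℚᵘ-cancel-< (ℚᵘ.<-respˡ-≃ (ℚᵘ.≃-sym (toℚᵘ-ι a)) (ℚᵘ.<-respʳ-≃ (ℚᵘ.≃-sym (toℚᵘ-ι b))
    (*<* (subst₂ ℤ._<_ (sym (ℤ.*-identityʳ (+ a))) (sym (ℤ.*-identityʳ (+ b))) (ℤ.+<+ a<b)))))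

  ι-mono-≤ : ∀ {a b} → a ℕ.≤ b → ι a ≤ ι b
  ι-mono-≤ {a} {b} a≤b = toℚᵘ-cancel-≤ (ℚᵘ.≤-respˡ-≃ (ℚᵘ.≃-sym (toℚᵘ-ι a)) (ℚᵘ.≤-respʳ-≃ (ℚᵘ.≃-sym (toℚᵘ-ι b))
    (*≤* (subst₂ ℤ._≤_ (sym (ℤ.*-identityʳ (+ a))) (sym (ℤ.*-identityʳ (+ b))) (ℤ.+≤+ a≤b)))))

  ι-+ : ∀ a b → ι (a ℕ.+ b) ≡ ι a + ι b
  ι-+ a b = toℚᵘ-injective (begin
    toℚᵘ (ι (a ℕ.+ b))               ≈⟨ toℚᵘ-ι (a ℕ.+ b) ⟩
    ιᵘ (a ℕ.+ b)                     ≈⟨ *≡* (cong (ℤ._* + 1) (sym (cong₂ ℤ._+_ (ℤ.*-identityʳ (+ a)) (ℤ.*-identityʳ (+ b))))) ⟩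
    ιᵘ a ℚᵘ.+ ιᵘ b                   ≈⟨ ℚᵘ.+-cong (toℚᵘ-ι a) (toℚᵘ-ι b) ⟨
    toℚᵘ (ι a) ℚᵘ.+ toℚᵘ (ι b)       ≈⟨ toℚᵘ-homo-+ (ι a) (ι b) ⟨
    toℚᵘ (ι a + ι b)                 ∎)
    where open ℚᵘ.≃-Reasoning

-- From a covering path to a bound on its number of sides.

module LowerBound where

  open import Data.Empty using (⊥)
  open import Data.Fin.Base as Fin using (Fin; inject₁; toℕ)
  import Data.Fin.Properties as Fin
  open import Data.Nat.Base as ℕ using (ℕ; suc)
  import Data.Nat.Properties as ℕ
  open import Data.Product.Base using (_×_; _,_; ∃; proj₁; proj₂)
  open import Data.Rational.Base as ℚ using (ℚ; 0ℚ; 1ℚ)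
  import Data.Rational.Properties as ℚ
  open import Data.Sum.Base using (_⊎_; inj₁; inj₂)
  open import Relation.Binary.Definitions using (tri<; tri≈; tri>)
  open import Relation.Binary.PropositionalEquality
  open import Relation.Nullary.Decidable.Core using (Dec; yes; no)
  open import Relation.Nullary.Negation.Core using (¬_; contradiction)
  import Tactic.RingSolver as RingSolver
  open import Defs
  open Reals
  open RationalPlane
  open RealPlane
  open Integral

  -- The factor is rational, so the equation can be multiplied by its exact inverse; `y` may be any
  -- real.
  difference-zero : ∀ {d} y q → d ≢ 0ℚ → fromℚ d * (y - fromℚ q) ≈ 0ℝ → y ≈ fromℚ q
  difference-zero {d} y q d≢0 e =
    ≈-trans {y} {fromℚ r * (fromℚ d * (y - fromℚ q)) + fromℚ q} {fromℚ q}
      (pointwise {y} {fromℚ r * (fromℚ d * (y - fromℚ q)) + fromℚ q} (λ i → solved (seq y i)))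
      (≈-trans {fromℚ r * (fromℚ d * (y - fromℚ q)) + fromℚ q} {fromℚ r * 0ℝ + fromℚ q} {fromℚ q}
        (+-cong {fromℚ r * (fromℚ d * (y - fromℚ q))} {fromℚ r * 0ℝ} {fromℚ q} {fromℚ q}
          (*-cong {fromℚ r} {fromℚ r} {fromℚ d * (y - fromℚ q)} {0ℝ} (≈-refl {fromℚ r}) e) (≈-refl {fromℚ q}))
        (pointwise {fromℚ r * 0ℝ + fromℚ q} {fromℚ q} (λ _ → drop r q)))
    where
    instance
      _ : ℚ.NonZero d
      _ = ℚ.≢-nonZero d≢0
    r : ℚ
    r = ℚ.1/ d
    drop : ∀ r q → r ℚ.* 0ℚ ℚ.+ q ≡ q
    drop = RingSolver.solve-∀ ℚ-ring
    assoc : ∀ r d y q → (r ℚ.* d) ℚ.* (y ℚ.- q) ℚ.+ q ≡ r ℚ.* (d ℚ.* (y ℚ.- q)) ℚ.+ q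
    assoc = RingSolver.solve-∀ ℚ-ring
    unit : ∀ y q → y ≡ 1ℚ ℚ.* (y ℚ.- q) ℚ.+ q
    unit = RingSolver.solve-∀ ℚ-ring
    solved : ∀ y → y ≡ r ℚ.* (d ℚ.* (y ℚ.- q)) ℚ.+ q
    solved y = trans (unit y q)
      (trans (cong (λ z → z ℚ.* (y ℚ.- q) ℚ.+ q) (sym (ℚ.*-inverseˡ d))) (assoc r d y q))

  private
    p-q≡0⇒p≡q : ∀ {p q} → p ℚ.- q ≡ 0ℚ → p ≡ q
    p-q≡0⇒p≡q {p} {q} e = trans (sym (p-q+q≡p p q)) (trans (cong (ℚ._+ q) e) (ℚ.+-identityˡ q))

  -- The counterpart of `horizontal` for a real third point, which will be a vertex of the path.
  horizontalℝ : ∀ {a b q} w → a ≢ b → crossℝ (embed (a , q)) (embed (b , q)) w ≈ 0ℝ → proj₂ w ≈ fromℚ q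
  horizontalℝ {a} {b} {q} (x , y) a≢b e = difference-zero {b ℚ.- a} y q (λ b-a≡0 → a≢b (sym (p-q≡0⇒p≡q b-a≡0)))
    (≈-trans {fromℚ (b ℚ.- a) * (y - fromℚ q)} {crossℝ (embed (a , q)) (embed (b , q)) (x , y)} {0ℝ}
      (pointwise {fromℚ (b ℚ.- a) * (y - fromℚ q)} {crossℝ (embed (a , q)) (embed (b , q)) (x , y)}
        (λ i → eq a b q (seq x i) (seq y i))) e)
    where
    eq : ∀ a b q x y → (b ℚ.- a) ℚ.* (y ℚ.- q) ≡ (b ℚ.- a) ℚ.* (y ℚ.- q) ℚ.- (q ℚ.- q) ℚ.* (x ℚ.- a)
    eq = RingSolver.solve-∀ ℚ-ring

  verticalℝ : ∀ {a b q} w → a ≢ b → crossℝ (embed (q , a)) (embed (q , b)) w ≈ 0ℝ → proj₁ w ≈ fromℚ q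
  verticalℝ {a} {b} {q} (x , y) a≢b e = difference-zero {a ℚ.- b} x q (λ a-b≡0 → a≢b (p-q≡0⇒p≡q a-b≡0))
    (≈-trans {fromℚ (a ℚ.- b) * (x - fromℚ q)} {crossℝ (embed (q , a)) (embed (q , b)) (x , y)} {0ℝ}
      (pointwise {fromℚ (a ℚ.- b) * (x - fromℚ q)} {crossℝ (embed (q , a)) (embed (q , b)) (x , y)}
        (λ i → eq a b q (seq x i) (seq y i))) e)
    where
    eq : ∀ a b q x y → (a ℚ.- b) ℚ.* (x ℚ.- q) ≡ (q ℚ.- q) ℚ.* (y ℚ.- a) ℚ.- (b ℚ.- a) ℚ.* (x ℚ.- q)
    eq = RingSolver.solve-∀ ℚ-ring

  -- The two sides come in no particular order and are not assumed distinct; `no-self-crossing`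
  -- sorts this out.
  record SidesCross {k} (π : PolygonalPath k) : Set where
    constructor sidesCross
    field
      {i j}     : Fin k
      {a b c e} : ℚ²
      a∈ : side π i (embed a)
      b∈ : side π i (embed b)
      c∈ : side π j (embed c)
      e∈ : side π j (embed e)
      isCrossing : Crossing a b c e

  opposite-≢0 : ∀ {p q} → Opposite p q → p ≢ 0ℚ
  opposite-≢0 (inj₁ (p<0 , _)) = ℚ.<⇒≢ p<0
  opposite-≢0 (inj₂ (0<p , _)) p≡0 = ℚ.<⇒≢ 0<p (sym p≡0)

  -- Equal sides are impossible, since the points on one side are collinear and a crossing needs
  -- nonzero determinants. Otherwise the symmetry of `Crossing` permits to put the earlier side
  -- first.
  no-self-crossing : ∀ {k} (π : PolygonalPath k) →
    (∀ {i j a b c e} → i Fin.< j → side π i (embed a) → side π i (embed b) →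
      side π j (embed c) → side π j (embed e) → Crossing a b c e → ⊥) →
    ¬ SidesCross π
  no-self-crossing π ordered (sidesCross {i} {j} {a} {b} {c} {e} a∈ b∈ c∈ e∈ X) with Fin.<-cmp i j
  ... | tri< i<j _ _ = ordered {a = a} {b} {c} {e} i<j a∈ b∈ c∈ e∈ X
  ... | tri≈ _ refl _ = opposite-≢0 (Crossing.ab-separated X)
          (embed-collinear {vertex π (inject₁ i)} {vertex π (Fin.suc i)} {c} {e} {a} c∈ e∈ a∈)
  ... | tri> _ _ j<i = ordered {a = c} {e} {a} {b} j<i c∈ e∈ a∈ b∈ (Crossing-sym X)

  noncrossing⇒¬SidesCross : ∀ {k} (π : PolygonalPath k) → Noncrossing π → ¬ SidesCross π
  noncrossing⇒¬SidesCross π nc = no-self-crossing π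
    (λ {i} {j} {a} {b} {c} {e} → noncrossing-not-crossing π {i} {j} {a} {b} {c} {e} nc)

  -- With at most two sides, distinct sides are consecutive. This is what rescues the bound for
  -- squares with n ≤ 2.
  two-sides⇒¬SidesCross : ∀ {k} (π : PolygonalPath k) → k ℕ.≤ 2 → ¬ SidesCross π
  two-sides⇒¬SidesCross π k≤2 = no-self-crossing π
    (λ {i} {j} {a} {b} {c} {e} i<j → consecutive-not-crossing π {i} {j} {a} {b} {c} {e}
      (ℕ.≤-antisym (ℕ.≤-trans (ℕ.s≤s⁻¹ (ℕ.≤-trans (Fin.toℕ<n j) k≤2)) (ℕ.s≤s ℕ.z≤n)) i<j))

  module _ {n m k} (π : PolygonalPath k) (covers : Covers π (V n m)) where

    coordinate : ∀ {l} → Fin l → ℚ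
    coordinate i = ι (suc (toℕ i))

    coordinate-mono : ∀ {l} {i j : Fin l} → i Fin.< j → coordinate i ℚ.< coordinate j
    coordinate-mono i<j = ι-mono-< (ℕ.s≤s i<j)

    gridPoint : Fin n × Fin m → ℚ²
    gridPoint (i , j) = coordinate i , coordinate j

    abstract
      covered : ∀ p → ∃ λ s → side π s (embed (gridPoint p))
      covered (i , j) = covers {embed (gridPoint (i , j))}
        (suc (toℕ i) , suc (toℕ j) , (ℕ.s≤s ℕ.z≤n , Fin.toℕ<n i) , (ℕ.s≤s ℕ.z≤n , Fin.toℕ<n j)
        , ≈ₚ-refl {embed (gridPoint (i , j))})

    sideOf : Fin n × Fin m → Fin k
    sideOf p = proj₁ (covered p)

    on-side : ∀ {p s} → sideOf p ≡ s → side π s (embed (gridPoint p))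
    on-side {p} refl = proj₂ (covered p)

    sideOf-collinear : ∀ p q r → sideOf p ≡ sideOf q → sideOf p ≡ sideOf r →
      cross (gridPoint p) (gridPoint q) (gridPoint r) ≡ 0ℚ
    sideOf-collinear p q r e e′ =
      embed-collinear {vertex π (inject₁ s)} {vertex π (Fin.suc s)} {gridPoint p} {gridPoint q} {gridPoint r}
        (on-side {p} refl) (on-side {q} (sym e)) (on-side {r} (sym e′))
      where s = sideOf p

    open Grid.Colouring {n} {m} {k} coordinate coordinate coordinate-mono coordinate-mono sideOf sideOf-collinear

    row-height : ∀ {j s} w → RowSide j s → side π s w → proj₂ w ≈ fromℚ (coordinate j)
    row-height {j} {s} w (i , i′ , i≢i′ , e , e′) w∈ =
      horizontalℝ {coordinate i} {coordinate i′} {coordinate j} w (u-inj i≢i′)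
        (Segment-collinear {vertex π (inject₁ s)} {vertex π (Fin.suc s)}
          {embed (gridPoint (i , j))} {embed (gridPoint (i′ , j))} {w} (on-side {i , j} e) (on-side {i′ , j} e′) w∈)

    column-abscissa : ∀ {i s} w → ColumnSide i s → side π s w → proj₁ w ≈ fromℚ (coordinate i)
    column-abscissa {i} {s} w (j , j′ , j≢j′ , e , e′) w∈ =
      verticalℝ {coordinate j} {coordinate j′} {coordinate i} w (v-inj j≢j′)
        (Segment-collinear {vertex π (inject₁ s)} {vertex π (Fin.suc s)}
          {embed (gridPoint (i , j))} {embed (gridPoint (i , j′))} {w} (on-side {i , j} e) (on-side {i , j′} e′) w∈)

    private
      ≈-unique : ∀ {x p q} → x ≈ fromℚ p → x ≈ fromℚ q → p ≡ q
      ≈-unique {x} {p} {q} x≈p x≈q =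
        fromℚ-injective {p} {q} (≈-trans {fromℚ p} {x} {fromℚ q} (≈-sym {x} {fromℚ p} x≈p) x≈q)

    -- The vertex shared by the two sides has the height of both rows.
    consecutive-rows : ∀ {j j′ s s′} → RowSide j s → RowSide j′ s′ → toℕ s′ ≡ suc (toℕ s) → j ≡ j′
    consecutive-rows {j} {j′} {s} {s′} row row′ s′≡1+s with j Fin.≟ j′
    ... | yes j≡j′ = j≡j′
    ... | no j≢j′  = contradiction
          (≈-unique {proj₂ w} {coordinate j} {coordinate j′} (row-height {j} {s} w row (vertex∈previous π {s} {s′} s′≡1+s))
            (row-height {j′} {s′} w row′ (start∈Segment w (vertex π (Fin.suc s′)))))
          (v-inj j≢j′)
      where w = vertex π (inject₁ s′)

    consecutive-columns : ∀ {i i′ s s′} → ColumnSide i s → ColumnSide i′ s′ → toℕ s′ ≡ suc (toℕ s) → i ≡ i′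
    consecutive-columns {i} {i′} {s} {s′} column column′ s′≡1+s with i Fin.≟ i′
    ... | yes i≡i′ = i≡i′
    ... | no i≢i′  = contradiction
          (≈-unique {proj₁ w} {coordinate i} {coordinate i′} (column-abscissa {i} {s} w column (vertex∈previous π {s} {s′} s′≡1+s))
            (column-abscissa {i′} {s′} w column′ (start∈Segment w (vertex π (Fin.suc s′)))))
          (u-inj i≢i′)
      where w = vertex π (inject₁ s′)

    crossingSides : CrossingSides → SidesCross π
    crossingSides (a , b , c , e , ab , ce , X) =
      sidesCross {i = sideOf a} {j = sideOf c} {a = gridPoint a} {gridPoint b} {gridPoint c} {gridPoint e}
        (on-side {a} {sideOf a} refl) (on-side {b} {sideOf a} (sym ab)) (on-side {c} {sideOf c} refl) (on-side {e} {sideOf c} (sym ce)) X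

    -- Each of the first three alternatives gives k ≥ 2 min(n, m) - 1. The last allows one side
    -- less, but only for a path that crosses itself.
    Bound : Set
    Bound = n ℕ.+ n ℕ.≤ suc k ⊎ m ℕ.+ m ℕ.≤ suc k ⊎ n ℕ.+ m ℕ.≤ suc k ⊎
      (n ℕ.+ m ℕ.≤ 2 ℕ.+ k × SidesCross π)

    lower-bound : Bound
    lower-bound = decide (Fin.all? Column?) (Fin.all? Row?)
      where
      free : (∃ λ i → ¬ ∃ (ColumnSide i)) → (∃ λ j → ¬ ∃ (RowSide j)) → Bound
      -- The colour of the free point also supplies the default side.
      free (i , ¬column) (j , ¬row) = conclude (free-point⇒bound (sideOf (i , j)) {i} {j} (¬column , ¬row))
        where
        conclude : n ℕ.+ m ℕ.≤ 1 ℕ.+ k ⊎ (n ℕ.+ m ℕ.≤ 2 ℕ.+ k × CrossingSides) → Bound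
        conclude (inj₁ h) = inj₂ (inj₂ (inj₁ h))
        conclude (inj₂ (h , X)) = inj₂ (inj₂ (inj₂ (h , crossingSides X)))

      decide : Dec (∀ i → ∃ (ColumnSide i)) → Dec (∀ j → ∃ (RowSide j)) → Bound
      decide (yes columns) _ = inj₁ (all-columns columns λ {i} {i′} {s} {s′} → consecutive-columns {i} {i′} {s} {s′})
      decide (no _) (yes rows) = inj₂ (inj₁ (all-rows rows λ {j} {j′} {s} {s′} → consecutive-rows {j} {j′} {s} {s′}))
      decide (no ¬columns) (no ¬rows) = free
        (Fin.¬∀⟶∃¬ n (λ i → ∃ (ColumnSide i)) Column? ¬columns)
        (Fin.¬∀⟶∃¬ m (λ j → ∃ (RowSide j)) Row? ¬rows)

-- Polygonal paths with rational turning points.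

module UpperBound where

  open import Data.Fin.Base as Fin using (Fin; inject₁; toℕ; fromℕ<)
  import Data.Fin.Properties as Fin
  open import Data.Nat.Base as ℕ using (ℕ; zero; suc; z≤n; s≤s)
  import Data.Nat.Properties as ℕ
  open import Data.Product.Base using (_×_; _,_; ∃; swap)
  open import Data.Rational.Base as ℚ using (ℚ; 0ℚ; 1ℚ; ½)
  import Data.Rational.Properties as ℚ
  open import Relation.Binary.PropositionalEquality
  open import Relation.Nullary.Decidable.Core using (yes; no)
  open import Relation.Nullary.Negation.Core using (¬_; contradiction)
  import Tactic.RingSolver as RingSolver
  open import Defs
  open Reals
  open RationalPlane
  open RealPlane
  open Integral

  OnSegment : ℚ² → ℚ² → ℚ² → Set
  OnSegment p q r = ∃ λ t → 0ℚ ℚ.≤ t × t ℚ.≤ 1ℚ × r ≡ mix t p q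

  OnSegment⇒Segment : ∀ p q r {r′} → OnSegment p q r → r′ ≈ₚ embed r → Segment (embed p) (embed q) r′
  OnSegment⇒Segment p q r {r′} (t , 0≤t , t≤1 , refl) r′≈r =
    fromℚ t , fromℚ-nonNegative {t} 0≤t
    , nonNegative⇒≤ {fromℚ t} {1ℝ} (fromℚ-nonNegative {1ℚ ℚ.- t} (p≤q⇒0≤q-p t≤1))
    , r′≈r

  OnSegment-sym : ∀ {p q r} → OnSegment p q r → OnSegment q p r
  OnSegment-sym {px , py} {qx , qy} (t , 0≤t , t≤1 , refl) =
    1ℚ ℚ.- t , p≤q⇒0≤q-p t≤1 , 0≤q-p⇒p≤q (subst (0ℚ ℚ.≤_) (eq₁ t) 0≤t) , cong₂ _,_ (eq₂ t px qx) (eq₂ t py qy)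
    where
    eq₁ : ∀ t → t ≡ 1ℚ ℚ.- (1ℚ ℚ.- t)
    eq₁ = RingSolver.solve-∀ ℚ-ring
    eq₂ : ∀ t p q → (1ℚ ℚ.- t) ℚ.* p ℚ.+ t ℚ.* q ≡ (1ℚ ℚ.- (1ℚ ℚ.- t)) ℚ.* q ℚ.+ (1ℚ ℚ.- t) ℚ.* p
    eq₂ = RingSolver.solve-∀ ℚ-ring

  OnSegment-transpose : ∀ {p q r} → OnSegment p q r → OnSegment (transpose p) (transpose q) (transpose r)
  OnSegment-transpose (t , 0≤t , t≤1 , refl) = t , 0≤t , t≤1 , refl

  horizontal-OnSegment : ∀ {a b x} y → a ℚ.< b → a ℚ.≤ x → x ℚ.≤ b → OnSegment (a , y) (b , y) (x , y)
  horizontal-OnSegment {a} {b} {x} y a<b a≤x x≤b = weigh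
    (fraction {x ℚ.- a} {b ℚ.- x} (p≤q⇒0≤q-p a≤x) (p≤q⇒0≤q-p x≤b) (subst (0ℚ ℚ.<_) (eq₁ a b x) (p<q⇒0<q-p a<b)))
    where
    eq₁ : ∀ a b x → b ℚ.- a ≡ (x ℚ.- a) ℚ.+ (b ℚ.- x)
    eq₁ = RingSolver.solve-∀ ℚ-ring
    eq₂ : ∀ t a b x → t ℚ.* ((x ℚ.- a) ℚ.+ (b ℚ.- x)) ℚ.+ a ≡ (1ℚ ℚ.- t) ℚ.* a ℚ.+ t ℚ.* b
    eq₂ = RingSolver.solve-∀ ℚ-ring
    eq₃ : ∀ t y → y ≡ (1ℚ ℚ.- t) ℚ.* y ℚ.+ t ℚ.* y
    eq₃ = RingSolver.solve-∀ ℚ-ring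
    weigh : (∃ λ t → 0ℚ ℚ.≤ t × t ℚ.≤ 1ℚ × t ℚ.* ((x ℚ.- a) ℚ.+ (b ℚ.- x)) ≡ x ℚ.- a) →
      OnSegment (a , y) (b , y) (x , y)
    weigh (t , 0≤t , t≤1 , e) = t , 0≤t , t≤1 , cong₂ _,_
      (trans (sym (p-q+q≡p x a)) (trans (cong (ℚ._+ a) (sym e)) (eq₂ t a b x))) (eq₃ t y)

  squaredLength-positive : ∀ p q → p ≢ q → 0ℝ < squaredLength (embed p) (embed q)
  squaredLength-positive (px , py) (qx , qy) p≢q =
    -- The order `_<_` asks for a positive gap; half the squared length is one.
    s ℚ.* ½ , half-pos 0<s , always λ _ → subst₂ ℚ._<_ (sym (ℚ.+-identityˡ (s ℚ.* ½))) (half+half s)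
      (subst (ℚ._< s ℚ.* ½ ℚ.+ s ℚ.* ½) (ℚ.+-identityʳ (s ℚ.* ½)) (ℚ.+-monoʳ-< (s ℚ.* ½) (half-pos 0<s)))
    where
    s : ℚ
    s = (qx ℚ.- px) ℚ.* (qx ℚ.- px) ℚ.+ (qy ℚ.- py) ℚ.* (qy ℚ.- py)
    difference : ∀ a b → 0ℚ ≡ b ℚ.- a → a ≡ b
    difference a b e = trans (trans (sym (ℚ.+-identityˡ a)) (cong (ℚ._+ a) e)) (p-q+q≡p b a)
    square-zero : ∀ a → ¬ 0ℚ ℚ.< a ℚ.* a → 0ℚ ≡ a
    square-zero a ¬0<a² with 0ℚ ℚ.≟ a
    ... | yes e = e
    ... | no 0≢a = contradiction (*-cancelˡ-≡ {a} {0ℚ} {a} (λ e → 0≢a (sym e))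
            (trans (ℚ.*-zeroʳ a) (ℚ.≤-antisym (0≤p² a) (ℚ.≮⇒≥ ¬0<a²)))) 0≢a
    0<s : 0ℚ ℚ.< s
    0<s with 0ℚ ℚ.<? (qx ℚ.- px) ℚ.* (qx ℚ.- px) | 0ℚ ℚ.<? (qy ℚ.- py) ℚ.* (qy ℚ.- py)
    ... | yes 0<x² | _ = ℚ.+-mono-<-≤ {0ℚ} {(qx ℚ.- px) ℚ.* (qx ℚ.- px)} {0ℚ} {(qy ℚ.- py) ℚ.* (qy ℚ.- py)}
            0<x² (0≤p² (qy ℚ.- py))
    ... | no _ | yes 0<y² = ℚ.+-mono-≤-< {0ℚ} {(qx ℚ.- px) ℚ.* (qx ℚ.- px)} {0ℚ} {(qy ℚ.- py) ℚ.* (qy ℚ.- py)}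
            (0≤p² (qx ℚ.- px)) 0<y²
    ... | no x²≤0 | no y²≤0 = contradiction
            (cong₂ _,_ (difference px qx (square-zero _ x²≤0)) (difference py qy (square-zero _ y²≤0))) p≢q

  -- The constructions define an infinite sequence of turning points by recursion on its index; a
  -- path takes the first k + 1 of them. The passage to `Fin` happens only here.
  module _ (k : ℕ) (1≤k : 1 ℕ.≤ k) (p : ℕ → ℚ²) (p≢ : ∀ i → i ℕ.< k → p i ≢ p (suc i)) where

    path : PolygonalPath k
    path = record
      { nonempty       = 1≤k
      ; vertex         = λ i → embed (p (toℕ i))
      ; positiveLength = λ i → squaredLength-positive (p (toℕ (inject₁ i))) (p (suc (toℕ i)))
          (subst (λ j → p j ≢ p (suc (toℕ i))) (sym (Fin.toℕ-inject₁ i)) (p≢ (toℕ i) (Fin.toℕ<n i)))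
      }

    path-covers : ∀ n m →
      (∀ a b → 1 ℕ.≤ a → a ℕ.≤ n → 1 ℕ.≤ b → b ℕ.≤ m →
        ∃ λ i → i ℕ.< k × OnSegment (p i) (p (suc i)) (ι a , ι b)) →
      Covers path (V n m)
    path-covers n m h {r} (a , b , (1≤a , a≤n) , (1≤b , b≤m) , r≈) = locate (h a b 1≤a a≤n 1≤b b≤m)
      where
      locate : (∃ λ i → i ℕ.< k × OnSegment (p i) (p (suc i)) (ι a , ι b)) → ∃ λ i → side path i r
      locate (i , i<k , on) = fromℕ< i<k , OnSegment⇒Segment _ _ (ι a , ι b) {r}
        (subst₂ (λ i′ i″ → OnSegment (p i′) (p (suc i″)) (ι a , ι b))
          (sym (trans (Fin.toℕ-inject₁ (fromℕ< i<k)) (Fin.toℕ-fromℕ< i<k))) (sym (Fin.toℕ-fromℕ< i<k)) on) r≈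

    path-noncrossing :
      (∀ i j r → i ℕ.< j → Segment (embed (p i)) (embed (p (suc i))) r → Segment (embed (p j)) (embed (p (suc j))) r →
        j ≡ suc i × r ≈ₚ embed (p j)) →
      Noncrossing path
    path-noncrossing h i j i<j r r∈i r∈j =
      subst (λ z → toℕ j ≡ suc (toℕ i) × r ≈ₚ embed (p z)) (sym (Fin.toℕ-inject₁ j))
        (h (toℕ i) (toℕ j) r i<j (align i r∈i) (align j r∈j))
      where
      align : ∀ i → side path i r → Segment (embed (p (toℕ i))) (embed (p (suc (toℕ i)))) r
      align i = subst (λ z → Segment (embed (p z)) (embed (p (suc (toℕ i)))) r) (Fin.toℕ-inject₁ i)

  Segment-swap : ∀ {p q r} → Segment p q r → Segment (swap p) (swap q) (swap r)
  Segment-swap (t , 0≤t , t≤1 , x≈ , y≈) = t , 0≤t , t≤1 , y≈ , x≈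

  transposePath : ∀ {k} → PolygonalPath k → PolygonalPath k
  transposePath π = record
    { nonempty       = nonempty π
    ; vertex         = λ i → swap (vertex π i)
    ; positiveLength = λ i → flip (vertex π (inject₁ i)) (vertex π (Fin.suc i)) (positiveLength π i)
    }
    where
    flip : ∀ p q → 0ℝ < squaredLength p q → 0ℝ < squaredLength (swap p) (swap q)
    flip (px , py) (qx , qy) (ε , 0<ε , h) = ε , 0<ε , eventually-map
      (λ {i} → subst (0ℚ ℚ.+ ε ℚ.<_) (ℚ.+-comm (seq ((qx - px) * (qx - px)) i) (seq ((qy - py) * (qy - py)) i))) h

  transpose-covers : ∀ {n m k} (π : PolygonalPath k) → Covers π (V n m) → Covers (transposePath π) (V m n)
  transpose-covers π covers {r} (a , b , a-range , b-range , x≈ , y≈)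
    = let i , r∈ = covers {swap r} (b , a , b-range , a-range , y≈ , x≈)
      in i , Segment-swap {vertex π (inject₁ i)} {vertex π (Fin.suc i)} {swap r} r∈

  transpose-noncrossing : ∀ {k} (π : PolygonalPath k) → Noncrossing π → Noncrossing (transposePath π)
  transpose-noncrossing π nc i j i<j r r∈i r∈j =
    let e , x≈ , y≈ = nc i j i<j (swap r)
          (Segment-swap {swap (vertex π (inject₁ i))} {swap (vertex π (Fin.suc i))} {r} r∈i)
          (Segment-swap {swap (vertex π (inject₁ j))} {swap (vertex π (Fin.suc j))} {r} r∈j)
    in e , y≈ , x≈

  -- Computes to two successors per step, one for each of the two sides that a new row of the snake
  -- or a new layer of the spiral costs.
  double : ℕ → ℕ
  double zero    = zero
  double (suc n) = suc (suc (double n))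

  double-mono : ∀ {a b} → a ℕ.≤ b → double a ℕ.≤ double b
  double-mono z≤n       = z≤n
  double-mono (s≤s a≤b) = s≤s (s≤s (double-mono a≤b))

-- The boustrophedon path.

module Snake where

  open import Data.Empty using (⊥; ⊥-elim)
  open import Data.Nat.Base as ℕ using (ℕ; zero; suc; z≤n; s≤s)
  import Data.Nat.Properties as ℕ
  open import Data.Product.Base using (_×_; _,_; ∃; proj₁; proj₂)
  open import Data.Rational.Base as ℚ using (ℚ; 1ℚ)
  import Data.Rational.Properties as ℚ
  open import Data.Sum.Base using (_⊎_; inj₁; inj₂)
  open import Relation.Binary.PropositionalEquality
  open import Relation.Nullary.Negation.Core using (contradiction)
  import Tactic.RingSolver as RingSolver
  open import Defs
  open Reals
  open RationalPlane
  open RealPlane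
  open Integral
  open UpperBound

  constant-x : ∀ {a a′ b b′ r} → a ≡ a′ → Segment (embed (a , b)) (embed (a′ , b′)) r → proj₁ r ≈ fromℚ a
  constant-x {a} {r = x , y} refl (t , _ , _ , x≈ , _) =
    ≈-trans {x} {lerpℝ t (fromℚ a) (fromℚ a)} {fromℚ a} x≈
      (pointwise {lerpℝ t (fromℚ a) (fromℚ a)} {fromℚ a} (λ i → eq (seq t i) a))
    where
    eq : ∀ t a → (1ℚ ℚ.- t) ℚ.* a ℚ.+ t ℚ.* a ≡ a
    eq = RingSolver.solve-∀ ℚ-ring

  -- The difference c - y is the convex combination of c - b and c - b′ with the parameter of the
  -- point.
  upper-y : ∀ {a a′ b b′ r} c → b ℚ.≤ c → b′ ℚ.≤ c →
    Segment (embed (a , b)) (embed (a′ , b′)) r → NonNegative (fromℚ c - proj₂ r)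
  upper-y {b = b} {b′} {x , y} c b≤c b′≤c (t , 0≤t , t≤1 , _ , y≈) =
    nonNegative-resp-≈ {lerpℝ t (fromℚ (c ℚ.- b)) (fromℚ (c ℚ.- b′))} {fromℚ c - y}
      (≈-trans {lerpℝ t (fromℚ (c ℚ.- b)) (fromℚ (c ℚ.- b′))} {fromℚ c - lerpℝ t (fromℚ b) (fromℚ b′)} {fromℚ c - y}
        (pointwise {lerpℝ t (fromℚ (c ℚ.- b)) (fromℚ (c ℚ.- b′))} {fromℚ c - lerpℝ t (fromℚ b) (fromℚ b′)}
          (λ i → eq (seq t i) b b′ c))
        (minus-cong {fromℚ c} {fromℚ c} {lerpℝ t (fromℚ b) (fromℚ b′)} {y} (≈-refl {fromℚ c})
          (≈-sym {y} {lerpℝ t (fromℚ b) (fromℚ b′)} y≈)))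
      (+-nonNegative {(1ℝ - t) * fromℚ (c ℚ.- b)} {t * fromℚ (c ℚ.- b′)}
        (*-nonNegative {1ℝ - t} {fromℚ (c ℚ.- b)} (≤⇒nonNegative {t} {1ℝ} t≤1)
          (fromℚ-nonNegative {c ℚ.- b} (p≤q⇒0≤q-p b≤c)))
        (*-nonNegative {t} {fromℚ (c ℚ.- b′)} 0≤t (fromℚ-nonNegative {c ℚ.- b′} (p≤q⇒0≤q-p b′≤c))))
    where
    eq : ∀ t b b′ c → (1ℚ ℚ.- t) ℚ.* (c ℚ.- b) ℚ.+ t ℚ.* (c ℚ.- b′) ≡ c ℚ.- ((1ℚ ℚ.- t) ℚ.* b ℚ.+ t ℚ.* b′)
    eq = RingSolver.solve-∀ ℚ-ring

  lower-y : ∀ {a a′ b b′ r} c → c ℚ.≤ b → c ℚ.≤ b′ →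
    Segment (embed (a , b)) (embed (a′ , b′)) r → NonNegative (proj₂ r - fromℚ c)
  lower-y {b = b} {b′} {x , y} c c≤b c≤b′ (t , 0≤t , t≤1 , _ , y≈) =
    nonNegative-resp-≈ {lerpℝ t (fromℚ (b ℚ.- c)) (fromℚ (b′ ℚ.- c))} {y - fromℚ c}
      (≈-trans {lerpℝ t (fromℚ (b ℚ.- c)) (fromℚ (b′ ℚ.- c))} {lerpℝ t (fromℚ b) (fromℚ b′) - fromℚ c} {y - fromℚ c}
        (pointwise {lerpℝ t (fromℚ (b ℚ.- c)) (fromℚ (b′ ℚ.- c))} {lerpℝ t (fromℚ b) (fromℚ b′) - fromℚ c}
          (λ i → eq (seq t i) b b′ c))
        (minus-cong {lerpℝ t (fromℚ b) (fromℚ b′)} {y} {fromℚ c} {fromℚ c}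
          (≈-sym {y} {lerpℝ t (fromℚ b) (fromℚ b′)} y≈) (≈-refl {fromℚ c})))
      (+-nonNegative {(1ℝ - t) * fromℚ (b ℚ.- c)} {t * fromℚ (b′ ℚ.- c)}
        (*-nonNegative {1ℝ - t} {fromℚ (b ℚ.- c)} (≤⇒nonNegative {t} {1ℝ} t≤1)
          (fromℚ-nonNegative {b ℚ.- c} (p≤q⇒0≤q-p c≤b)))
        (*-nonNegative {t} {fromℚ (b′ ℚ.- c)} 0≤t (fromℚ-nonNegative {b′ ℚ.- c} (p≤q⇒0≤q-p c≤b′))))
    where
    eq : ∀ t b b′ c → (1ℚ ℚ.- t) ℚ.* (b ℚ.- c) ℚ.+ t ℚ.* (b′ ℚ.- c) ≡ ((1ℚ ℚ.- t) ℚ.* b ℚ.+ t ℚ.* b′) ℚ.- c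
    eq = RingSolver.solve-∀ ℚ-ring

  -- The sum of the two inequalities eliminates the real `y` and leaves d ≤ c between rationals.
  disjoint-ranges : ∀ {c d} y → c ℚ.< d → NonNegative (fromℚ c - y) → NonNegative (y - fromℚ d) → ⊥
  disjoint-ranges {c} {d} y c<d y≤c d≤y = ℚ.<-irrefl refl (ℚ.<-≤-trans c<d (0≤q-p⇒p≤q
    (fromℚ-nonNegative⁻¹ {c ℚ.- d}
      (nonNegative-resp-≈ {(fromℚ c - y) + (y - fromℚ d)} {fromℚ (c ℚ.- d)}
        (pointwise {(fromℚ c - y) + (y - fromℚ d)} {fromℚ (c ℚ.- d)} (λ i → eq c (seq y i) d))
        (+-nonNegative {fromℚ c - y} {y - fromℚ d} y≤c d≤y)))))
    where
    eq : ∀ c y d → (c ℚ.- y) ℚ.+ (y ℚ.- d) ≡ c ℚ.- d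
    eq = RingSolver.solve-∀ ℚ-ring

  squeezed : ∀ {c} y → NonNegative (fromℚ c - y) → NonNegative (y - fromℚ c) → y ≈ fromℚ c
  squeezed {c} y y≤c c≤y =
    ≈-trans {y} {(y - fromℚ c) + fromℚ c} {fromℚ c}
      (pointwise {y} {(y - fromℚ c) + fromℚ c} (λ i → sym (p-q+q≡p (seq y i) c)))
      (≈-trans {(y - fromℚ c) + fromℚ c} {0ℝ + fromℚ c} {fromℚ c}
        (+-cong {y - fromℚ c} {0ℝ} {fromℚ c} {fromℚ c}
          (nonNegative-antisym {y - fromℚ c} c≤y
            (nonNegative-resp-≈ {fromℚ c - y} { - (y - fromℚ c)}
              (pointwise {fromℚ c - y} { - (y - fromℚ c)} (λ i → eq c (seq y i))) y≤c))
          (≈-refl {fromℚ c}))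
        (pointwise {0ℝ + fromℚ c} {fromℚ c} (λ _ → ℚ.+-identityˡ c)))
    where
    eq : ∀ c y → c ℚ.- y ≡ ℚ.- (y ℚ.- c)
    eq = RingSolver.solve-∀ ℚ-ring

  -- The i-th turning point of the boustrophedon path has abscissa
  -- l, r, r, l, l, r, r, … and height 1, 1, 2, 2, 3, 3, …
  abscissa : ℚ → ℚ → ℕ → ℚ
  abscissa l r zero          = l
  abscissa l r (suc zero)    = r
  abscissa l r (suc (suc i)) = abscissa r l i

  height : ℕ → ℕ
  height zero          = 1
  height (suc zero)    = 1
  height (suc (suc i)) = suc (height i)

  height-step : ∀ i → height i ℕ.≤ height (suc i)
  height-step zero          = ℕ.≤-refl
  height-step (suc zero)    = s≤s z≤n
  height-step (suc (suc i)) = s≤s (height-step i)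

  height-mono : ∀ {i j} → i ℕ.≤ j → height i ℕ.≤ height j
  height-mono {i} i≤j = go (ℕ.≤⇒≤′ i≤j)
    where
    go : ∀ {j} → i ℕ.≤′ j → height i ℕ.≤ height j
    go (ℕ.≤′-reflexive refl) = ℕ.≤-refl
    go (ℕ.≤′-step {j} h)     = ℕ.≤-trans (go h) (height-step j)

  abscissa-flip : ∀ {l r} → l ≢ r → ∀ i → abscissa r l i ≢ abscissa l r i
  abscissa-flip l≢r zero          e = l≢r (sym e)
  abscissa-flip l≢r (suc zero)    e = l≢r e
  abscissa-flip l≢r (suc (suc i)) e = abscissa-flip l≢r i (sym e)

  -- `Vertical` quantifies over both abscissas because the recursion of `abscissa` exchanges them.
  Horizontal Vertical : ℕ → Set
  Horizontal i = height (suc i) ≡ height i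
  Vertical i   = ∀ l r → abscissa l r (suc i) ≡ abscissa l r i

  alternating : ∀ i → (Horizontal i × Vertical (suc i)) ⊎ (Vertical i × Horizontal (suc i))
  alternating zero          = inj₁ (refl , λ _ _ → refl)
  alternating (suc zero)    = inj₂ ((λ _ _ → refl) , refl)
  alternating (suc (suc i)) with alternating i
  ... | inj₁ (h , v) = inj₁ (cong suc h , λ l r → v r l)
  ... | inj₂ (v , h) = inj₂ ((λ l r → v r l) , cong suc h)

  module _ (l r : ℚ) (l<r : l ℚ.< r) where

    turn : ℕ → ℚ²
    turn i = abscissa l r i , ι (height i)

    private
      l≢r : l ≢ r
      l≢r = ℚ.<⇒≢ l<r

    turn-≢ : ∀ i → turn i ≢ turn (suc i)
    turn-≢ i e with alternating i
    ... | inj₁ (_ , v) = abscissa-flip l≢r i (trans (v l r) (sym (cong proj₁ e)))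
    ... | inj₂ (_ , h) = ℚ.<⇒≢ (ι-mono-< {height i} {height (suc i)} (ℕ.≤-reflexive h)) (cong proj₂ e)

    private
      Side : ℕ → Point → Set
      Side i = Segment (embed (turn i)) (embed (turn (suc i)))

      below : ∀ i w → Side i w → NonNegative (fromℚ (ι (height (suc i))) - proj₂ w)
      below i w w∈ = upper-y {abscissa l r i} {abscissa l r (suc i)} {ι (height i)} {ι (height (suc i))} {w}
        (ι (height (suc i))) (ι-mono-≤ {height i} {height (suc i)} (height-step i)) ℚ.≤-refl w∈

      above : ∀ i w → Side i w → NonNegative (proj₂ w - fromℚ (ι (height i)))
      above i w w∈ = lower-y {abscissa l r i} {abscissa l r (suc i)} {ι (height i)} {ι (height (suc i))} {w}
        (ι (height i)) ℚ.≤-refl (ι-mono-≤ {height i} {height (suc i)} (height-step i)) w∈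

      separated : ∀ i j w → height (suc i) ℕ.< height j → Side i w → Side j w → ⊥
      separated i j w h w∈i w∈j = disjoint-ranges {ι (height (suc i))} {ι (height j)} (proj₂ w)
        (ι-mono-< {height (suc i)} {height j} h) (below i w w∈i) (above j w w∈j)

      on-vertical : ∀ i w → Vertical i → Side i w → proj₁ w ≈ fromℚ (abscissa l r i)
      on-vertical i w v w∈ =
        constant-x {abscissa l r i} {abscissa l r (suc i)} {ι (height i)} {ι (height (suc i))} {w} (sym (v l r)) w∈

    -- For consecutive sides the height of `w` is squeezed between equal bounds, and the vertical
    -- one of them fixes the abscissa. Other pairs are separated by height, except for a vertical
    -- side i and j = i + 2: these two touch the same height from below and from above, but at
    -- opposite ends of the row.
    turn-noncrossing : ∀ i j w → i ℕ.< j → Side i w → Side j w → j ≡ suc i × w ≈ₚ embed (turn j)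
    turn-noncrossing i j w i<j w∈i w∈j with ℕ.m≤n⇒m<n∨m≡n i<j | alternating i
    ... | inj₂ refl | alternation = refl , abscissa-meet alternation ,
          squeezed {ι (height (suc i))} (proj₂ w) (below i w w∈i) (above (suc i) w w∈j)
      where
      abscissa-meet : (Horizontal i × Vertical (suc i)) ⊎ (Vertical i × Horizontal (suc i)) →
        proj₁ w ≈ fromℚ (abscissa l r (suc i))
      abscissa-meet (inj₁ (_ , v)) = on-vertical (suc i) w v w∈j
      abscissa-meet (inj₂ (v , _)) = subst (λ x → proj₁ w ≈ fromℚ x) (sym (v l r)) (on-vertical i w v w∈i)
    ... | inj₁ 2+i≤j | inj₁ (h , _) = ⊥-elim (separated i j w
          (ℕ.≤-trans (ℕ.≤-reflexive (cong suc h)) (height-mono 2+i≤j)) w∈i w∈j)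
    ... | inj₁ 2+i≤j | inj₂ (v , _) with ℕ.m≤n⇒m<n∨m≡n 2+i≤j
    ...   | inj₁ 3+i≤j = ⊥-elim (separated i j w (height-mono 3+i≤j) w∈i w∈j)
    ...   | inj₂ refl = contradiction
            (fromℚ-injective {abscissa r l i} {abscissa l r i}
              (≈-trans {fromℚ (abscissa r l i)} {proj₁ w} {fromℚ (abscissa l r i)}
                (≈-sym {proj₁ w} {fromℚ (abscissa r l i)} (on-vertical (suc (suc i)) w (λ l r → v r l) w∈j))
                (on-vertical i w v w∈i)))
            (abscissa-flip l≢r i)

  height-double : ∀ b → height (double b) ≡ suc b × height (suc (double b)) ≡ suc b
  height-double zero    = refl , refl
  height-double (suc b) = let e , e′ = height-double b in cong suc e , cong suc e′

  abscissa-double : ∀ b l r → (abscissa l r (double b) ≡ l × abscissa l r (suc (double b)) ≡ r) ⊎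
                              (abscissa l r (double b) ≡ r × abscissa l r (suc (double b)) ≡ l)
  abscissa-double zero    l r = inj₁ (refl , refl)
  abscissa-double (suc b) l r with abscissa-double b r l
  ... | inj₁ e = inj₂ e
  ... | inj₂ e = inj₁ e

  snake : ∀ n m → 1 ℕ.≤ n → NoncrossingCoverableWith n (suc m) (suc (double m))
  snake n m 1≤n =
    path k (s≤s z≤n) p p≢ ,
    path-noncrossing k (s≤s z≤n) p p≢ (turn-noncrossing (ι 0) (ι n) 0<n) ,
    (λ {x} → path-covers k (s≤s z≤n) p p≢ n (suc m) covers {x})
    where
    k : ℕ
    k = suc (double m)
    -- The rows start at abscissa 0, one step left of the grid, so that they have positive length
    -- even for n = 1.
    0<n : ι 0 ℚ.< ι n
    0<n = ι-mono-< {0} {n} 1≤n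
    p : ℕ → ℚ²
    p = turn (ι 0) (ι n) 0<n
    p≢ : ∀ i → i ℕ.< k → p i ≢ p (suc i)
    p≢ i _ = turn-≢ (ι 0) (ι n) 0<n i

    covers : ∀ a b → 1 ℕ.≤ a → a ℕ.≤ n → 1 ℕ.≤ b → b ℕ.≤ suc m →
      ∃ λ i → i ℕ.< k × OnSegment (p i) (p (suc i)) (ι a , ι b)
    -- The sides with even index are the horizontal ones; row `suc b` is traversed in the direction
    -- that the parity of `b` dictates.
    covers a (suc b) _ a≤n _ (s≤s b≤m) = double b , s≤s (double-mono b≤m) , on (abscissa-double b (ι 0) (ι n))
      where
      row : OnSegment (ι 0 , ι (suc b)) (ι n , ι (suc b)) (ι a , ι (suc b))
      row = horizontal-OnSegment {ι 0} {ι n} {ι a} (ι (suc b)) 0<n (ι-mono-≤ {0} {a} z≤n) (ι-mono-≤ {a} {n} a≤n)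
      OnRow : ℚ → ℚ → ℕ → ℕ → Set
      OnRow x x′ y y′ = OnSegment (x , ι y) (x′ , ι y′) (ι a , ι (suc b))
      place : ∀ {x x′ y y′} → OnRow x x′ (suc b) (suc b) → y ≡ suc b → y′ ≡ suc b → OnRow x x′ y y′
      place h refl refl = h
      on : (abscissa (ι 0) (ι n) (double b) ≡ ι 0 × abscissa (ι 0) (ι n) (suc (double b)) ≡ ι n) ⊎
           (abscissa (ι 0) (ι n) (double b) ≡ ι n × abscissa (ι 0) (ι n) (suc (double b)) ≡ ι 0) →
           OnSegment (p (double b)) (p (suc (double b))) (ι a , ι (suc b))
      on (inj₁ (e , e′)) = place (subst₂ (λ x x′ → OnRow x x′ (suc b) (suc b)) (sym e) (sym e′) row)
        (proj₁ (height-double b)) (proj₂ (height-double b))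
      on (inj₂ (e , e′)) = place (subst₂ (λ x x′ → OnRow x x′ (suc b) (suc b)) (sym e) (sym e′)
          (OnSegment-sym {ι 0 , ι (suc b)} {ι n , ι (suc b)} {ι a , ι (suc b)} row))
        (proj₁ (height-double b)) (proj₂ (height-double b))

-- Spirals around the nine dots, for square grids.

module Spiral where

  open import Data.Nat.Base as ℕ using (ℕ; zero; suc; z≤n; s≤s)
  import Data.Nat.Properties as ℕ
  open import Data.Product.Base using (_×_; _,_; ∃; proj₁; proj₂)
  open import Data.Rational.Base as ℚ using (ℚ; 0ℚ; 1ℚ)
  import Data.Rational.Properties as ℚ
  open import Data.Sum.Base using (inj₁; inj₂)
  open import Data.Integer.Base using (+_)
  open import Relation.Binary.PropositionalEquality
  open import Relation.Nullary.Decidable.Core using (True; toWitness)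
  import Tactic.RingSolver as RingSolver
  open import Defs using (CoverableWith)
  open Reals using (ℚ-ring)
  open RationalPlane
  open Integral
  open UpperBound

  -- The first side may start beyond the right end of the row above the
  -- grid, which the next layer covers.
  record Spiral (n k : ℕ) : Set where
    field
      turn     : ℕ → ℚ²
      start    : ℚ
      turn₀    : turn 0 ≡ (start , ι (suc n))
      n≤start  : ι n ℚ.≤ start
      turn-≢   : ∀ i → i ℕ.< k → turn i ≢ turn (suc i)
      covers   : ∀ a b → 1 ℕ.≤ a → a ℕ.≤ n → 1 ℕ.≤ b → b ℕ.≤ n →
                 ∃ λ i → i ℕ.< k × OnSegment (turn i) (turn (suc i)) (ι a , ι b)

  ι-∸ : ∀ {a b} → b ℕ.≤ a → ι a ℚ.- ι b ≡ ι (a ℕ.∸ b)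
  ι-∸ {a} {b} b≤a = begin
    ι a ℚ.- ι b                             ≡⟨ cong (λ c → ι c ℚ.- ι b) (ℕ.m∸n+n≡m b≤a) ⟨
    ι (a ℕ.∸ b ℕ.+ b) ℚ.- ι b               ≡⟨ cong (ℚ._- ι b) (ι-+ (a ℕ.∸ b) b) ⟩
    ι (a ℕ.∸ b) ℚ.+ ι b ℚ.- ι b             ≡⟨ eq (ι (a ℕ.∸ b)) (ι b) ⟩
    ι (a ℕ.∸ b)                             ∎
    where
    open ≡-Reasoning
    eq : ∀ x y → x ℚ.+ y ℚ.- y ≡ x
    eq = RingSolver.solve-∀ ℚ-ring

  module _ {n k} (s : Spiral (suc n) k) where
    open Spiral s

    private
      N = suc n

      -- The path starts at height 0, one below the new column. After the half turn this end lies
      -- one row above the enlarged grid, where `turn₀` wants it.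
      outer : ℕ → ℚ²
      outer zero          = ι 0 , ι 0
      outer (suc zero)    = ι 0 , ι (suc N)
      outer (suc (suc i)) = turn i

      -- Abscissas 0, ..., N go to N + 1, ..., 1, and heights 1, ..., N + 1 are reversed, so the
      -- extended grid lands on the standard square of size N + 1.
      half-turn : ℚ² → ℚ²
      half-turn (x , y) = ι (suc N) ℚ.- x , ι (suc (suc N)) ℚ.- y

      half-turn-involutive : ∀ p → half-turn (half-turn p) ≡ p
      half-turn-involutive (x , y) = cong₂ _,_ (eq (ι (suc N)) x) (eq (ι (suc (suc N))) y)
        where
        eq : ∀ c x → c ℚ.- (c ℚ.- x) ≡ x
        eq = RingSolver.solve-∀ ℚ-ring

      half-turn-injective : ∀ {p q} → half-turn p ≡ half-turn q → p ≡ q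
      half-turn-injective {p} {q} e =
        trans (sym (half-turn-involutive p)) (trans (cong half-turn e) (half-turn-involutive q))

      half-turn-OnSegment : ∀ {p q r} → OnSegment p q r → OnSegment (half-turn p) (half-turn q) (half-turn r)
      half-turn-OnSegment {px , py} {qx , qy} (t , 0≤t , t≤1 , refl) =
        t , 0≤t , t≤1 , cong₂ _,_ (eq (ι (suc N)) t px qx) (eq (ι (suc (suc N))) t py qy)
        where
        eq : ∀ c t p q → c ℚ.- ((1ℚ ℚ.- t) ℚ.* p ℚ.+ t ℚ.* q) ≡ (1ℚ ℚ.- t) ℚ.* (c ℚ.- p) ℚ.+ t ℚ.* (c ℚ.- q)
        eq = RingSolver.solve-∀ ℚ-ring

      0<start : ι 0 ℚ.< start
      0<start = ℚ.<-≤-trans (ι-mono-< {0} {N} (s≤s z≤n)) n≤start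

      outer-≢ : ∀ i → i ℕ.< suc (suc k) → outer i ≢ outer (suc i)
      outer-≢ zero          _ e = ℚ.<⇒≢ (ι-mono-< {0} {suc N} (s≤s z≤n)) (cong proj₂ e)
      outer-≢ (suc zero)    _ e = ℚ.<⇒≢ 0<start (cong proj₁ (trans e turn₀))
      outer-≢ (suc (suc i)) (s≤s (s≤s i<k)) e = turn-≢ i i<k e

      outer-covers : ∀ a b → a ℕ.≤ N → 1 ℕ.≤ b → b ℕ.≤ suc N →
        ∃ λ i → i ℕ.< suc (suc k) × OnSegment (outer i) (outer (suc i)) (ι a , ι b)
      outer-covers zero b _ _ b≤1+N = 0 , s≤s z≤n ,
        OnSegment-transpose (horizontal-OnSegment {ι 0} {ι (suc N)} {ι b} (ι 0)
          (ι-mono-< {0} {suc N} (s≤s z≤n)) (ι-mono-≤ {0} {b} z≤n) (ι-mono-≤ {b} {suc N} b≤1+N))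
      outer-covers (suc a) b a≤N 1≤b b≤1+N with ℕ.m≤n⇒m<n∨m≡n b≤1+N
      ... | inj₂ refl = 1 , s≤s (s≤s z≤n) ,
            subst (λ q → OnSegment (outer 1) q (ι (suc a) , ι (suc N))) (sym turn₀)
              (horizontal-OnSegment {ι 0} {start} {ι (suc a)} (ι (suc N)) 0<start
                (ι-mono-≤ {0} {suc a} z≤n) (ℚ.≤-trans (ι-mono-≤ {suc a} {N} a≤N) n≤start))
      ... | inj₁ (s≤s b≤N) with covers (suc a) b (s≤s z≤n) a≤N 1≤b b≤N
      ...   | i , i<k , on = suc (suc i) , s≤s (s≤s i<k) , on

    -- The new layer is a column on the left and a row on top; the half turn
    -- moves it to the right and the bottom, and the start to the top.
    spiral-step : Spiral (suc N) (suc (suc k))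
    spiral-step = record
      { turn    = λ i → half-turn (outer i)
      ; start   = ι (suc N)
      ; turn₀   = cong₂ _,_ (eq (ι (suc N))) (eq (ι (suc (suc N))))
      ; n≤start = ℚ.≤-refl
      ; turn-≢  = λ i i<2+k e → outer-≢ i i<2+k (half-turn-injective e)
      ; covers  = step-covers
      }
      where
      eq : ∀ c → c ℚ.- 0ℚ ≡ c
      eq = RingSolver.solve-∀ ℚ-ring

      step-covers : ∀ a b → 1 ℕ.≤ a → a ℕ.≤ suc N → 1 ℕ.≤ b → b ℕ.≤ suc N →
        ∃ λ i → i ℕ.< suc (suc k) × OnSegment (half-turn (outer i)) (half-turn (outer (suc i))) (ι a , ι b)
      step-covers (suc a) (suc b) _ a≤ _ (s≤s b≤N) = rotate
        (outer-covers (N ℕ.∸ a) (suc N ℕ.∸ b) (ℕ.m∸n≤m N a) (ℕ.m<n⇒0<n∸m (s≤s b≤N)) (ℕ.m∸n≤m (suc N) b))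
        where
        rotate : (∃ λ i → i ℕ.< suc (suc k) × OnSegment (outer i) (outer (suc i)) (ι (N ℕ.∸ a) , ι (suc N ℕ.∸ b))) →
          ∃ λ i → i ℕ.< suc (suc k) × OnSegment (half-turn (outer i)) (half-turn (outer (suc i))) (ι (suc a) , ι (suc b))
        rotate (i , i<2+k , on) = i , i<2+k ,
          subst (OnSegment (half-turn (outer i)) (half-turn (outer (suc i))))
            (trans (cong half-turn (sym (cong₂ _,_ (ι-∸ {suc N} {suc a} a≤) (ι-∸ {suc (suc N)} {suc b} (s≤s (ℕ.m≤n⇒m≤1+n b≤N))))))
              (half-turn-involutive (ι (suc a) , ι (suc b))))
            (half-turn-OnSegment {outer i} {outer (suc i)} on)

  -- The diagonal is prolonged beyond (3, 3) to (4, 4): the starting point has to be in row 4, at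
  -- abscissa 3 or further right, for the next layer to attach.
  nine-dots : Spiral 3 4
  nine-dots = record
    { turn    = turn
    ; start   = ι 4
    ; turn₀   = refl
    ; n≤start = ι-mono-≤ {3} {4} (ℕ.n≤1+n 3)
    ; turn-≢  = turn-≢
    ; covers  = covers
    }
    where
    turn : ℕ → ℚ²
    turn 0 = ι 4 , ι 4
    turn 1 = ι 1 , ι 1
    turn 2 = ι 4 , ι 1
    turn 3 = ι 1 , ι 4
    turn _ = ι 1 , ι 1

    turn-≢ : ∀ i → i ℕ.< 4 → turn i ≢ turn (suc i)
    turn-≢ 0 _ ()
    turn-≢ 1 _ ()
    turn-≢ 2 _ ()
    turn-≢ 3 _ ()
    turn-≢ (suc (suc (suc (suc _)))) (s≤s (s≤s (s≤s (s≤s ()))))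

    at : ∀ t i {a b} {_ : True (0ℚ ℚ.≤? t)} {_ : True (t ℚ.≤? 1ℚ)} {_ : True (i ℕ.<? 4)} →
      (ι a , ι b) ≡ mix t (turn i) (turn (suc i)) →
      ∃ λ i → i ℕ.< 4 × OnSegment (turn i) (turn (suc i)) (ι a , ι b)
    at t i {_} {_} {0≤t} {t≤1} {i<4} e = i , toWitness i<4 , t , toWitness 0≤t , toWitness t≤1 , e

    ⅓ ⅔ : ℚ
    ⅓ = + 1 ℚ./ 3
    ⅔ = + 2 ℚ./ 3

    covers : ∀ a b → 1 ℕ.≤ a → a ℕ.≤ 3 → 1 ℕ.≤ b → b ℕ.≤ 3 →
      ∃ λ i → i ℕ.< 4 × OnSegment (turn i) (turn (suc i)) (ι a , ι b)
    covers 1 1 _ _ _ _ = at 1ℚ 0 {1} {1} refl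
    covers 2 2 _ _ _ _ = at ⅔ 0 {2} {2} refl
    covers 3 3 _ _ _ _ = at ⅓ 0 {3} {3} refl
    covers 2 1 _ _ _ _ = at ⅓ 1 {2} {1} refl
    covers 3 1 _ _ _ _ = at ⅔ 1 {3} {1} refl
    covers 3 2 _ _ _ _ = at ⅓ 2 {3} {2} refl
    covers 2 3 _ _ _ _ = at ⅔ 2 {2} {3} refl
    covers 1 3 _ _ _ _ = at ⅓ 3 {1} {3} refl
    covers 1 2 _ _ _ _ = at ⅔ 3 {1} {2} refl
    covers (suc (suc (suc (suc _)))) _ _ (s≤s (s≤s (s≤s ()))) _ _
    covers 1 (suc (suc (suc (suc _)))) _ _ _ (s≤s (s≤s (s≤s ())))
    covers 2 (suc (suc (suc (suc _)))) _ _ _ (s≤s (s≤s (s≤s ())))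
    covers 3 (suc (suc (suc (suc _)))) _ _ _ (s≤s (s≤s (s≤s ())))

  spiral : ∀ j → Spiral (3 ℕ.+ j) (4 ℕ.+ double j)
  spiral zero    = nine-dots
  spiral (suc j) = spiral-step (spiral j)

  spiral-covers : ∀ j → CoverableWith (3 ℕ.+ j) (3 ℕ.+ j) (4 ℕ.+ double j)
  spiral-covers j = 
    path k (s≤s z≤n) turn turn-≢ , λ {x} → path-covers k (s≤s z≤n) turn turn-≢ (3 ℕ.+ j) (3 ℕ.+ j) covers {x}
    where
    k : ℕ
    k = 4 ℕ.+ double j
    open Spiral (spiral j)

-- Arithmetic of the bounds.

module Minimum where

  open import Data.Nat.Base
  open import Data.Nat.Properties
  import Data.Nat.Tactic.RingSolver as ℕSolver
  open import Data.Product.Base using (_×_; _,_)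
  open import Data.Sum.Base using (_⊎_; inj₁; inj₂; [_,_]′)
  open import Relation.Binary.PropositionalEquality
  open import Relation.Nullary.Decidable.Core using (yes; no)
  open import Relation.Nullary.Negation.Core using (¬_; contradiction)
  open import Defs using (CoverableWith; NoncrossingCoverableWith)
  open LowerBound
  open UpperBound
  open Snake
  open Spiral

  double≡2* : ∀ n → double n ≡ 2 * n
  double≡2* zero    = refl
  double≡2* (suc n) = trans (cong (λ z → suc (suc z)) (double≡2* n)) (eq n)
    where
    eq : ∀ n → 2 + 2 * n ≡ 2 * (1 + n)
    eq = ℕSolver.solve-∀

  snake-size : ∀ m → suc (double m) ≡ 2 * suc m ∸ 1
  snake-size m = cong (_∸ 1) {2 + double m} {2 * suc m} (double≡2* (suc m))

  transpose-coverable : ∀ {n m k} → NoncrossingCoverableWith n m k → NoncrossingCoverableWith m n k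
  transpose-coverable {n} {m} (π , nc , covers) =
    transposePath π , transpose-noncrossing π nc ,
    λ {x} → transpose-covers {n} {m} π (λ {y} → covers {y}) {x}

  noncrossing-upper : ∀ n m → 1 ≤ n → 1 ≤ m → NoncrossingCoverableWith n m (2 * (n ⊓ m) ∸ 1)
  noncrossing-upper n m 1≤n 1≤m with ≤-total n m
  noncrossing-upper (suc n) m 1≤n 1≤m | inj₁ n≤m = subst (NoncrossingCoverableWith (suc n) m)
          (trans (snake-size n) (cong (λ z → 2 * z ∸ 1) (sym (m≤n⇒m⊓n≡m n≤m))))
          (transpose-coverable (snake m n 1≤m))
  noncrossing-upper n (suc m) 1≤n 1≤m | inj₂ m≤n = subst (NoncrossingCoverableWith n (suc m))
          (trans (snake-size m) (cong (λ z → 2 * z ∸ 1) (sym (m≥n⇒m⊓n≡n m≤n))))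
          (snake n m 1≤n)

  forget-noncrossing : ∀ {n m k} → NoncrossingCoverableWith n m k → CoverableWith n m k
  forget-noncrossing (π , _ , covers) = π , λ {x} → covers {x}

  2*≡+ : ∀ n → 2 * n ≡ n + n
  2*≡+ n = cong (n +_) (+-identityʳ n)

  2*⊓≤ˡ : ∀ n m → 2 * (n ⊓ m) ≤ n + n
  2*⊓≤ˡ n m = ≤-trans (*-monoʳ-≤ 2 (m⊓n≤m n m)) (≤-reflexive (2*≡+ n))

  2*⊓≤ʳ : ∀ n m → 2 * (n ⊓ m) ≤ m + m
  2*⊓≤ʳ n m = ≤-trans (*-monoʳ-≤ 2 (m⊓n≤n n m)) (≤-reflexive (2*≡+ m))

  2*⊓≤+ : ∀ n m → 2 * (n ⊓ m) ≤ n + m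
  2*⊓≤+ n m = ≤-trans (≤-reflexive (2*≡+ (n ⊓ m))) (+-mono-≤ (m⊓n≤m n m) (m⊓n≤n n m))

  ≢⇒2*⊓<+ : ∀ n m → n ≢ m → 2 * (n ⊓ m) < n + m
  ≢⇒2*⊓<+ n m n≢m with ≤-total n m
  ... | inj₁ n≤m = subst (_< n + m) (trans (sym (2*≡+ n)) (cong (2 *_) (sym (m≤n⇒m⊓n≡m n≤m))))
          (+-monoʳ-< n (≤∧≢⇒< n≤m n≢m))
  ... | inj₂ m≤n = subst (_< n + m) (trans (sym (2*≡+ m)) (cong (2 *_) (sym (m≥n⇒m⊓n≡n m≤n))))
          (+-monoˡ-< m (≤∧≢⇒< m≤n (λ e → n≢m (sym e))))

  -- Evaluates the alternatives of `Bound` for all three claims at once: c is 1 + k for noncrossing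
  -- paths and for nonsquare or small grids, and 2 + k for squares. Only the case of a crossing is
  -- left to the caller.
  bound⇒2*⊓≤ : ∀ n m {k c} {X : Set} → 1 + k ≤ c → (n + m ≤ 2 + k → X → 2 * (n ⊓ m) ≤ c) →
    n + n ≤ 1 + k ⊎ m + m ≤ 1 + k ⊎ n + m ≤ 1 + k ⊎ (n + m ≤ 2 + k × X) → 2 * (n ⊓ m) ≤ c
  bound⇒2*⊓≤ n m 1+k≤c _ (inj₁ h)                     = ≤-trans (2*⊓≤ˡ n m) (≤-trans h 1+k≤c)
  bound⇒2*⊓≤ n m 1+k≤c _ (inj₂ (inj₁ h))              = ≤-trans (2*⊓≤ʳ n m) (≤-trans h 1+k≤c)
  bound⇒2*⊓≤ n m 1+k≤c _ (inj₂ (inj₂ (inj₁ h)))       = ≤-trans (2*⊓≤+ n m) (≤-trans h 1+k≤c)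
  bound⇒2*⊓≤ n m _ crossed (inj₂ (inj₂ (inj₂ (h , X)))) = crossed h X

  noncrossing-lower : ∀ n m k → NoncrossingCoverableWith n m k → 2 * (n ⊓ m) ∸ 1 ≤ k
  noncrossing-lower n m k (π , nc , covers) = m≤n+o⇒m∸n≤o (2 * (n ⊓ m)) 1
    (bound⇒2*⊓≤ n m {X = SidesCross π} ≤-refl (λ _ X → contradiction X (noncrossing⇒¬SidesCross π nc))
      (lower-bound {n} {m} {k} π (λ {x} → covers {x})))

  square-lower : ∀ n m k → CoverableWith n m k → 2 * (n ⊓ m) ∸ 2 ≤ k
  square-lower n m k (π , covers) = m≤n+o⇒m∸n≤o (2 * (n ⊓ m)) 2
    (bound⇒2*⊓≤ n m {X = SidesCross π} (n≤1+n (1 + k)) (λ h _ → ≤-trans (2*⊓≤+ n m) h)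
      (lower-bound {n} {m} {k} π (λ {x} → covers {x})))

  -- For n ≠ m the sum exceeds twice the minimum, which makes up for the side lost to the crossing.
  -- For n = m ≤ 2 the value 2 min(n, m) is at most 4, and three sides are enough.
  crossed-nonsquare : ∀ n m {k} → ¬ (n ≡ m × 3 ≤ n) → 3 ≤ k → n + m ≤ 2 + k → 2 * (n ⊓ m) ≤ 1 + k
  crossed-nonsquare n m not-square 3≤k h with n ≟ m
  ... | no n≢m = s≤s⁻¹ (≤-trans (≢⇒2*⊓<+ n m n≢m) h)
  ... | yes refl with <-≤-connex n 3
  ...   | inj₂ 3≤n = contradiction (refl , 3≤n) not-square
  ...   | inj₁ n<3 = ≤-trans (*-monoʳ-≤ 2 (≤-trans (m⊓n≤m n n) (s≤s⁻¹ n<3))) (s≤s 3≤k)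

  nonsquare-lower : ∀ n m → ¬ (n ≡ m × 3 ≤ n) → ∀ k → CoverableWith n m k → 2 * (n ⊓ m) ∸ 1 ≤ k
  nonsquare-lower n m not-square k (π , covers) = m≤n+o⇒m∸n≤o (2 * (n ⊓ m)) 1
    (bound⇒2*⊓≤ n m {X = SidesCross π} ≤-refl crossed (lower-bound {n} {m} {k} π (λ {x} → covers {x})))
    where
    crossed : n + m ≤ 2 + k → SidesCross π → 2 * (n ⊓ m) ≤ 1 + k
    -- A path that crosses itself has at least three sides, which supplies the hypothesis 3 ≤ k.
    crossed h X = [ (λ k<3 → contradiction X (two-sides⇒¬SidesCross π (s≤s⁻¹ k<3)))
                  , (λ 3≤k → crossed-nonsquare n m not-square 3≤k h) ]′ (<-≤-connex k 3)

  square-upper : ∀ n → 3 ≤ n → CoverableWith n n (2 * (n ⊓ n) ∸ 2)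
  square-upper (suc (suc (suc j))) _ = subst (CoverableWith n n)
    (cong (_∸ 2) {6 + double j} {2 * (n ⊓ n)} (trans (double≡2* n) (cong (2 *_) (sym (⊓-idem n)))))
    (spiral-covers j)
    where n = 3 + j
  square-upper (suc zero)       (s≤s ())
  square-upper (suc (suc zero)) (s≤s (s≤s ()))

open import Data.Nat.Base using (ℕ; _≤_; _*_; _∸_; _⊓_)
open import Data.Product.Base using (_×_; _,_)
open import Relation.Binary.PropositionalEquality using (_≡_; refl)
open import Relation.Nullary.Negation.Core using (¬_)
open import Defs using (CoverableWith; NoncrossingCoverableWith; IsMinimum)
open Minimum

theorem3 : ∀ (n m : ℕ) → 1 ≤ n → 1 ≤ m →
    ((n ≡ m × 3 ≤ n) → IsMinimum (CoverableWith n m) (2 * (n ⊓ m) ∸ 2)) ×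
    (¬ (n ≡ m × 3 ≤ n) → IsMinimum (CoverableWith n m) (2 * (n ⊓ m) ∸ 1)) ×
    IsMinimum (NoncrossingCoverableWith n m) (2 * (n ⊓ m) ∸ 1)
theorem3 n m 1≤n 1≤m =
  (λ { (refl , 3≤n) → square-upper n 3≤n , square-lower n n }) ,
  (λ not-square → forget-noncrossing (noncrossing-upper n m 1≤n 1≤m) , nonsquare-lower n m not-square) ,
  (noncrossing-upper n m 1≤n 1≤m , noncrossing-lower n m)
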